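{- For any $\mathbf{a}\in\mathbf{Z}^r$ ($r\geqslant0$), there exists a unique finitely supported family $(f_{\mathbf{b}})_{\mathbf{b}\in\mathscr{C}}$ of polynomials $f_{\mathbf{b}}\in\mathbf{Q}[T]$ such that for each $n\in\mathbf{N}$, $$\sigma(\mathbf{a})_n=\sum_{\mathbf{b}\in\mathscr{C}}f_{\mathbf{b}}(n)\,\sigma(\mathbf{b})_n.$$
   Context: $\mathscr{C}$ is the set of all compositions, i.e. finite sequences (possibly empty) of positive integers. For $r\geqslant1$, $\mathbf{s}=(s_1,\ldots,s_r)\in\mathbf{C}^r$ and $n\in\mathbf{N}$, $\sigma(\mathbf{s})_n=\sum_{n_1>\cdots>n_r>n}\binom{2n_1}{n_1}^{ -1}n_1^{ -s_1}\cdots n_r^{ -s_r}$ (absolutely convergent), and for $r=0$, $\sigma(\varnothing)_n=\binom{2n}{n}^{ -1}$. -}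

module Defs where

open import Data.Nat as ℕ using (ℕ; zero; suc; _∸_; _≤_)
open import Data.Nat.Combinatorics using (_C_)
open import Data.Integer as ℤ using (ℤ; +_; -[1+_])
open import Data.Rational as ℚ using (ℚ; 0ℚ; 1ℚ; _+_; _*_; _-_; ∣_∣; _<_)
open import Data.List using (List; []; _∷_; map)
open import Data.List.Relation.Unary.All using (All)
open import Data.List.Properties using (≡-dec)
open import Data.Product using (Σ; _×_; _,_; ∃-syntax)
open import Relation.Nullary using (yes; no)

-- reciprocal of a natural number (only ever used at positive arguments)
invℕ : ℕ → ℚ
invℕ zero = 0ℚ
invℕ (suc m) = (+ 1) ℚ./ (suc m)

-- m ^ (- s) for an integer exponent s (m ≥ 1 in all uses)
powNeg : ℕ → ℤ → ℚ
powNeg m (+ t) = invℕ (m ℕ.^ t)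
powNeg m -[1+ t ] = (+ (m ℕ.^ suc t)) ℚ./ 1

binInv : ℕ → ℚ
binInv m = invℕ ((2 ℕ.* m) C m)

Σ< : ℕ → (ℕ → ℚ) → ℚ
Σ< zero f = 0ℚ
Σ< (suc N) f = Σ< N f + f N

ΣOC : ℕ → ℕ → (ℕ → ℚ) → ℚ
ΣOC n N f = Σ< (N ∸ n) (λ j → f (suc (n ℕ.+ j)))

ΣOO : ℕ → ℕ → (ℕ → ℚ) → ℚ
ΣOO n m f = Σ< (m ∸ suc n) (λ j → f (suc (n ℕ.+ j)))

U : List ℤ → ℕ → ℕ → ℚ
U [] n m = 1ℚ
U (s ∷ ss) n m = ΣOO n m (λ k → powNeg k s * U ss n k)

-- Truncation at N of σ(s)_n:
--   σ(∅)_n = binom(2n,n)^{-1},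
--   σ(s)_n truncated = Σ_{N ≥ n_1 > ... > n_r > n} binom(2n_1,n_1)^{-1} n_1^{-s_1} ... n_r^{-s_r}
σTrunc : List ℤ → ℕ → ℕ → ℚ
σTrunc [] n N = binInv n
σTrunc (s ∷ ss) n N = ΣOC n N (λ m → binInv m * powNeg m s * U ss n m)

Tends0 : (ℕ → ℚ) → Set
Tends0 d = ∀ (ε : ℚ) → 0ℚ < ε → ∃[ N₀ ] (∀ N → N₀ ≤ N → ∣ d N ∣ < ε)

-- polynomials in ℚ[T] as coefficient lists (constant term first)
Poly : Set
Poly = List ℚ

eval : Poly → ℚ → ℚ
eval [] x = 0ℚ
eval (c ∷ cs) x = c + x * eval cs x

coeff : Poly → ℕ → ℚ
coeff [] k = 0ℚ
coeff (c ∷ cs) zero = c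
coeff (c ∷ cs) (suc k) = coeff cs k

IsComposition : List ℕ → Set
IsComposition b = All (λ x → 0 ℕ.< x) b

Composition : Set
Composition = Σ (List ℕ) IsComposition

-- a finitely supported family (f_b)_{b ∈ 𝒞} of polynomials, given as a finite
-- list of entries (b , p); f_b is the sum of the p's attached to b
Family : Set
Family = List (Composition × Poly)

famCoeff : Family → List ℕ → ℕ → ℚ
famCoeff [] b k = 0ℚ
famCoeff (((c , _) , p) ∷ F) b k with ≡-dec ℕ._≟_ c b
... | yes _ = coeff p k + famCoeff F b k
... | no _ = famCoeff F b k

famTrunc : Family → ℕ → ℕ → ℚ
famTrunc [] n N = 0ℚ
famTrunc (((c , _) , p) ∷ F) n N =
  eval p ((+ n) ℚ./ 1) * σTrunc (map +_ c) n N + famTrunc F n N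

-- σ(a)_n = Σ_b f_b(n) σ(b)_n  (both sides are limits of their truncations)
Represents : List ℤ → Family → ℕ → Set
Represents a F n = Tends0 (λ N → σTrunc a n N - famTrunc F n N)

{-# OPTIONS --safe #-}
module Submission where

-- Write τ for the shift n ↦ n - 1.  Then τ σ(b,t) = σ(b,t) + n^(-t) σ(b) and τ σ(∅) = (4 - 2/n) σ(∅).
--
-- Existence: σ(a) is obtained from σ(∅) by iterating tail sums Σ_{m>n} m^(-t) ( · ), so it suffices that tail sums
-- of n^k σ(b) are combinations of the required kind.  For k < 0 this is a new σ.  For k ≥ 0, telescoping
-- n^(k+1) σ(b) (for b ≠ ∅) or n^k σ(∅) reduces to lower k, to shorter b and to σ(1); the truncation errors
-- are all O(N^c 2^(-N)).
--
-- Uniqueness: the σ(b) are linearly independent over Q(n).  In a relation clear the denominators of the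
-- coefficients of maximal depth and apply τ - 1 until these are constants; one further application of τ - 1
-- and induction on the depth give h(n) = ρ(n) h(n-1) + Σ c_t n^(-t) with h rational and ρ = 1 or ρ = 4 - 2/n.
-- The poles of such an h cannot cancel, so h is a polynomial, and comparing coefficients gives c = 0.

open import Defs
open import Data.Empty using (⊥)
open import Data.Integer as ℤ using (ℤ)
import Data.Integer.Properties as ℤₚ
open import Data.List using (List; []; _∷_; map; length; replicate; reverse; take; drop; _++_; _∷ʳ_)
open import Data.List.Properties using (≡-dec; length-map; map-id; map-∘; reverse-involutive; reverse-map; unfold-reverse)
open import Data.List.Relation.Unary.All as All using (All; []; _∷_)
import Data.List.Relation.Unary.All.Properties as Allₚ
open import Data.Nat as ℕ using (ℕ; zero; suc; _∸_; z≤n; s≤s; _!)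
open import Data.Nat.Combinatorics using (k![n∸k]!∣n!) renaming (_C_ to _choose_)
open import Data.Nat.Combinatorics.Specification using (nCk≡n!/k![n-k]!)
open import Data.Nat.DivMod using (m/n*n≡m; m/n*n≤m; m≡m%n+[m/n]*n; m%n<n)
import Data.Nat.Properties as ℕₚ
open import Data.Nat.Tactic.RingSolver using () renaming (solve-∀ to solveℕ-∀)
open import Data.Product using (Σ; _×_; _,_; ∃-syntax; proj₁; proj₂; uncurry)
open import Data.Rational as ℚ using (ℚ; 0ℚ; 1ℚ; _+_; _*_; _-_; -_; ∣_∣; _<_; _≤_; toℚᵘ)
open import Data.Rational.Properties
open import Data.Rational.Unnormalised.Base as ℚᵘ using (mkℚᵘ; *≡*; *≤*)
import Data.Rational.Unnormalised.Properties as ℚᵘₚ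
open import Data.Sum using (_⊎_; inj₁; inj₂; [_,_]′)
open import Function using (_∘_; _$_)
open import Relation.Binary.PropositionalEquality
open import Relation.Nullary using (Dec; yes; no; contradiction)
open import Relation.Nullary.Decidable using (dec⇒maybe)
open import Tactic.RingSolver using (solve-∀)
open import Tactic.RingSolver.Core.AlmostCommutativeRing using (AlmostCommutativeRing; fromCommutativeRing)

-- Rational arithmetic

-- No real numbers occur. At a fixed truncation `N` the recursions of `σTrunc` in `n` are exact as
-- long as `n < N`, so all algebra is done on truncated sums. The one inexact ingredient is the
-- boundary term left at `N` by telescoping n^k σ(∅). Its size must be controlled uniformly in
-- `n ≤ N`, because every further tail sum adds up the errors of the previous one over `n`.
--
-- The obstacle in the uniqueness part is that τ creates coefficients n^(-t): polynomials are not a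
-- stable class, so the induction on the depth has to be run for rational coefficients. These are
-- treated as functions on ℕ some nonzero polynomial multiple of which is eventually polynomial.
-- Statements about poles then become statements about the ideal of such multipliers, and neither a
-- field of fractions nor a factorisation into irreducibles is used. The price is that identities
-- between coefficients hold only from some index on; this is harmless, since in the end a
-- polynomial is determined by its values at large integers.

ℚring : AlmostCommutativeRing _ _
ℚring = fromCommutativeRing +-*-commutativeRing (λ x → dec⇒maybe (0ℚ ≟ x))

abstract
  -- Opaque, so that the gcd normalisation inside `ℚ._/_` is not unfolded; `ι-def` leads back to the
  -- form used in the definitions.
  ι : ℕ → ℚ
  ι n = ℤ.+ n ℚ./ 1

  ι-def : ∀ n → ι n ≡ ℤ.+ n ℚ./ 1
  ι-def n = refl

  toℚᵘ-ι : ∀ n → toℚᵘ (ι n) ℚᵘ.≃ mkℚᵘ (ℤ.+ n) 0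
  toℚᵘ-ι n = toℚᵘ-fromℚᵘ (mkℚᵘ (ℤ.+ n) 0)

  ι-0 : ι 0 ≡ 0ℚ
  ι-0 = refl

  ι-1 : ι 1 ≡ 1ℚ
  ι-1 = refl

  ι-+ : ∀ m n → ι (m ℕ.+ n) ≡ ι m + ι n
  ι-+ m n = toℚᵘ-injective (begin
    toℚᵘ (ι (m ℕ.+ n))                    ≈⟨ toℚᵘ-ι (m ℕ.+ n) ⟩
    mkℚᵘ (ℤ.+ (m ℕ.+ n)) 0                  ≈⟨ *≡* (cong (ℤ._* ℤ.+ 1) (sym (cong₂ ℤ._+_ (ℤₚ.*-identityʳ (ℤ.+ m)) (ℤₚ.*-identityʳ (ℤ.+ n))))) ⟩
    mkℚᵘ (ℤ.+ m) 0 ℚᵘ.+ mkℚᵘ (ℤ.+ n) 0        ≈⟨ ℚᵘₚ.+-cong (ℚᵘₚ.≃-sym (toℚᵘ-ι m)) (ℚᵘₚ.≃-sym (toℚᵘ-ι n)) ⟩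
    toℚᵘ (ι m) ℚᵘ.+ toℚᵘ (ι n)            ≈⟨ ℚᵘₚ.≃-sym (toℚᵘ-homo-+ (ι m) (ι n)) ⟩
    toℚᵘ (ι m + ι n)                      ∎)
    where open ℚᵘₚ.≃-Reasoning

  ι-* : ∀ m n → ι (m ℕ.* n) ≡ ι m * ι n
  ι-* m n = toℚᵘ-injective (begin
    toℚᵘ (ι (m ℕ.* n))                    ≈⟨ toℚᵘ-ι (m ℕ.* n) ⟩
    mkℚᵘ (ℤ.+ (m ℕ.* n)) 0                  ≈⟨ *≡* (cong (ℤ._* ℤ.+ 1) (ℤₚ.pos-* m n)) ⟩
    mkℚᵘ (ℤ.+ m) 0 ℚᵘ.* mkℚᵘ (ℤ.+ n) 0        ≈⟨ ℚᵘₚ.*-cong (ℚᵘₚ.≃-sym (toℚᵘ-ι m)) (ℚᵘₚ.≃-sym (toℚᵘ-ι n)) ⟩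
    toℚᵘ (ι m) ℚᵘ.* toℚᵘ (ι n)            ≈⟨ ℚᵘₚ.≃-sym (toℚᵘ-homo-* (ι m) (ι n)) ⟩
    toℚᵘ (ι m * ι n)                      ∎)
    where open ℚᵘₚ.≃-Reasoning

  ι-mono-≤ : ∀ {m n} → m ℕ.≤ n → ι m ≤ ι n
  ι-mono-≤ {m} {n} m≤n = toℚᵘ-cancel-≤
    (ℚᵘₚ.≤-respˡ-≃ (ℚᵘₚ.≃-sym (toℚᵘ-ι m)) (ℚᵘₚ.≤-respʳ-≃ (ℚᵘₚ.≃-sym (toℚᵘ-ι n))
      (*≤* (ℤₚ.*-monoʳ-≤-nonNeg (ℤ.+ 1) (ℤ.+≤+ m≤n)))))

  ι-inv : ∀ n → ι (suc n) * invℕ (suc n) ≡ 1ℚ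
  ι-inv n = toℚᵘ-injective (begin
    toℚᵘ (ι (suc n) * invℕ (suc n))       ≈⟨ toℚᵘ-homo-* (ι (suc n)) (invℕ (suc n)) ⟩
    toℚᵘ (ι (suc n)) ℚᵘ.* toℚᵘ (invℕ (suc n)) ≈⟨ ℚᵘₚ.*-cong (toℚᵘ-ι (suc n)) (toℚᵘ-fromℚᵘ (mkℚᵘ (ℤ.+ 1) n)) ⟩
    mkℚᵘ (ℤ.+ suc n) 0 ℚᵘ.* mkℚᵘ (ℤ.+ 1) n    ≈⟨ *≡* (cong ℤ.+_ (lem n)) ⟩
    mkℚᵘ (ℤ.+ 1) 0                          ∎)
    where
    open ℚᵘₚ.≃-Reasoning
    lem : ∀ n → suc (n ℕ.* 1) ℕ.* 1 ≡ suc (n ℕ.+ 0 ℕ.+ 0)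
    lem = solveℕ-∀

  archimedean : ∀ p → ∃[ n ] p ≤ ι n
  archimedean (ℚ.mkℚ (ℤ.+ a) d _) = a , toℚᵘ-cancel-≤ (ℚᵘₚ.≤-respʳ-≃ (ℚᵘₚ.≃-sym (toℚᵘ-ι a))
    (*≤* (subst₂ ℤ._≤_ (ℤₚ.pos-* a 1) (ℤₚ.pos-* a (suc d)) (ℤ.+≤+ (ℕₚ.*-monoʳ-≤ a (s≤s z≤n))))))
  archimedean (ℚ.mkℚ ℤ.-[1+ a ] d _) = 0 , toℚᵘ-cancel-≤ (*≤* ℤ.-≤+)

2ℚ 3ℚ 4ℚ : ℚ
2ℚ = ℤ.+ 2 ℚ./ 1
3ℚ = ℤ.+ 3 ℚ./ 1
4ℚ = ℤ.+ 4 ℚ./ 1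

inv-unique : ∀ {a b c} → a * b ≡ 1ℚ → a * c ≡ 1ℚ → b ≡ c
inv-unique {a} {b} {c} ab ac = begin
  b            ≡⟨ sym (*-identityˡ b) ⟩
  1ℚ * b       ≡⟨ cong (_* b) (sym ac) ⟩
  a * c * b    ≡⟨ lem a b c ⟩
  a * b * c    ≡⟨ cong (_* c) ab ⟩
  1ℚ * c       ≡⟨ *-identityˡ c ⟩
  c ∎
  where
  open ≡-Reasoning
  lem : ∀ a b c → a * c * b ≡ a * b * c
  lem = solve-∀ ℚring

inverse : ∀ {q} → q ≢ 0ℚ → ∃[ r ] q * r ≡ 1ℚ
inverse {q} q≢0 = (ℚ.1/ q) {{ℚ.≢-nonZero q≢0}} , *-inverseʳ q {{ℚ.≢-nonZero q≢0}}

*-cancel-0 : ∀ {x y} → x ≢ 0ℚ → x * y ≡ 0ℚ → y ≡ 0ℚ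
*-cancel-0 {x} {y} x≢0 xy≡0 with inverse x≢0
... | r , xr≡1 = begin
  y             ≡⟨ sym (*-identityˡ y) ⟩
  1ℚ * y        ≡⟨ cong (_* y) (sym xr≡1) ⟩
  x * r * y     ≡⟨ lem x r y ⟩
  r * (x * y)   ≡⟨ cong (r *_) xy≡0 ⟩
  r * 0ℚ        ≡⟨ *-zeroʳ r ⟩
  0ℚ            ∎
  where
  open ≡-Reasoning
  lem : ∀ x r y → x * r * y ≡ r * (x * y)
  lem = solve-∀ ℚring

*-≢0 : ∀ {x y} → x ≢ 0ℚ → y ≢ 0ℚ → x * y ≢ 0ℚ
*-≢0 x≢0 y≢0 = y≢0 ∘ *-cancel-0 x≢0

unit≢0 : ∀ {x y} → x * y ≡ 1ℚ → x ≢ 0ℚ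
unit≢0 {y = y} xy refl = 1≢0 (trans (sym xy) (*-zeroˡ y))

-≡0⇒≡ : ∀ {x y} → x - y ≡ 0ℚ → x ≡ y
-≡0⇒≡ {x} {y} e = trans (lem x y) (trans (cong (_+ y) e) (+-identityˡ y))
  where
  lem : ∀ x y → x ≡ (x - y) + y
  lem = solve-∀ ℚring

≡⇒-≡0 : ∀ {x y} → x ≡ y → x - y ≡ 0ℚ
≡⇒-≡0 {x} refl = +-inverseʳ x

ι-suc : ∀ n → ι (suc n) ≡ ι n + 1ℚ
ι-suc n = trans (trans (ι-+ 1 n) (cong (_+ ι n) ι-1)) (+-comm 1ℚ (ι n))

ι-suc≢0 : ∀ n → ι (suc n) ≢ 0ℚ
ι-suc≢0 n = unit≢0 (ι-inv n)

0≤ι : ∀ n → 0ℚ ≤ ι n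
0≤ι n = subst (_≤ ι n) ι-0 (ι-mono-≤ z≤n)

invℕ-* : ∀ m n → invℕ (m ℕ.* n) ≡ invℕ m * invℕ n
invℕ-* zero n = sym (*-zeroˡ (invℕ n))
invℕ-* (suc m) zero = trans (cong invℕ (ℕₚ.*-zeroʳ m)) (sym (*-zeroʳ (invℕ (suc m))))
invℕ-* (suc m) (suc n) = inv-unique {ι (suc m ℕ.* suc n)} (ι-inv (n ℕ.+ m ℕ.* suc n)) (begin
  ι (suc m ℕ.* suc n) * (invℕ (suc m) * invℕ (suc n)) ≡⟨ cong (_* (invℕ (suc m) * invℕ (suc n))) (ι-* (suc m) (suc n)) ⟩
  ι (suc m) * ι (suc n) * (invℕ (suc m) * invℕ (suc n)) ≡⟨ lem (ι (suc m)) (ι (suc n)) (invℕ (suc m)) (invℕ (suc n)) ⟩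
  (ι (suc m) * invℕ (suc m)) * (ι (suc n) * invℕ (suc n)) ≡⟨ cong₂ _*_ (ι-inv m) (ι-inv n) ⟩
  1ℚ * 1ℚ ≡⟨ *-identityˡ 1ℚ ⟩
  1ℚ ∎)
  where
  open ≡-Reasoning
  lem : ∀ a b c d → a * b * (c * d) ≡ (a * c) * (b * d)
  lem = solve-∀ ℚring

infixr 8 _^_
_^_ : ℚ → ℕ → ℚ
x ^ zero  = 1ℚ
x ^ suc k = x * x ^ k

^-≢0 : ∀ {x} k → x ≢ 0ℚ → x ^ k ≢ 0ℚ
^-≢0 zero x≢0 = 1≢0
^-≢0 (suc k) x≢0 = *-≢0 x≢0 (^-≢0 k x≢0)

ι-^ : ∀ m k → ι (m ℕ.^ k) ≡ ι m ^ k
ι-^ m zero = ι-1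
ι-^ m (suc k) = trans (ι-* m (m ℕ.^ k)) (cong (ι m *_) (ι-^ m k))

-- One rule for all integer exponents, across the change of sign. It lets a polynomial factor be
-- absorbed into a power, see `TailRep-powNeg*eval`.
powNeg-pred : ∀ n a → powNeg (suc n) (ℤ.pred a) ≡ ι (suc n) * powNeg (suc n) a
powNeg-pred n (ℤ.+ zero) = begin
  ℤ.+ (suc n ℕ.* 1) ℚ./ 1      ≡⟨ cong (λ k →  ℤ.+ k ℚ./ 1) (ℕₚ.*-identityʳ (suc n)) ⟩
  ℤ.+ suc n ℚ./ 1              ≡⟨ sym (ι-def (suc n)) ⟩
  ι (suc n)                  ≡⟨ sym (*-identityʳ _) ⟩
  ι (suc n) * 1ℚ ∎
  where open ≡-Reasoning
powNeg-pred n (ℤ.+ suc t) = begin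
  invℕ (suc n ℕ.^ t)                                    ≡⟨ sym (*-identityˡ _) ⟩
  1ℚ * invℕ (suc n ℕ.^ t)                               ≡⟨ cong (_* invℕ (suc n ℕ.^ t)) (sym (ι-inv n)) ⟩
  ι (suc n) * invℕ (suc n) * invℕ (suc n ℕ.^ t)         ≡⟨ *-assoc (ι (suc n)) _ _ ⟩
  ι (suc n) * (invℕ (suc n) * invℕ (suc n ℕ.^ t))       ≡⟨ cong (ι (suc n) *_) (sym (invℕ-* (suc n) (suc n ℕ.^ t))) ⟩
  ι (suc n) * invℕ (suc n ℕ.* suc n ℕ.^ t)              ∎
  where open ≡-Reasoning
powNeg-pred n ℤ.-[1+ t ] = begin
  ℤ.+ (suc n ℕ.* suc n ℕ.^ suc t) ℚ./ 1           ≡⟨ sym (ι-def (suc n ℕ.* suc n ℕ.^ suc t)) ⟩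
  ι (suc n ℕ.* suc n ℕ.^ suc t)                 ≡⟨ ι-* (suc n) (suc n ℕ.^ suc t) ⟩
  ι (suc n) * ι (suc n ℕ.^ suc t)               ≡⟨ cong (ι (suc n) *_) (ι-def (suc n ℕ.^ suc t)) ⟩
  ι (suc n) * (ℤ.+ (suc n ℕ.^ suc t) ℚ./ 1)       ∎
  where open ≡-Reasoning

∣invℕ∣≤1 : ∀ n → ∣ invℕ n ∣ ≤ 1ℚ
∣invℕ∣≤1 zero = subst (0ℚ ≤_) ι-1 (0≤ι 1)
∣invℕ∣≤1 (suc n) = begin
  ∣ invℕ (suc n) ∣                 ≡⟨ sym (*-identityˡ _) ⟩
  1ℚ * ∣ invℕ (suc n) ∣            ≤⟨ *-monoʳ-≤-nonNeg ∣ invℕ (suc n) ∣ {{∣-∣-nonNeg (invℕ (suc n))}} 1≤ ⟩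
  ι (suc n) * ∣ invℕ (suc n) ∣     ≡⟨ cong (_* ∣ invℕ (suc n) ∣) (sym (0≤p⇒∣p∣≡p (0≤ι (suc n)))) ⟩
  ∣ ι (suc n) ∣ * ∣ invℕ (suc n) ∣ ≡⟨ sym (∣p*q∣≡∣p∣*∣q∣ (ι (suc n)) (invℕ (suc n))) ⟩
  ∣ ι (suc n) * invℕ (suc n) ∣     ≡⟨ cong ∣_∣ (ι-inv n) ⟩
  1ℚ ∎
  where
  open ≤-Reasoning
  1≤ : 1ℚ ≤ ι (suc n)
  1≤ = subst (_≤ ι (suc n)) ι-1 (ι-mono-≤ (s≤s z≤n))

∣powNeg∣≤ : ∀ m a → ∣ powNeg m a ∣ ≤ ι (suc m ℕ.^ ℤ.∣ a ∣)
∣powNeg∣≤ m (ℤ.+ t) = ≤-trans (∣invℕ∣≤1 (m ℕ.^ t))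
  (subst (_≤ ι (suc m ℕ.^ t)) ι-1 (ι-mono-≤ (ℕₚ.m^n>0 (suc m) t)))
∣powNeg∣≤ m ℤ.-[1+ t ] = ≤-trans (≤-reflexive (trans (cong ∣_∣ (sym (ι-def (m ℕ.^ suc t)))) (0≤p⇒∣p∣≡p (0≤ι (m ℕ.^ suc t)))))
  (ι-mono-≤ (ℕₚ.^-monoˡ-≤ (suc t) (ℕₚ.n≤1+n m)))

-- Central binomial coefficients

central-! : ∀ n → ((2 ℕ.* n) choose n) ℕ.* (n ! ℕ.* n !) ≡ (2 ℕ.* n) !
central-! n = begin
  ((2 ℕ.* n) choose n) ℕ.* (n ! ℕ.* n !)               ≡⟨ cong (λ k → ((2 ℕ.* n) choose n) ℕ.* (n ! ℕ.* k !)) (sym 2n∸n) ⟩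
  ((2 ℕ.* n) choose n) ℕ.* d                           ≡⟨ cong (ℕ._* d) (nCk≡n!/k![n-k]! n≤2n) ⟩
  ((2 ℕ.* n) ! ℕ./ d) {{nz}} ℕ.* d                ≡⟨ m/n*n≡m {{nz}} (k![n∸k]!∣n! n≤2n) ⟩
  (2 ℕ.* n) !                                     ∎
  where
  open ≡-Reasoning
  n≤2n : n ℕ.≤ 2 ℕ.* n
  n≤2n = ℕₚ.m≤m+n n _
  2n∸n : 2 ℕ.* n ∸ n ≡ n
  2n∸n = trans (ℕₚ.m+n∸m≡n n (n ℕ.+ 0)) (ℕₚ.+-identityʳ n)
  d = n ! ℕ.* (2 ℕ.* n ∸ n) !
  nz : ℕ.NonZero d
  nz = ℕₚ.m*n≢0 (n !) _ {{ℕₚ._!≢0 n}} {{ℕₚ._!≢0 (2 ℕ.* n ∸ n)}}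

central-suc : ∀ n → suc n ℕ.* ((2 ℕ.* suc n) choose suc n) ≡ (4 ℕ.* n ℕ.+ 2) ℕ.* ((2 ℕ.* n) choose n)
central-suc n = ℕₚ.*-cancelʳ-≡ _ _ (suc n ℕ.* (n ! ℕ.* n !)) {{nz}} (begin
  suc n ℕ.* C′ ℕ.* (suc n ℕ.* (f ℕ.* f))        ≡⟨ lem₁ n C′ f ⟩
  C′ ℕ.* (suc n ! ℕ.* suc n !)                  ≡⟨ central-! (suc n) ⟩
  (2 ℕ.* suc n) !                               ≡⟨ cong _! (lem₂ n) ⟩
  suc (suc (2 ℕ.* n)) !                         ≡⟨⟩
  suc (suc (2 ℕ.* n)) ℕ.* (suc (2 ℕ.* n) ℕ.* (2 ℕ.* n) !) ≡⟨ cong (λ k → suc (suc (2 ℕ.* n)) ℕ.* (suc (2 ℕ.* n) ℕ.* k)) (sym (central-! n)) ⟩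
  suc (suc (2 ℕ.* n)) ℕ.* (suc (2 ℕ.* n) ℕ.* (C₀ ℕ.* (f ℕ.* f))) ≡⟨ lem₃ n C₀ f ⟩
  (4 ℕ.* n ℕ.+ 2) ℕ.* C₀ ℕ.* (suc n ℕ.* (f ℕ.* f)) ∎)
  where
  open ≡-Reasoning
  C′ = (2 ℕ.* suc n) choose suc n
  C₀ = (2 ℕ.* n) choose n
  f = n !
  nz : ℕ.NonZero (suc n ℕ.* (n ! ℕ.* n !))
  nz = ℕₚ.m*n≢0 (suc n) _ {{_}} {{ℕₚ.m*n≢0 (n !) (n !) {{ℕₚ._!≢0 n}} {{ℕₚ._!≢0 n}}}}
  lem₁ : ∀ n c f → suc n ℕ.* c ℕ.* (suc n ℕ.* (f ℕ.* f)) ≡ c ℕ.* ((suc n ℕ.* f) ℕ.* (suc n ℕ.* f))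
  lem₁ = solveℕ-∀
  lem₂ : ∀ n → 2 ℕ.* suc n ≡ suc (suc (2 ℕ.* n))
  lem₂ = solveℕ-∀
  lem₃ : ∀ n c f → suc (suc (2 ℕ.* n)) ℕ.* (suc (2 ℕ.* n) ℕ.* (c ℕ.* (f ℕ.* f))) ≡ (4 ℕ.* n ℕ.+ 2) ℕ.* c ℕ.* (suc n ℕ.* (f ℕ.* f))
  lem₃ = solveℕ-∀

-- The ratio of consecutive terms is (4n + 2)/(n + 1) ≥ 2. This exponential growth is the only
-- source of convergence in the proof.
2^n≤central : ∀ n → 2 ℕ.^ n ℕ.≤ (2 ℕ.* n) choose n
2^n≤central zero = s≤s z≤n
2^n≤central (suc n) = ℕₚ.≤-trans (ℕₚ.*-monoʳ-≤ 2 (2^n≤central n)) (ℕₚ.*-cancelˡ-≤ (suc n) (begin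
  suc n ℕ.* (2 ℕ.* c)                    ≡⟨ lem n c ⟩
  (2 ℕ.* n ℕ.+ 2) ℕ.* c                  ≤⟨ ℕₚ.*-monoˡ-≤ c (ℕₚ.+-monoˡ-≤ 2 (ℕₚ.*-monoˡ-≤ n (s≤s (s≤s (z≤n {2}))))) ⟩
  (4 ℕ.* n ℕ.+ 2) ℕ.* c                  ≡⟨ sym (central-suc n) ⟩
  suc n ℕ.* ((2 ℕ.* suc n) choose suc n)      ∎))
  where
  open ℕₚ.≤-Reasoning
  c = (2 ℕ.* n) choose n
  lem : ∀ n c → suc n ℕ.* (2 ℕ.* c) ≡ (2 ℕ.* n ℕ.+ 2) ℕ.* c
  lem = solveℕ-∀

invℕ-inverse : ∀ m → 0 ℕ.< m → ι m * invℕ m ≡ 1ℚ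
invℕ-inverse (suc m) _ = ι-inv m

0≤invℕ : ∀ m → 0ℚ ≤ invℕ m
0≤invℕ zero = ≤-refl
0≤invℕ (suc m) = nonNegative⁻¹ (invℕ (suc m)) {{normalize-nonNeg 1 (suc m)}}

invℕ-anti : ∀ m n → 0 ℕ.< m → m ℕ.≤ n → invℕ n ≤ invℕ m
invℕ-anti m n 0<m m≤n = begin
  invℕ n                     ≡⟨ sym (*-identityʳ _) ⟩
  invℕ n * 1ℚ                ≡⟨ cong (invℕ n *_) (sym (invℕ-inverse m 0<m)) ⟩
  invℕ n * (ι m * invℕ m)    ≡⟨ lem (invℕ n) (ι m) (invℕ m) ⟩
  ι m * (invℕ n * invℕ m)    ≤⟨ *-monoʳ-≤-nonNeg (invℕ n * invℕ m) {{nn}} (ι-mono-≤ m≤n) ⟩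
  ι n * (invℕ n * invℕ m)    ≡⟨ sym (*-assoc (ι n) _ _) ⟩
  ι n * invℕ n * invℕ m      ≡⟨ cong (_* invℕ m) (invℕ-inverse n (ℕₚ.<-≤-trans 0<m m≤n)) ⟩
  1ℚ * invℕ m                ≡⟨ *-identityˡ _ ⟩
  invℕ m ∎
  where
  open ≤-Reasoning
  lem : ∀ a b c → a * (b * c) ≡ b * (a * c)
  lem = solve-∀ ℚring
  nn = nonNeg*nonNeg⇒nonNeg (invℕ n) {{ℚ.nonNegative (0≤invℕ n)}} (invℕ m) {{ℚ.nonNegative (0≤invℕ m)}}

binInv≤ : ∀ n → binInv n ≤ invℕ (2 ℕ.^ n)
binInv≤ n = invℕ-anti (2 ℕ.^ n) _ (ℕₚ.m^n>0 2 n) (2^n≤central n)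

central>0 : ∀ n → 0 ℕ.< (2 ℕ.* n) choose n
central>0 n = ℕₚ.<-≤-trans (ℕₚ.m^n>0 2 n) (2^n≤central n)

binInv≢0 : ∀ n → binInv n ≢ 0ℚ
binInv≢0 n = unit≢0 {y = ι ((2 ℕ.* n) choose n)} (trans (*-comm (binInv n) _) (invℕ-inverse _ (central>0 n)))

ρ₀ : ℕ → ℚ
ρ₀ n = 4ℚ - 2ℚ * invℕ n

ι-4n+2 : ∀ n → ι (4 ℕ.* n ℕ.+ 2) ≡ 4ℚ * ι (suc n) - 2ℚ
ι-4n+2 n = begin
  ι (4 ℕ.* n ℕ.+ 2)                     ≡⟨ lem (ι (4 ℕ.* n ℕ.+ 2)) 2ℚ ⟩
  ι (4 ℕ.* n ℕ.+ 2) + 2ℚ - 2ℚ           ≡⟨ cong (_- 2ℚ) (sym (trans (ι-+ (4 ℕ.* n ℕ.+ 2) 2) (cong (ι (4 ℕ.* n ℕ.+ 2) +_) (ι-def 2)))) ⟩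
  ι (4 ℕ.* n ℕ.+ 2 ℕ.+ 2) - 2ℚ          ≡⟨ cong (λ k → ι k - 2ℚ) (four n) ⟩
  ι (4 ℕ.* suc n) - 2ℚ                  ≡⟨ cong (_- 2ℚ) (trans (ι-* 4 (suc n)) (cong (_* ι (suc n)) (ι-def 4))) ⟩
  4ℚ * ι (suc n) - 2ℚ                   ∎
  where
  open ≡-Reasoning
  lem : ∀ a b → a ≡ a + b - b
  lem = solve-∀ ℚring
  four : ∀ n → 4 ℕ.* n ℕ.+ 2 ℕ.+ 2 ≡ 4 ℕ.* suc n
  four = solveℕ-∀

binInv-suc : ∀ n → binInv n ≡ ρ₀ (suc n) * binInv (suc n)
binInv-suc n = begin
  b                                     ≡⟨ sym (*-identityʳ b) ⟩
  b * 1ℚ                                ≡⟨ cong (b *_) (sym c′b′) ⟩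
  b * (c′ * b′)                         ≡⟨ cong (λ z → b * (z * b′)) eq ⟩
  b * (r * c * b′)                      ≡⟨ lem₂ b r c b′ ⟩
  r * b′ * (c * b)                      ≡⟨ cong (r * b′ *_) cb ⟩
  r * b′ * 1ℚ                           ≡⟨ *-identityʳ _ ⟩
  r * b′ ∎
  where
  open ≡-Reasoning
  b = binInv n
  b′ = binInv (suc n)
  c = ι ((2 ℕ.* n) choose n)
  c′ = ι ((2 ℕ.* suc n) choose suc n)
  r = ρ₀ (suc n)
  i = invℕ (suc n)
  x = ι (suc n)
  cb : c * b ≡ 1ℚ
  cb = invℕ-inverse _ (central>0 n)
  c′b′ : c′ * b′ ≡ 1ℚ
  c′b′ = invℕ-inverse _ (central>0 (suc n))
  lem₂ : ∀ b r c b′ → b * (r * c * b′) ≡ r * b′ * (c * b)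
  lem₂ = solve-∀ ℚring
  lem₃ : ∀ i x → (x * i) * 4ℚ - 2ℚ * i ≡ i * (4ℚ * x - 2ℚ)
  lem₃ = solve-∀ ℚring
  r≡ : r ≡ i * ι (4 ℕ.* n ℕ.+ 2)
  r≡ = begin
    4ℚ - 2ℚ * i                  ≡⟨ cong (_- 2ℚ * i) (sym (*-identityˡ 4ℚ)) ⟩
    1ℚ * 4ℚ - 2ℚ * i             ≡⟨ cong (λ z → z * 4ℚ - 2ℚ * i) (sym (ι-inv n)) ⟩
    (x * i) * 4ℚ - 2ℚ * i        ≡⟨ lem₃ i x ⟩
    i * (4ℚ * x - 2ℚ)            ≡⟨ cong (i *_) (sym (ι-4n+2 n)) ⟩
    i * ι (4 ℕ.* n ℕ.+ 2)          ∎
  eq : c′ ≡ r * c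
  eq = begin
    c′                             ≡⟨ sym (*-identityˡ c′) ⟩
    1ℚ * c′                        ≡⟨ cong (_* c′) (sym (ι-inv n)) ⟩
    x * i * c′                     ≡⟨ lem₅ x i c′ ⟩
    i * (x * c′)                   ≡⟨ cong (i *_) (sym (ι-* (suc n) _)) ⟩
    i * ι (suc n ℕ.* ((2 ℕ.* suc n) choose suc n)) ≡⟨ cong (λ k → i * ι k) (central-suc n) ⟩
    i * ι ((4 ℕ.* n ℕ.+ 2) ℕ.* ((2 ℕ.* n) choose n)) ≡⟨ cong (i *_) (ι-* (4 ℕ.* n ℕ.+ 2) _) ⟩
    i * (ι (4 ℕ.* n ℕ.+ 2) * c)    ≡⟨ sym (*-assoc i _ c) ⟩
    i * ι (4 ℕ.* n ℕ.+ 2) * c      ≡⟨ cong (_* c) (sym r≡) ⟩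
    r * c                          ∎
    where
    lem₅ : ∀ x i c → x * i * c ≡ i * (x * c)
    lem₅ = solve-∀ ℚring

-- Recursions for the truncated sums

Σ<-cong : ∀ N {f g} → (∀ j → j ℕ.< N → f j ≡ g j) → Σ< N f ≡ Σ< N g
Σ<-cong zero e = refl
Σ<-cong (suc N) e = cong₂ _+_ (Σ<-cong N (λ j j<N → e j (ℕₚ.m<n⇒m<1+n j<N))) (e N ℕₚ.≤-refl)

Σ<-front : ∀ N f → Σ< (suc N) f ≡ f 0 + Σ< N (f ∘ suc)
Σ<-front zero f = +-comm 0ℚ (f 0)
Σ<-front (suc N) f = trans (cong (_+ f (suc N)) (Σ<-front N f)) (+-assoc (f 0) _ (f (suc N)))

Σ<-+ : ∀ N f g → Σ< N (λ j → f j + g j) ≡ Σ< N f + Σ< N g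
Σ<-+ zero f g = refl
Σ<-+ (suc N) f g = trans (cong (_+ (f N + g N)) (Σ<-+ N f g)) (lem (Σ< N f) (Σ< N g) (f N) (g N))
  where
  lem : ∀ a b c d → a + b + (c + d) ≡ a + c + (b + d)
  lem = solve-∀ ℚring

Σ<-* : ∀ N c f → Σ< N (λ j → c * f j) ≡ c * Σ< N f
Σ<-* zero c f = sym (*-zeroʳ c)
Σ<-* (suc N) c f = trans (cong (_+ c * f N) (Σ<-* N c f)) (sym (*-distribˡ-+ c (Σ< N f) (f N)))

Σ<-zero : ∀ N {f} → (∀ j → j ℕ.< N → f j ≡ 0ℚ) → Σ< N f ≡ 0ℚ
Σ<-zero zero e = refl
Σ<-zero (suc N) e = cong₂ _+_ (Σ<-zero N (λ j j<N → e j (ℕₚ.m<n⇒m<1+n j<N))) (e N ℕₚ.≤-refl)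

∣Σ<∣≤ : ∀ N {f B} → (∀ j → j ℕ.< N → ∣ f j ∣ ≤ B) → ∣ Σ< N f ∣ ≤ ι N * B
∣Σ<∣≤ zero {f} {B} e = ≤-reflexive (sym (trans (cong (_* B) ι-0) (*-zeroˡ B)))
∣Σ<∣≤ (suc N) {f} {B} e = begin
  ∣ Σ< N f + f N ∣        ≤⟨ ∣p+q∣≤∣p∣+∣q∣ (Σ< N f) (f N) ⟩
  ∣ Σ< N f ∣ + ∣ f N ∣    ≤⟨ +-mono-≤ (∣Σ<∣≤ N (λ j j<N → e j (ℕₚ.m<n⇒m<1+n j<N))) (e N ℕₚ.≤-refl) ⟩
  ι N * B + B             ≡⟨ lem (ι N) B ⟩
  (ι N + 1ℚ) * B          ≡⟨ cong (_* B) (sym (ι-suc N)) ⟩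
  ι (suc N) * B           ∎
  where
  open ≤-Reasoning
  lem : ∀ a b → a * b + b ≡ (a + 1ℚ) * b
  lem = solve-∀ ℚring

<∸⇒+< : ∀ a m {j} → j ℕ.< m ∸ a → a ℕ.+ j ℕ.< m
<∸⇒+< zero m j< = j<
<∸⇒+< (suc a) (suc m) j< = s≤s (<∸⇒+< a m j<)

ΣOO-cong : ∀ n m {f g} → (∀ k → n ℕ.< k → k ℕ.< m → f k ≡ g k) → ΣOO n m f ≡ ΣOO n m g
ΣOO-cong n m e = Σ<-cong (m ∸ suc n) λ j j< → e (suc (n ℕ.+ j)) (s≤s (ℕₚ.m≤m+n n j)) (<∸⇒+< (suc n) m j<)

ΣOO-front : ∀ n m f → suc n ℕ.< m → ΣOO n m f ≡ f (suc n) + ΣOO (suc n) m f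
ΣOO-front n (suc m) f (s≤s n<m) = begin
  Σ< (m ∸ n) g                              ≡⟨ cong (λ k → Σ< k g) (sym (ℕₚ.suc-pred (m ∸ n) {{ℕ.≢-nonZero (ℕₚ.m>n⇒m∸n≢0 n<m)}})) ⟩
  Σ< (suc (ℕ.pred (m ∸ n))) g               ≡⟨ cong (λ k → Σ< (suc k) g) (ℕₚ.pred[m∸n]≡m∸[1+n] m n) ⟩
  Σ< (suc (m ∸ suc n)) g                    ≡⟨ Σ<-front (m ∸ suc n) g ⟩
  g 0 + Σ< (m ∸ suc n) (g ∘ suc)            ≡⟨ cong₂ _+_ (cong (f ∘ suc) (ℕₚ.+-identityʳ n)) (Σ<-cong (m ∸ suc n) λ j _ → cong (f ∘ suc) (ℕₚ.+-suc n j)) ⟩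
  f (suc n) + ΣOO (suc n) (suc m) f         ∎
  where
  open ≡-Reasoning
  g = λ j → f (suc (n ℕ.+ j))

Σ<-empty : ∀ {n m} f → m ℕ.≤ n → Σ< (m ∸ n) f ≡ 0ℚ
Σ<-empty f m≤n = cong (λ k → Σ< k f) (ℕₚ.m≤n⇒m∸n≡0 m≤n)

ΣOO-+ : ∀ n m f g → ΣOO n m (λ k → f k + g k) ≡ ΣOO n m f + ΣOO n m g
ΣOO-+ n m f g = Σ<-+ (m ∸ suc n) _ _

ΣOO-* : ∀ n m c f → ΣOO n m (λ k → c * f k) ≡ c * ΣOO n m f
ΣOO-* n m c f = Σ<-* (m ∸ suc n) c _

-- In the applications u k is a nonempty nested sum over indices strictly between n and k, hence u (suc n) ≡ 0ℚ.
ΣOO-shift : ∀ n m (w : ℕ → ℚ) (u u′ : ℕ → ℚ) (v : ℕ → ℚ) c → suc n ℕ.< m → u (suc n) ≡ 0ℚ →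
  (∀ k → suc n ℕ.< k → u k ≡ u′ k + c * v k) →
  ΣOO n m (λ k → w k * u k) ≡ ΣOO (suc n) m (λ k → w k * u′ k) + c * ΣOO (suc n) m (λ k → w k * v k)
ΣOO-shift n m w u u′ v c n<m u≡0 rec = begin
  ΣOO n m (λ k → w k * u k)
    ≡⟨ ΣOO-front n m (λ k → w k * u k) n<m ⟩
  w (suc n) * u (suc n) + ΣOO (suc n) m (λ k → w k * u k)
    ≡⟨ cong₂ _+_ (trans (cong (w (suc n) *_) u≡0) (*-zeroʳ (w (suc n))))
         (ΣOO-cong (suc n) m λ k n<k _ → trans (cong (w k *_) (rec k n<k)) (lem (w k) (u′ k) c (v k))) ⟩
  0ℚ + ΣOO (suc n) m (λ k → w k * u′ k + c * (w k * v k))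
    ≡⟨ +-identityˡ (ΣOO (suc n) m (λ k → w k * u′ k + c * (w k * v k))) ⟩
  ΣOO (suc n) m (λ k → w k * u′ k + c * (w k * v k))
    ≡⟨ ΣOO-+ (suc n) m (λ k → w k * u′ k) (λ k → c * (w k * v k)) ⟩
  ΣOO (suc n) m (λ k → w k * u′ k) + ΣOO (suc n) m (λ k → c * (w k * v k))
    ≡⟨ cong (ΣOO (suc n) m (λ k → w k * u′ k) +_) (ΣOO-* (suc n) m c (λ k → w k * v k)) ⟩
  ΣOO (suc n) m (λ k → w k * u′ k) + c * ΣOO (suc n) m (λ k → w k * v k) ∎
  where
  open ≡-Reasoning
  lem : ∀ w a c b → w * (a + c * b) ≡ w * a + c * (w * b)
  lem = solve-∀ ℚring

U-empty : ∀ ss t n m → m ℕ.≤ suc n → U (ss ∷ʳ t) n m ≡ 0ℚ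
U-empty [] t n m m≤ = Σ<-empty _ m≤
U-empty (s ∷ ss) t n m m≤ = Σ<-empty _ m≤

-- Either the smallest index exceeds n + 1, or it equals n + 1 and the remaining ones run above it.
-- The induction is on the front of the list because `U` is nested from the largest index downwards.
U-snoc : ∀ ss t n m → suc n ℕ.< m →
  U (ss ∷ʳ t) n m ≡ U (ss ∷ʳ t) (suc n) m + powNeg (suc n) t * U ss (suc n) m
U-snoc [] t n m n<m = trans (ΣOO-front n m (λ k → powNeg k t * 1ℚ) n<m) (+-comm (powNeg (suc n) t * 1ℚ) (U (t ∷ []) (suc n) m))
U-snoc (s ∷ ss) t n m n<m = ΣOO-shift n m (λ k → powNeg k s) (U (ss ∷ʳ t) n) (U (ss ∷ʳ t) (suc n)) (U ss (suc n))
  (powNeg (suc n) t) n<m (U-empty ss t n (suc n) ℕₚ.≤-refl) (λ k → U-snoc ss t n k)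

σTrunc-empty : ∀ ss t n → σTrunc (ss ∷ʳ t) n n ≡ 0ℚ
σTrunc-empty [] t n = Σ<-empty {n} _ ℕₚ.≤-refl
σTrunc-empty (s ∷ ss) t n = Σ<-empty {n} _ ℕₚ.≤-refl

σTrunc-snoc : ∀ ss t n N → n ℕ.< N →
  σTrunc (ss ∷ʳ t) n N ≡ σTrunc (ss ∷ʳ t) (suc n) N + powNeg (suc n) t * σTrunc ss (suc n) N
σTrunc-snoc [] t n N n<N = trans (ΣOO-front n (suc N) f (s≤s n<N))
  (lem (binInv (suc n)) (powNeg (suc n) t) (ΣOO (suc n) (suc N) f))
  where
  f : ℕ → ℚ
  f m = binInv m * powNeg m t * 1ℚ
  lem : ∀ b p s → b * p * 1ℚ + s ≡ s + p * b
  lem = solve-∀ ℚring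
σTrunc-snoc (s ∷ ss) t n N n<N = ΣOO-shift n (suc N) (λ k → binInv k * powNeg k s) (U (ss ∷ʳ t) n) (U (ss ∷ʳ t) (suc n)) (U ss (suc n))
  (powNeg (suc n) t) (s≤s n<N) (U-empty ss t n (suc n) ℕₚ.≤-refl) (λ k → U-snoc ss t n k)

-- The recursions of σ peel off the last entry, so the exponents are kept in reverse order.
S : List ℤ → ℕ → ℕ → ℚ
S r = σTrunc (reverse r)

S-suc : ∀ t r n N → n ℕ.< N → S (t ∷ r) n N ≡ S (t ∷ r) (suc n) N + powNeg (suc n) t * S r (suc n) N
S-suc t r n N n<N rewrite unfold-reverse t r = σTrunc-snoc (reverse r) t n N n<N

S-diag : ∀ t r n → S (t ∷ r) n n ≡ 0ℚ
S-diag t r n rewrite unfold-reverse t r = σTrunc-empty (reverse r) t n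

S-[] : ∀ n N → S [] n N ≡ ρ₀ (suc n) * S [] (suc n) N
S-[] n N = binInv-suc n

-- Range and summand are truncated at the same `N`; with this choice `S-∷` is an exact identity.
T : (ℕ → ℕ → ℚ) → ℕ → ℕ → ℚ
T X n N = ΣOC n N (λ m → X m N)

T-suc : ∀ X n N → n ℕ.< N → T X n N ≡ X (suc n) N + T X (suc n) N
T-suc X n N n<N = ΣOO-front n (suc N) (λ m → X m N) (s≤s n<N)

T-diag : ∀ X n → T X n n ≡ 0ℚ
T-diag X n = Σ<-empty {n} _ ℕₚ.≤-refl

-- Descent from `N` to `n`. Every telescoping below has this form: a candidate `f` is checked on one
-- step, and the boundary value `f N` is all that remains.
tail-unique : ∀ (X : ℕ → ℕ → ℚ) (f : ℕ → ℚ) N →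
  (∀ n → n ℕ.< N → f n ≡ X (suc n) N + f (suc n)) → ∀ n → n ℕ.≤ N → f n ≡ T X n N + f N
tail-unique X f N rec n n≤N = go (N ∸ n) n (ℕₚ.m∸n+n≡m n≤N)
  where
  open ≡-Reasoning
  go : ∀ d n → d ℕ.+ n ≡ N → f n ≡ T X n N + f N
  go zero n refl = sym (trans (cong (_+ f n) (T-diag X n)) (+-identityˡ (f n)))
  go (suc d) n e = begin
    f n                              ≡⟨ rec n n<N ⟩
    X (suc n) N + f (suc n)          ≡⟨ cong (X (suc n) N +_) (go d (suc n) (trans (ℕₚ.+-suc d n) e)) ⟩
    X (suc n) N + (T X (suc n) N + f N)   ≡⟨ sym (+-assoc (X (suc n) N) _ (f N)) ⟩
    X (suc n) N + T X (suc n) N + f N     ≡⟨ cong (_+ f N) (sym (T-suc X n N n<N)) ⟩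
    T X n N + f N                    ∎
    where
    n<N : n ℕ.< N
    n<N = subst (n ℕ.<_) e (s≤s (ℕₚ.m≤n+m n d))

S-∷ : ∀ t r n N → n ℕ.≤ N → S (t ∷ r) n N ≡ T (λ m N → powNeg m t * S r m N) n N
S-∷ t r n N n≤N = trans
  (tail-unique X (λ n → S (t ∷ r) n N) N
    (λ n n<N → trans (S-suc t r n N n<N) (+-comm (S (t ∷ r) (suc n) N) (X (suc n) N))) n n≤N)
  (trans (cong (T X n N +_) (S-diag t r N)) (+-identityʳ (T X n N)))
  where
  X : ℕ → ℕ → ℚ
  X m N = powNeg m t * S r m N

-- Polynomials

infixl 6 _⊕_
infixr 7 _⊙_ _⊗_

_⊕_ : Poly → Poly → Poly
[]       ⊕ q        = q
(c ∷ cs) ⊕ []       = c ∷ cs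
(c ∷ cs) ⊕ (d ∷ ds) = c + d ∷ cs ⊕ ds

eval-⊕ : ∀ p q x → eval (p ⊕ q) x ≡ eval p x + eval q x
eval-⊕ [] q x = sym (+-identityˡ _)
eval-⊕ (c ∷ cs) [] x = sym (+-identityʳ _)
eval-⊕ (c ∷ cs) (d ∷ ds) x = trans (cong (λ z → c + d + x * z) (eval-⊕ cs ds x)) (lem c d x (eval cs x) (eval ds x))
  where
  lem : ∀ c d x a b → c + d + x * (a + b) ≡ c + x * a + (d + x * b)
  lem = solve-∀ ℚring

coeff-⊕ : ∀ p q k → coeff (p ⊕ q) k ≡ coeff p k + coeff q k
coeff-⊕ [] q k = sym (+-identityˡ _)
coeff-⊕ (c ∷ cs) [] k = sym (+-identityʳ _)
coeff-⊕ (c ∷ cs) (d ∷ ds) zero = refl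
coeff-⊕ (c ∷ cs) (d ∷ ds) (suc k) = coeff-⊕ cs ds k

length-⊕ : ∀ {ℓ} p q → length p ℕ.≤ ℓ → length q ℕ.≤ ℓ → length (p ⊕ q) ℕ.≤ ℓ
length-⊕ [] q _ q≤ = q≤
length-⊕ (c ∷ cs) [] p≤ _ = p≤
length-⊕ (c ∷ cs) (d ∷ ds) (s≤s p≤) (s≤s q≤) = s≤s (length-⊕ cs ds p≤ q≤)

_⊙_ : ℚ → Poly → Poly
a ⊙ p = map (a *_) p

eval-⊙ : ∀ a p x → eval (a ⊙ p) x ≡ a * eval p x
eval-⊙ a [] x = sym (*-zeroʳ a)
eval-⊙ a (c ∷ cs) x = trans (cong (λ z → a * c + x * z) (eval-⊙ a cs x)) (lem a c x (eval cs x))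
  where
  lem : ∀ a c x z → a * c + x * (a * z) ≡ a * (c + x * z)
  lem = solve-∀ ℚring

coeff-⊙ : ∀ a p k → coeff (a ⊙ p) k ≡ a * coeff p k
coeff-⊙ a [] k = sym (*-zeroʳ a)
coeff-⊙ a (c ∷ cs) zero = refl
coeff-⊙ a (c ∷ cs) (suc k) = coeff-⊙ a cs k

length-⊙ : ∀ {ℓ} a p → length p ℕ.≤ ℓ → length (a ⊙ p) ℕ.≤ ℓ
length-⊙ {ℓ} a p = subst (ℕ._≤ ℓ) (sym (length-map (a *_) p))

eval-0∷ : ∀ p x → eval (0ℚ ∷ p) x ≡ x * eval p x
eval-0∷ p x = +-identityˡ (x * eval p x)

_⊗_ : Poly → Poly → Poly
[]       ⊗ q = []
(c ∷ cs) ⊗ q = c ⊙ q ⊕ (0ℚ ∷ cs ⊗ q)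

eval-⊗ : ∀ p q x → eval (p ⊗ q) x ≡ eval p x * eval q x
eval-⊗ [] q x = sym (*-zeroˡ (eval q x))
eval-⊗ (c ∷ cs) q x = begin
  eval (c ⊙ q ⊕ (0ℚ ∷ cs ⊗ q)) x              ≡⟨ eval-⊕ (c ⊙ q) (0ℚ ∷ cs ⊗ q) x ⟩
  eval (c ⊙ q) x + eval (0ℚ ∷ cs ⊗ q) x       ≡⟨ cong₂ _+_ (eval-⊙ c q x) (trans (eval-0∷ (cs ⊗ q) x) (cong (x *_) (eval-⊗ cs q x))) ⟩
  c * eval q x + x * (eval cs x * eval q x)   ≡⟨ lem c x (eval cs x) (eval q x) ⟩
  (c + x * eval cs x) * eval q x              ∎
  where
  open ≡-Reasoning
  lem : ∀ c x p q → c * q + x * (p * q) ≡ (c + x * p) * q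
  lem = solve-∀ ℚring

shift : ℚ → Poly → Poly
shift a []       = []
shift a (c ∷ cs) = (c ∷ shift a cs) ⊕ a ⊙ shift a cs

eval-shift : ∀ a p x → eval (shift a p) x ≡ eval p (x + a)
eval-shift a [] x = refl
eval-shift a (c ∷ cs) x = begin
  eval ((c ∷ shift a cs) ⊕ a ⊙ shift a cs) x           ≡⟨ eval-⊕ (c ∷ shift a cs) (a ⊙ shift a cs) x ⟩
  c + x * eval (shift a cs) x + eval (a ⊙ shift a cs) x ≡⟨ cong (c + x * eval (shift a cs) x +_) (eval-⊙ a (shift a cs) x) ⟩
  c + x * eval (shift a cs) x + a * eval (shift a cs) x ≡⟨ lem c x a (eval (shift a cs) x) ⟩
  c + (x + a) * eval (shift a cs) x                    ≡⟨ cong (λ z → c + (x + a) * z) (eval-shift a cs x) ⟩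
  c + (x + a) * eval cs (x + a)                        ∎
  where
  open ≡-Reasoning
  lem : ∀ c x a s → c + x * s + a * s ≡ c + (x + a) * s
  lem = solve-∀ ℚring

length-shift : ∀ {ℓ} a p → length p ℕ.≤ ℓ → length (shift a p) ℕ.≤ ℓ
length-shift a [] _ = z≤n
length-shift a (c ∷ cs) (s≤s p≤) =
  length-⊕ (c ∷ shift a cs) (a ⊙ shift a cs) (s≤s (length-shift a cs p≤))
    (length-⊙ a (shift a cs) (ℕₚ.m≤n⇒m≤1+n (length-shift a cs p≤)))

-- Not defined as `shift` minus the identity: the recursion makes the loss of one degree visible in
-- the length of the list, and the clause for constants is where the list becomes shorter.
diff : ℚ → Poly → Poly
diff a []           = []
diff a (c ∷ [])     = []
diff a (c ∷ d ∷ ds) = (0ℚ ∷ diff a (d ∷ ds)) ⊕ a ⊙ shift a (d ∷ ds)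

eval-diff : ∀ a p x → eval (diff a p) x ≡ eval p (x + a) - eval p x
eval-diff a [] x = refl
eval-diff a (c ∷ []) x = sym (lem c x a)
  where
  lem : ∀ c x a → c + (x + a) * 0ℚ - (c + x * 0ℚ) ≡ 0ℚ
  lem = solve-∀ ℚring
eval-diff a (c ∷ cs@(d ∷ ds)) x = begin
  eval ((0ℚ ∷ diff a cs) ⊕ a ⊙ shift a cs) x                 ≡⟨ eval-⊕ (0ℚ ∷ diff a cs) (a ⊙ shift a cs) x ⟩
  0ℚ + x * eval (diff a cs) x + eval (a ⊙ shift a cs) x      ≡⟨ cong₂ (λ y z → 0ℚ + x * y + z) (eval-diff a cs x) (trans (eval-⊙ a (shift a cs) x) (cong (a *_) (eval-shift a cs x))) ⟩
  0ℚ + x * (eval cs (x + a) - eval cs x) + a * eval cs (x + a) ≡⟨ lem c x a (eval cs (x + a)) (eval cs x) ⟩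
  c + (x + a) * eval cs (x + a) - (c + x * eval cs x)        ∎
  where
  open ≡-Reasoning
  lem : ∀ c x a s t → 0ℚ + x * (s - t) + a * s ≡ c + (x + a) * s - (c + x * t)
  lem = solve-∀ ℚring

length-diff : ∀ {ℓ} a p → length p ℕ.≤ suc ℓ → length (diff a p) ℕ.≤ ℓ
length-diff a [] _ = z≤n
length-diff a (c ∷ []) _ = z≤n
length-diff a (c ∷ cs@(d ∷ ds)) (s≤s p≤@(s≤s _)) =
  length-⊕ (0ℚ ∷ diff a cs) (a ⊙ shift a cs) (s≤s (length-diff a cs p≤)) (length-⊙ a (shift a cs) (length-shift a cs p≤))

X^_·_ : ℕ → Poly → Poly
X^ k · p = replicate k 0ℚ ++ p

eval-X^ : ∀ k p x → eval (X^ k · p) x ≡ x ^ k * eval p x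
eval-X^ zero p x = sym (*-identityˡ _)
eval-X^ (suc k) p x = trans (eval-0∷ (X^ k · p) x) (trans (cong (x *_) (eval-X^ k p x)) (sym (*-assoc x (x ^ k) _)))

coeff-X^-< : ∀ k p {j} → j ℕ.< k → coeff (X^ k · p) j ≡ 0ℚ
coeff-X^-< (suc k) p {zero} _ = refl
coeff-X^-< (suc k) p {suc j} (s≤s j<k) = coeff-X^-< k p j<k

coeff-X^-+ : ∀ k p j → coeff (X^ k · p) (k ℕ.+ j) ≡ coeff p j
coeff-X^-+ zero p j = refl
coeff-X^-+ (suc k) p j = coeff-X^-+ k p j

coeff-≥length : ∀ p k → length p ℕ.≤ k → coeff p k ≡ 0ℚ
coeff-≥length [] k _ = refl
coeff-≥length (c ∷ cs) (suc k) (s≤s p≤) = coeff-≥length cs k p≤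

-- Coefficient lists may end in zeros, so the zero polynomial has many representatives.
Zero : Poly → Set
Zero p = ∀ k → coeff p k ≡ 0ℚ

eval-Zero : ∀ p x → Zero p → eval p x ≡ 0ℚ
eval-Zero [] x z = refl
eval-Zero (c ∷ cs) x z = trans (cong₂ (λ a b → a + x * b) (z 0) (eval-Zero cs x (z ∘ suc))) (trans (+-identityˡ (x * 0ℚ)) (*-zeroʳ x))

EvNZ : Poly → Set
EvNZ p = ∃[ n₀ ] (∀ n → n₀ ℕ.≤ n → eval p (ι n) ≢ 0ℚ)

-- Coefficients of (p(x) - p(a)) / (x - a) for p = c ∷ cs; it does not depend on c.
quotient : ℚ → Poly → Poly
quotient a []           = []
quotient a cs@(_ ∷ ds) = eval cs a ∷ quotient a ds

eval-quotient : ∀ a cs x → x * eval cs x - a * eval cs a ≡ (x - a) * eval (quotient a cs) x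
eval-quotient a [] x = lem x a
  where
  lem : ∀ x a → x * 0ℚ - a * 0ℚ ≡ (x - a) * 0ℚ
  lem = solve-∀ ℚring
eval-quotient a (d ∷ ds) x = trans (lem₁ x a d (eval ds x) (eval ds a))
  (trans (cong (λ z → (x - a) * (d + a * eval ds a) + x * z) (eval-quotient a ds x)) (lem₂ x a d (eval ds a) (eval (quotient a ds) x)))
  where
  lem₁ : ∀ x a d s t → x * (d + x * s) - a * (d + a * t) ≡ (x - a) * (d + a * t) + x * (x * s - a * t)
  lem₁ = solve-∀ ℚring
  lem₂ : ∀ x a d t q → (x - a) * (d + a * t) + x * ((x - a) * q) ≡ (x - a) * (d + a * t + x * q)
  lem₂ = solve-∀ ℚring

length-quotient : ∀ a cs → length (quotient a cs) ≡ length cs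
length-quotient a [] = refl
length-quotient a (d ∷ ds) = cong suc (length-quotient a ds)

∷-Zero : ∀ {c cs x} → Zero cs → eval (c ∷ cs) x ≡ 0ℚ → Zero (c ∷ cs)
∷-Zero {c} {cs} {x} z e zero = trans (sym (trans (cong (λ y → c + x * y) (eval-Zero cs x z)) (lem c x))) e
  where
  lem : ∀ c x → c + x * 0ℚ ≡ c
  lem = solve-∀ ℚring
∷-Zero z e (suc k) = z k

quotient-Zero : ∀ a cs → Zero (quotient a cs) → Zero cs
quotient-Zero a [] z = λ k → refl
quotient-Zero a (d ∷ ds) z = ∷-Zero {x = a} (quotient-Zero a ds (z ∘ suc)) (z 0)

ι-<⇒-≢0 : ∀ {m n} → m ℕ.< n → ι n - ι m ≢ 0ℚ
ι-<⇒-≢0 {m} {n} m<n e = ι-suc≢0 j (trans (sym (begin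
  ι n - ι m                   ≡⟨ cong (λ k → ι k - ι m) (sym (ℕₚ.m+[n∸m]≡n m<n)) ⟩
  ι (suc m ℕ.+ j) - ι m       ≡⟨ cong (λ k → ι k - ι m) (sym (ℕₚ.+-suc m j)) ⟩
  ι (m ℕ.+ suc j) - ι m       ≡⟨ cong (_- ι m) (ι-+ m (suc j)) ⟩
  ι m + ι (suc j) - ι m       ≡⟨ lem (ι m) (ι (suc j)) ⟩
  ι (suc j)                   ∎)) e)
  where
  open ≡-Reasoning
  j = n ∸ suc m
  lem : ∀ a b → a + b - a ≡ b
  lem = solve-∀ ℚring

-- A root at `n₀` is divided out; the quotient is one entry shorter and vanishes from n₀ + 1 on.
vanishing⇒Zero : ∀ p n₀ → (∀ n → n₀ ℕ.≤ n → eval p (ι n) ≡ 0ℚ) → Zero p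
vanishing⇒Zero p = go (length p) p refl
  where
  go : ∀ ℓ p → length p ≡ ℓ → ∀ n₀ → (∀ n → n₀ ℕ.≤ n → eval p (ι n) ≡ 0ℚ) → Zero p
  go _ [] _ n₀ v k = refl
  go (suc ℓ) (c ∷ cs) e n₀ v = ∷-Zero {x = a} (quotient-Zero a cs q-Zero) (v n₀ ℕₚ.≤-refl)
    where
    a = ι n₀
    lem : ∀ c s t → s - t ≡ (c + s) - (c + t)
    lem = solve-∀ ℚring
    q-Zero : Zero (quotient a cs)
    q-Zero = go ℓ (quotient a cs) (trans (length-quotient a cs) (ℕₚ.suc-injective e)) (suc n₀) λ n n₀<n →
      *-cancel-0 (ι-<⇒-≢0 n₀<n) (trans (sym (eval-quotient a cs (ι n)))
        (trans (lem c (ι n * eval cs (ι n)) (a * eval cs a))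
          (cong₂ _-_ (v n (ℕₚ.<⇒≤ n₀<n)) (v n₀ ℕₚ.≤-refl))))

agree⇒coeff≡ : ∀ p q n₀ → (∀ n → n₀ ℕ.≤ n → eval p (ι n) ≡ eval q (ι n)) → ∀ k → coeff p k ≡ coeff q k
agree⇒coeff≡ p q n₀ e k = -≡0⇒≡ (begin
  coeff p k - coeff q k               ≡⟨ lem (coeff p k) (coeff q k) ⟩
  coeff p k + (- 1ℚ) * coeff q k      ≡⟨ cong (coeff p k +_) (sym (coeff-⊙ (- 1ℚ) q k)) ⟩
  coeff p k + coeff ((- 1ℚ) ⊙ q) k    ≡⟨ sym (coeff-⊕ p ((- 1ℚ) ⊙ q) k) ⟩
  coeff (p ⊕ (- 1ℚ) ⊙ q) k            ≡⟨ vanishing⇒Zero (p ⊕ (- 1ℚ) ⊙ q) n₀ v k ⟩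
  0ℚ                                  ∎)
  where
  open ≡-Reasoning
  lem : ∀ a b → a - b ≡ a + (- 1ℚ) * b
  lem = solve-∀ ℚring
  v : ∀ n → n₀ ℕ.≤ n → eval (p ⊕ (- 1ℚ) ⊙ q) (ι n) ≡ 0ℚ
  v n n≥ = begin
    eval (p ⊕ (- 1ℚ) ⊙ q) (ι n)                 ≡⟨ eval-⊕ p ((- 1ℚ) ⊙ q) (ι n) ⟩
    eval p (ι n) + eval ((- 1ℚ) ⊙ q) (ι n)      ≡⟨ cong (eval p (ι n) +_) (eval-⊙ (- 1ℚ) q (ι n)) ⟩
    eval p (ι n) + (- 1ℚ) * eval q (ι n)        ≡⟨ sym (lem (eval p (ι n)) (eval q (ι n))) ⟩
    eval p (ι n) - eval q (ι n)                 ≡⟨ ≡⇒-≡0 (e n n≥) ⟩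
    0ℚ ∎

≢0⇒0<∣∣ : ∀ {c} → c ≢ 0ℚ → 0ℚ < ∣ c ∣
≢0⇒0<∣∣ {c} c≢0 = ≰⇒> λ ∣c∣≤0 → c≢0 (∣p∣≡0⇒p≡0 c (≤-antisym ∣c∣≤0 (0≤∣p∣ c)))

-- The uniform bound δ is what carries the induction: if |q(n)| ≥ δ for large n, then |c + n q(n)| ≥
-- n δ - |c| ≥ δ as soon as n ≥ (|c| + δ)/δ. Nonvanishing of q alone would say nothing about c + n
-- q(n).
Zero⊎away-from-0 : ∀ p → Zero p ⊎ (∃[ n₀ ] ∃[ δ ] 0ℚ < δ × (∀ n → n₀ ℕ.≤ n → δ ≤ ∣ eval p (ι n) ∣))
Zero⊎away-from-0 [] = inj₁ (λ k → refl)
Zero⊎away-from-0 (c ∷ cs) with Zero⊎away-from-0 cs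
... | inj₁ z with c ≟ 0ℚ
...   | yes refl = inj₁ λ { zero → refl ; (suc k) → z k }
...   | no c≢0 = inj₂ (0 , ∣ c ∣ , ≢0⇒0<∣∣ c≢0 , λ n _ → ≤-reflexive (cong ∣_∣ (sym
        (trans (cong (λ y → c + ι n * y) (eval-Zero cs (ι n) z)) (lem c (ι n))))))
  where
  lem : ∀ c x → c + x * 0ℚ ≡ c
  lem = solve-∀ ℚring
Zero⊎away-from-0 (c ∷ cs) | inj₂ (n₀ , δ , 0<δ , away) with inverse (≢-sym (<⇒≢ 0<δ))
... | r , δr≡1 with archimedean ((∣ c ∣ + δ) * r)
... | M , M≥ = inj₂ (n₀ ℕ.⊔ M , δ , 0<δ , λ n n≥ → bound n (ℕₚ.m⊔n≤o⇒m≤o n₀ M n≥) (ℕₚ.m⊔n≤o⇒n≤o n₀ M n≥))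
  where
  open ≤-Reasoning
  instance
    δ≥0 = ℚ.nonNegative (<⇒≤ 0<δ)
  step : ∣ c ∣ + δ ≤ ι M * δ
  step = begin
    ∣ c ∣ + δ                ≡⟨ sym (*-identityʳ _) ⟩
    (∣ c ∣ + δ) * 1ℚ         ≡⟨ cong ((∣ c ∣ + δ) *_) (sym δr≡1) ⟩
    (∣ c ∣ + δ) * (δ * r)    ≡⟨ lem (∣ c ∣ + δ) δ r ⟩
    (∣ c ∣ + δ) * r * δ      ≤⟨ *-monoʳ-≤-nonNeg δ M≥ ⟩
    ι M * δ ∎
    where
    lem : ∀ a d r → a * (d * r) ≡ a * r * d
    lem = solve-∀ ℚring
  bound : ∀ n → n₀ ℕ.≤ n → M ℕ.≤ n → δ ≤ ∣ c + ι n * eval cs (ι n) ∣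
  bound n n≥n₀ n≥M = begin
    δ                                   ≡⟨ lem₂ ∣ c ∣ δ ⟩
    ∣ c ∣ + δ - ∣ c ∣                   ≤⟨ +-monoˡ-≤ (- ∣ c ∣) step ⟩
    ι M * δ - ∣ c ∣                     ≤⟨ +-monoˡ-≤ (- ∣ c ∣) (*-monoʳ-≤-nonNeg δ (ι-mono-≤ n≥M)) ⟩
    ι n * δ - ∣ c ∣                     ≤⟨ +-monoˡ-≤ (- ∣ c ∣) (*-monoˡ-≤-nonNeg (ι n) {{ℚ.nonNegative (0≤ι n)}} (away n n≥n₀)) ⟩
    ι n * ∣ q ∣ - ∣ c ∣                 ≡⟨ cong (λ z → z * ∣ q ∣ - ∣ c ∣) (sym (0≤p⇒∣p∣≡p (0≤ι n))) ⟩
    ∣ ι n ∣ * ∣ q ∣ - ∣ c ∣             ≡⟨ cong (_- ∣ c ∣) (sym (∣p*q∣≡∣p∣*∣q∣ (ι n) q)) ⟩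
    ∣ y ∣ - ∣ c ∣                       ≡⟨ cong (λ z → ∣ z ∣ - ∣ c ∣) (lem₃ c y) ⟩
    ∣ (c + y) - c ∣ - ∣ c ∣             ≤⟨ +-monoˡ-≤ (- ∣ c ∣) (∣p-q∣≤∣p∣+∣q∣ (c + y) c) ⟩
    ∣ c + y ∣ + ∣ c ∣ - ∣ c ∣           ≡⟨ sym (lem₄ ∣ c + y ∣ ∣ c ∣) ⟩
    ∣ c + y ∣                           ∎
    where
    q = eval cs (ι n)
    y = ι n * q
    lem₂ : ∀ c d → d ≡ c + d - c
    lem₂ = solve-∀ ℚring
    lem₃ : ∀ c y → y ≡ (c + y) - c
    lem₃ = solve-∀ ℚring
    lem₄ : ∀ a c → a ≡ a + c - c
    lem₄ = solve-∀ ℚring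

Zero⊎EvNZ : ∀ p → Zero p ⊎ EvNZ p
Zero⊎EvNZ p with Zero⊎away-from-0 p
... | inj₁ z = inj₁ z
... | inj₂ (n₀ , δ , 0<δ , away) = inj₂ (n₀ , λ n n≥ e → <⇒≢ (<-≤-trans 0<δ (away n n≥)) (sym (cong ∣_∣ e)))

-- Rational solutions of first-order recurrences

Ev : (ℕ → Set) → Set
Ev P = ∃[ n₀ ] (∀ n → n₀ ℕ.≤ n → P n)

Ev-map : ∀ {P Q : ℕ → Set} → (∀ n → P n → Q n) → Ev P → Ev Q
Ev-map f (n₀ , p) = n₀ , λ n n≥ → f n (p n n≥)

Ev-zip : ∀ {P Q R : ℕ → Set} → (∀ n → P n → Q n → R n) → Ev P → Ev Q → Ev R
Ev-zip f (n₀ , p) (n₁ , q) = n₀ ℕ.⊔ n₁ , λ n n≥ →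
  f n (p n (ℕₚ.m⊔n≤o⇒m≤o n₀ n₁ n≥)) (q n (ℕₚ.m⊔n≤o⇒n≤o n₀ n₁ n≥))

Ev-suc : ∀ {P : ℕ → Set} → Ev P → Ev (P ∘ suc)
Ev-suc (n₀ , p) = n₀ , λ n n≥ → p (suc n) (ℕₚ.m≤n⇒m≤1+n n≥)

Ev-pred : ∀ {P : ℕ → Set} → Ev (P ∘ suc) → Ev P
Ev-pred (n₀ , p) = suc n₀ , λ { (suc n) (s≤s n≥) → p n n≥ }

-1ℚ : ℚ
-1ℚ = - 1ℚ

ι-suc-1 : ∀ n → ι (suc n) + -1ℚ ≡ ι n
ι-suc-1 n = trans (cong (_+ -1ℚ) (ι-suc n)) (lem (ι n))
  where
  lem : ∀ x → x + 1ℚ + -1ℚ ≡ x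
  lem = solve-∀ ℚring

eval-shift-1 : ∀ p n → eval (shift -1ℚ p) (ι (suc n)) ≡ eval p (ι n)
eval-shift-1 p n = trans (eval-shift -1ℚ p (ι (suc n))) (cong (eval p) (ι-suc-1 n))

eval-shift+1 : ∀ p n → eval (shift 1ℚ p) (ι n) ≡ eval p (ι (suc n))
eval-shift+1 p n = trans (eval-shift 1ℚ p (ι n)) (cong (eval p) (sym (ι-suc n)))

eval-diff-1 : ∀ p n → eval (diff -1ℚ p) (ι (suc n)) ≡ eval p (ι n) - eval p (ι (suc n))
eval-diff-1 p n = trans (eval-diff -1ℚ p (ι (suc n))) (cong (λ x → eval p x - eval p (ι (suc n))) (ι-suc-1 n))

-- Agreement is required for large arguments only, beyond the zeros of all denominators and the
-- default values at 0.
EvPoly : (ℕ → ℚ) → Set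
EvPoly f = ∃[ w ] Ev (λ n → f n ≡ eval w (ι n))

EvPoly-≗ : ∀ {f g} → EvPoly f → Ev (λ n → g n ≡ f n) → EvPoly g
EvPoly-≗ (w , p) e = w , Ev-zip (λ n → trans) e p

EvPoly-poly : ∀ p → EvPoly (λ n → eval p (ι n))
EvPoly-poly p = p , 0 , λ n _ → refl

EvPoly-+ : ∀ {f g} → EvPoly f → EvPoly g → EvPoly (λ n → f n + g n)
EvPoly-+ (v , p) (w , q) = v ⊕ w , Ev-zip (λ n e e′ → trans (cong₂ _+_ e e′) (sym (eval-⊕ v w (ι n)))) p q

EvPoly-* : ∀ {f g} → EvPoly f → EvPoly g → EvPoly (λ n → f n * g n)
EvPoly-* (v , p) (w , q) = v ⊗ w , Ev-zip (λ n e e′ → trans (cong₂ _*_ e e′) (sym (eval-⊗ v w (ι n)))) p q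

EvPoly-const : ∀ c → EvPoly (λ n → c)
EvPoly-const c = c ∷ [] , 0 , λ n _ → sym (lem c (ι n))
  where
  lem : ∀ c x → c + x * 0ℚ ≡ c
  lem = solve-∀ ℚring

EvPoly-suc : ∀ {f} → EvPoly f → EvPoly (f ∘ suc)
EvPoly-suc (w , p) = shift 1ℚ w , Ev-map (λ n e → trans e (sym (eval-shift+1 w n))) (Ev-suc p)

EvPoly-pred : ∀ {f} → EvPoly (f ∘ suc) → EvPoly f
EvPoly-pred (w , p) = shift -1ℚ w , Ev-pred (Ev-map (λ n e → trans e (sym (eval-shift-1 w n))) p)

EvPoly-ι : EvPoly ι
EvPoly-ι = 0ℚ ∷ 1ℚ ∷ [] , 0 , λ n _ → sym (lem (ι n))
  where
  lem : ∀ x → 0ℚ + x * (1ℚ + x * 0ℚ) ≡ x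
  lem = solve-∀ ℚring

EvPoly-^ : ∀ k → EvPoly (λ n → ι n ^ k)
EvPoly-^ zero = EvPoly-const 1ℚ
EvPoly-^ (suc k) = EvPoly-* EvPoly-ι (EvPoly-^ k)

-- The denominators q of h form an ideal; a solution h of a first-order recurrence that is singular
-- only at 0 has a denominator q₀ with q₀(0) ≠ 0 (push the recurrence upwards), hence denominators may be
-- divided by x, and every denominator q yields the denominator q(x - 1) - q(x), so that finally a constant is a denominator.
module _ (h : ℕ → ℚ) (K : ℕ) (A C : Poly)
  (A≢0 : ∀ j → eval A (ι (suc j)) ≢ 0ℚ)
  (rec : Ev (λ n → ι (suc n) ^ K * h (suc n) ≡ eval A (ι (suc n)) * h n + eval C (ι (suc n)))) where

  Denominator : Poly → Set
  Denominator q = EvPoly (λ n → eval q (ι n) * h n)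

  Denominator-up : ∀ q → Denominator q → Denominator (shift 1ℚ (A ⊗ q))
  Denominator-up q I = EvPoly-≗
    (EvPoly-suc (EvPoly-+ (EvPoly-* (EvPoly-^ K) I) (EvPoly-* (EvPoly-const -1ℚ) (EvPoly-* (EvPoly-poly q) (EvPoly-poly C)))))
    (Ev-map eq rec)
    where
    lem : ∀ a q h c x h′ → x * h′ ≡ a * h + c → a * q * h ≡ x * (q * h′) + -1ℚ * (q * c)
    lem a q h c x h′ e = trans (lem₁ a q h c) (trans (cong (λ z → q * z + -1ℚ * (q * c)) (sym e)) (lem₂ q x h′ c))
      where
      lem₁ : ∀ a q h c → a * q * h ≡ q * (a * h + c) + -1ℚ * (q * c)
      lem₁ = solve-∀ ℚring
      lem₂ : ∀ q x h′ c → q * (x * h′) + -1ℚ * (q * c) ≡ x * (q * h′) + -1ℚ * (q * c)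
      lem₂ = solve-∀ ℚring
    eq : ∀ n → ι (suc n) ^ K * h (suc n) ≡ eval A (ι (suc n)) * h n + eval C (ι (suc n)) →
      eval (shift 1ℚ (A ⊗ q)) (ι n) * h n ≡
        ι (suc n) ^ K * (eval q (ι (suc n)) * h (suc n)) + -1ℚ * (eval q (ι (suc n)) * eval C (ι (suc n)))
    eq n e = trans (cong (_* h n) (trans (eval-shift+1 (A ⊗ q) n) (eval-⊗ A q (ι (suc n)))))
      (lem (eval A (ι (suc n))) (eval q (ι (suc n))) (h n) (eval C (ι (suc n))) (ι (suc n) ^ K) (h (suc n)) e)

  -- Each use of `Denominator-up` replaces q(x) by A(x + 1) q(x + 1) and so moves a point where the
  -- denominator does not vanish from J + 1 to J; `A≢0` protects the new factor.
  regular-at-0 : ∀ J q → Denominator q → eval q (ι J) ≢ 0ℚ → ∃[ q₀ ] Denominator q₀ × eval q₀ 0ℚ ≢ 0ℚ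
  regular-at-0 zero q I q≢0 = q , I , q≢0 ∘ trans (cong (eval q) ι-0)
  regular-at-0 (suc J) q I q≢0 = regular-at-0 J (shift 1ℚ (A ⊗ q)) (Denominator-up q I)
    (*-≢0 (A≢0 J) q≢0 ∘ trans (sym (trans (eval-shift+1 (A ⊗ q) J) (eval-⊗ A q (ι (suc J))))))

  -- A Bezout identity for x and q₀: if q₀ = c + x s, then c q = q q₀ - s (x q), and both q₀ and x q
  -- are denominators.
  Denominator-/X : ∀ q₀ → Denominator q₀ → eval q₀ 0ℚ ≢ 0ℚ → ∀ q → Denominator (0ℚ ∷ q) → Denominator q
  Denominator-/X [] _ 0≢0 q _ = contradiction refl 0≢0
  Denominator-/X (c ∷ s) I₀ c≢0′ q Iq = uncurry divide (inverse {c} (c≢0′ ∘ trans (lem₀ c (eval s 0ℚ))))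
    where
    lem₀ : ∀ c y → c + 0ℚ * y ≡ c
    lem₀ = solve-∀ ℚring
    open ≡-Reasoning
    lem : ∀ c s q x h r → c * r * (q * h) ≡ r * (q * ((c + x * s) * h) + -1ℚ * (s * ((0ℚ + x * q) * h)))
    lem = solve-∀ ℚring
    eq : ∀ r → c * r ≡ 1ℚ → ∀ n → eval q (ι n) * h n ≡ r * (eval q (ι n) * (eval (c ∷ s) (ι n) * h n) + -1ℚ * (eval s (ι n) * (eval (0ℚ ∷ q) (ι n) * h n)))
    eq r cr≡1 n = begin
      eval q (ι n) * h n              ≡⟨ sym (*-identityˡ (eval q (ι n) * h n)) ⟩
      1ℚ * (eval q (ι n) * h n)       ≡⟨ cong (_* (eval q (ι n) * h n)) (sym cr≡1) ⟩
      c * r * (eval q (ι n) * h n)    ≡⟨ lem c (eval s (ι n)) (eval q (ι n)) (ι n) (h n) r ⟩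
      r * (eval q (ι n) * (eval (c ∷ s) (ι n) * h n) + -1ℚ * (eval s (ι n) * (eval (0ℚ ∷ q) (ι n) * h n))) ∎
    divide : ∀ r → c * r ≡ 1ℚ → Denominator q
    divide r cr≡1 = EvPoly-≗
      (EvPoly-* (EvPoly-const r) (EvPoly-+ (EvPoly-* (EvPoly-poly q) I₀) (EvPoly-* (EvPoly-const -1ℚ) (EvPoly-* (EvPoly-poly s) Iq))))
      (0 , λ n _ → eq r cr≡1 n)

  Denominator-/X^ : ∀ q₀ → Denominator q₀ → eval q₀ 0ℚ ≢ 0ℚ → ∀ k q → Denominator (X^ k · q) → Denominator q
  Denominator-/X^ q₀ I₀ q₀≢0 zero q I = I
  Denominator-/X^ q₀ I₀ q₀≢0 (suc k) q I =
    Denominator-/X^ q₀ I₀ q₀≢0 k q (Denominator-/X q₀ I₀ q₀≢0 (X^ k · q) I)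

  -- The recurrence multiplied by q(n), read at x = n + 1. The factor x^K is stripped afterwards by
  -- `Denominator-/X^`.
  Denominator-down : ∀ q → Denominator q → Denominator (X^ K · shift -1ℚ q)
  Denominator-down q I = EvPoly-pred (EvPoly-≗
    (EvPoly-+ (EvPoly-* (EvPoly-suc (EvPoly-poly A)) I) (EvPoly-* (EvPoly-poly q) (EvPoly-suc (EvPoly-poly C))))
    (Ev-map eq rec))
    where
    lem₁ : ∀ x q h → x * q * h ≡ q * (x * h)
    lem₁ = solve-∀ ℚring
    lem₂ : ∀ a q h c → q * (a * h + c) ≡ a * (q * h) + q * c
    lem₂ = solve-∀ ℚring
    eq : ∀ n → ι (suc n) ^ K * h (suc n) ≡ eval A (ι (suc n)) * h n + eval C (ι (suc n)) →
      eval (X^ K · shift -1ℚ q) (ι (suc n)) * h (suc n) ≡ eval A (ι (suc n)) * (eval q (ι n) * h n) + eval q (ι n) * eval C (ι (suc n))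
    eq n e = trans (cong (_* h (suc n)) (trans (eval-X^ K (shift -1ℚ q) (ι (suc n))) (cong (ι (suc n) ^ K *_) (eval-shift-1 q n))))
      (trans (lem₁ (ι (suc n) ^ K) (eval q (ι n)) (h (suc n)))
        (trans (cong (eval q (ι n) *_) e) (lem₂ (eval A (ι (suc n))) (eval q (ι n)) (h n) (eval C (ι (suc n))))))

  Denominator-diff : ∀ q₀ → Denominator q₀ → eval q₀ 0ℚ ≢ 0ℚ → ∀ q → Denominator q → Denominator (diff -1ℚ q)
  Denominator-diff q₀ I₀ q₀≢0 q I = EvPoly-≗
    (EvPoly-+ (Denominator-/X^ q₀ I₀ q₀≢0 K (shift -1ℚ q) (Denominator-down q I)) (EvPoly-* (EvPoly-const -1ℚ) I))
    (0 , λ n _ → eq n)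
    where
    lem : ∀ a b h → (a - b) * h ≡ a * h + -1ℚ * (b * h)
    lem = solve-∀ ℚring
    eq : ∀ n → eval (diff -1ℚ q) (ι n) * h n ≡ eval (shift -1ℚ q) (ι n) * h n + -1ℚ * (eval q (ι n) * h n)
    eq n = trans (cong (_* h n) (trans (eval-diff -1ℚ q (ι n)) (cong (_- eval q (ι n)) (sym (eval-shift -1ℚ q (ι n))))))
      (lem (eval (shift -1ℚ q) (ι n)) (eval q (ι n)) (h n))

  constant-denominator : ∀ q → Zero (diff -1ℚ q) → EvNZ q → Denominator q → EvPoly h
  constant-denominator q z (n₀ , q≢0) I = uncurry divide (inverse (q≢0 n₀ ℕₚ.≤-refl))
    where
    open ≡-Reasoning
    const : ∀ n → eval q (ι n) ≡ eval q (ι 0)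
    const zero = refl
    const (suc n) = trans (sym (-≡0⇒≡ (trans (sym (eval-diff-1 q n)) (eval-Zero (diff -1ℚ q) (ι (suc n)) z)))) (const n)
    lem : ∀ q r h → q * r * h ≡ r * (q * h)
    lem = solve-∀ ℚring
    eq : ∀ r → eval q (ι n₀) * r ≡ 1ℚ → ∀ n → h n ≡ r * (eval q (ι n) * h n)
    eq r qr≡1 n = begin
      h n                        ≡⟨ sym (*-identityˡ (h n)) ⟩
      1ℚ * h n                   ≡⟨ cong (_* h n) (sym qr≡1) ⟩
      eval q (ι n₀) * r * h n    ≡⟨ cong (λ z → z * r * h n) (trans (const n₀) (sym (const n))) ⟩
      eval q (ι n) * r * h n     ≡⟨ lem (eval q (ι n)) r (h n) ⟩
      r * (eval q (ι n) * h n)   ∎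
    divide : ∀ r → eval q (ι n₀) * r ≡ 1ℚ → EvPoly h
    divide r qr≡1 = EvPoly-≗ (EvPoly-* (EvPoly-const r) I) (0 , λ n _ → eq r qr≡1 n)

  EvPoly-solution : ∀ q → EvNZ q → Denominator q → EvPoly h
  EvPoly-solution q nz@(J , q≢0) I =
    let q₀ , I₀ , q₀≢0 = regular-at-0 J q I (q≢0 J ℕₚ.≤-refl)
    in descend q₀ I₀ q₀≢0 (length q) q ℕₚ.≤-refl nz I
    where
    descend : ∀ q₀ → Denominator q₀ → eval q₀ 0ℚ ≢ 0ℚ →
      ∀ ℓ q → length q ℕ.≤ ℓ → EvNZ q → Denominator q → EvPoly h
    descend q₀ I₀ q₀≢0 zero [] _ (n₀ , nz) _ = contradiction refl (nz n₀ ℕₚ.≤-refl)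
    descend q₀ I₀ q₀≢0 (suc ℓ) q q≤ nz I = [ (λ z → constant-denominator q z nz I)
      , (λ nz′ → descend q₀ I₀ q₀≢0 ℓ (diff -1ℚ q) (length-diff -1ℚ q q≤) nz′ (Denominator-diff q₀ I₀ q₀≢0 q I)) ]′
      (Zero⊎EvNZ (diff -1ℚ q))

-- Polynomial solutions force the polar part to vanish

powNeg-inverse : ∀ n t → ι (suc n) ^ t * powNeg (suc n) (ℤ.+ t) ≡ 1ℚ
powNeg-inverse n t = trans (cong (_* powNeg (suc n) (ℤ.+ t)) (sym (ι-^ (suc n) t))) (invℕ-inverse (suc n ℕ.^ t) (ℕₚ.m^n>0 (suc n) t))

-- x ^ K * (c₀ / x + ... + c_(K-1) / x ^ K)
cleared : (ℕ → ℚ) → ℕ → Poly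
cleared c zero    = []
cleared c (suc K) = c K ∷ cleared c K

polar : (ℕ → ℚ) → ℕ → ℕ → ℚ
polar c K n = Σ< K (λ t → c t * powNeg n (ℤ.+ suc t))

eval-cleared : ∀ c K n → eval (cleared c K) (ι (suc n)) ≡ ι (suc n) ^ K * polar c K (suc n)
eval-cleared c zero n = sym (*-zeroʳ 1ℚ)
eval-cleared c (suc K) n = begin
  c K + x * eval (cleared c K) x          ≡⟨ cong (λ z → c K + x * z) (eval-cleared c K n) ⟩
  c K + x * (x ^ K * s)                   ≡⟨ lem₁ (c K) x (x ^ K) s ⟩
  c K * 1ℚ + x * x ^ K * s                ≡⟨ cong (λ z → c K * z + x * x ^ K * s) (sym (powNeg-inverse n (suc K))) ⟩
  c K * (x * x ^ K * p) + x * x ^ K * s   ≡⟨ lem₂ (c K) x (x ^ K) s p ⟩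
  x * x ^ K * (s + c K * p)               ∎
  where
  open ≡-Reasoning
  x = ι (suc n)
  s = polar c K (suc n)
  p = powNeg (suc n) (ℤ.+ suc K)
  lem₁ : ∀ c x y s → c + x * (y * s) ≡ c * 1ℚ + x * y * s
  lem₁ = solve-∀ ℚring
  lem₂ : ∀ c x y s p → c * (x * y * p) + x * y * s ≡ x * y * (s + c * p)
  lem₂ = solve-∀ ℚring

length-cleared : ∀ c K → length (cleared c K) ≡ K
length-cleared c zero = refl
length-cleared c (suc K) = cong suc (length-cleared c K)

cleared-Zero : ∀ c K → Zero (cleared c K) → ∀ t → t ℕ.< K → c t ≡ 0ℚ
cleared-Zero c (suc K) z t (s≤s t≤K) with t ℕ.≟ K
... | yes refl = z 0
... | no t≢K = cleared-Zero c K (z ∘ suc) t (ℕₚ.≤∧≢⇒< t≤K t≢K)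

-- The left side is divisible by x^K, whereas `C` has degree below K.
x^K·[Px-P[x-1]]-Zero : ∀ K C P → length C ≡ K →
  Ev (λ n → ι (suc n) ^ K * (eval P (ι (suc n)) - eval P (ι n)) ≡ eval C (ι (suc n))) → Zero C
x^K·[Px-P[x-1]]-Zero K C P C≡K (n₀ , e) k with k ℕ.<? K
... | yes k<K = trans (sym (agree⇒coeff≡ (X^ K · (-1ℚ ⊙ diff -1ℚ P)) C (suc n₀) eq k)) (coeff-X^-< K _ k<K)
  where
  lem : ∀ x a b → x * (-1ℚ * (a - b)) ≡ x * (b - a)
  lem = solve-∀ ℚring
  eq : ∀ n → suc n₀ ℕ.≤ n → eval (X^ K · (-1ℚ ⊙ diff -1ℚ P)) (ι n) ≡ eval C (ι n)
  eq (suc n) (s≤s n≥) = trans (eval-X^ K (-1ℚ ⊙ diff -1ℚ P) (ι (suc n)))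
    (trans (cong (ι (suc n) ^ K *_) (trans (eval-⊙ -1ℚ (diff -1ℚ P) (ι (suc n))) (cong (-1ℚ *_) (eval-diff-1 P n))))
      (trans (lem (ι (suc n) ^ K) (eval P (ι n)) (eval P (ι (suc n)))) (e n n≥)))
... | no k≮K = coeff-≥length C k (subst (ℕ._≤ k) (sym C≡K) (ℕₚ.≮⇒≥ k≮K))

eval-take : ∀ ℓ P x → length P ℕ.≤ suc ℓ → eval P x ≡ eval (take ℓ P) x + coeff P ℓ * x ^ ℓ
eval-take zero [] x _ = sym (trans (+-identityˡ (0ℚ * 1ℚ)) (*-zeroˡ 1ℚ))
eval-take zero (c ∷ []) x _ = lem c x
  where
  lem : ∀ c x → c + x * 0ℚ ≡ 0ℚ + c * 1ℚ
  lem = solve-∀ ℚring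
eval-take zero (c ∷ d ∷ ds) x (s≤s ())
eval-take (suc ℓ) [] x _ = sym (trans (+-identityˡ (0ℚ * x ^ suc ℓ)) (*-zeroˡ (x ^ suc ℓ)))
eval-take (suc ℓ) (c ∷ cs) x (s≤s P≤) = trans (cong (λ z → c + x * z) (eval-take ℓ cs x P≤)) (lem c x (eval (take ℓ cs) x) (coeff cs ℓ) (x ^ ℓ))
  where
  lem : ∀ c x p a y → c + x * (p + a * y) ≡ c + x * p + a * (x * y)
  lem = solve-∀ ℚring

length-take≤ : ∀ ℓ (P : Poly) → length (take ℓ P) ℕ.≤ ℓ
length-take≤ zero P = z≤n
length-take≤ (suc ℓ) [] = z≤n
length-take≤ (suc ℓ) (c ∷ cs) = s≤s (length-take≤ ℓ cs)

-- Comparing leading terms: the left side has leading coefficient -3 times that of P, in degree 1 + deg P.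
xPx-[4x-2]P[x-1]-constant : ∀ e ℓ P → length P ℕ.≤ ℓ →
  Ev (λ n → ι (suc n) * eval P (ι (suc n)) - (4ℚ * ι (suc n) - 2ℚ) * eval P (ι n) ≡ e) →
  ∀ n → eval P (ι n) ≡ 0ℚ
xPx-[4x-2]P[x-1]-constant e zero [] _ _ n = refl
xPx-[4x-2]P[x-1]-constant e (suc ℓ) P P≤ (n₀ , rec) n =
  trans (sym (truncate n)) (xPx-[4x-2]P[x-1]-constant e ℓ (take ℓ P) (length-take≤ ℓ P)
    (n₀ , λ n n≥ → trans (cong₂ (λ y z → ι (suc n) * y - (4ℚ * ι (suc n) - 2ℚ) * z)
      (truncate (suc n)) (truncate n)) (rec n n≥)) n)
  where
  D lhs rhs : Poly
  D = diff -1ℚ P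
  -- Substituting P(x - 1) = P + D turns the equation into (3x - 2) P = (2 - 4x) D - e. As `D` is
  -- shorter than `P` and `e` is constant, the right side has no coefficient in degree `suc ℓ`,
  -- where the left side has three times the top coefficient of `P`.
  lhs = (- 2ℚ) ⊙ P ⊕ (0ℚ ∷ 3ℚ ⊙ P)
  rhs = (2ℚ ⊙ D ⊕ (0ℚ ∷ (- 4ℚ) ⊙ D)) ⊕ (- e ∷ [])
  D≤ : length D ℕ.≤ ℓ
  D≤ = length-diff -1ℚ P P≤
  rhs≤ : length rhs ℕ.≤ suc ℓ
  rhs≤ = length-⊕ (2ℚ ⊙ D ⊕ (0ℚ ∷ (- 4ℚ) ⊙ D)) (- e ∷ [])
    (length-⊕ (2ℚ ⊙ D) (0ℚ ∷ (- 4ℚ) ⊙ D) (length-⊙ 2ℚ D (ℕₚ.m≤n⇒m≤1+n D≤)) (s≤s (length-⊙ (- 4ℚ) D D≤))) (s≤s z≤n)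
  eval-linear : ∀ a b Q x → eval (a ⊙ Q ⊕ (0ℚ ∷ b ⊙ Q)) x ≡ (a + x * b) * eval Q x
  eval-linear a b Q x = trans (eval-⊕ (a ⊙ Q) (0ℚ ∷ b ⊙ Q) x)
    (trans (cong₂ (λ y z → y + (0ℚ + x * z)) (eval-⊙ a Q x) (eval-⊙ b Q x)) (lem a b x (eval Q x)))
    where
    lem : ∀ a b x q → a * q + (0ℚ + x * (b * q)) ≡ (a + x * b) * q
    lem = solve-∀ ℚring
  agree : ∀ n → suc n₀ ℕ.≤ n → eval lhs (ι n) ≡ eval rhs (ι n)
  agree (suc n) (s≤s n≥) = trans (eval-linear (- 2ℚ) 3ℚ P (ι (suc n))) (sym
    (trans (eval-⊕ (2ℚ ⊙ D ⊕ (0ℚ ∷ (- 4ℚ) ⊙ D)) (- e ∷ []) (ι (suc n)))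
      (trans (cong (_+ eval (- e ∷ []) (ι (suc n))) (trans (eval-linear 2ℚ (- 4ℚ) D (ι (suc n))) (cong ((2ℚ + ι (suc n) * (- 4ℚ)) *_) (eval-diff-1 P n))))
        (trans (cong (λ z → (2ℚ + ι (suc n) * (- 4ℚ)) * (eval P (ι n) - eval P (ι (suc n))) + (- z + ι (suc n) * 0ℚ)) (sym (rec n n≥)))
          (lem (ι (suc n)) (eval P (ι (suc n))) (eval P (ι n)))))))
    where
    lem : ∀ x p q → (2ℚ + x * (- 4ℚ)) * (q - p) + (- (x * p - (4ℚ * x - 2ℚ) * q) + x * 0ℚ) ≡ (- 2ℚ + x * 3ℚ) * p
    lem = solve-∀ ℚring
  top : coeff P ℓ ≡ 0ℚ
  top = *-cancel-0 {3ℚ} (λ ()) (begin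
    3ℚ * coeff P ℓ                             ≡⟨ lem (3ℚ * coeff P ℓ) ⟩
    - 2ℚ * 0ℚ + 3ℚ * coeff P ℓ                 ≡⟨ cong (λ z → - 2ℚ * z + 3ℚ * coeff P ℓ) (sym (coeff-≥length P (suc ℓ) P≤)) ⟩
    - 2ℚ * coeff P (suc ℓ) + 3ℚ * coeff P ℓ    ≡⟨ sym (cong₂ _+_ (coeff-⊙ (- 2ℚ) P (suc ℓ)) (coeff-⊙ 3ℚ P ℓ)) ⟩
    coeff ((- 2ℚ) ⊙ P) (suc ℓ) + coeff (3ℚ ⊙ P) ℓ ≡⟨ sym (coeff-⊕ ((- 2ℚ) ⊙ P) (0ℚ ∷ 3ℚ ⊙ P) (suc ℓ)) ⟩
    coeff lhs (suc ℓ)                          ≡⟨ agree⇒coeff≡ lhs rhs (suc n₀) agree (suc ℓ) ⟩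
    coeff rhs (suc ℓ)                          ≡⟨ coeff-≥length rhs (suc ℓ) rhs≤ ⟩
    0ℚ ∎)
    where
    open ≡-Reasoning
    lem : ∀ a → a ≡ - 2ℚ * 0ℚ + a
    lem = solve-∀ ℚring
  truncate : ∀ n → eval (take ℓ P) (ι n) ≡ eval P (ι n)
  truncate n = sym (trans (eval-take ℓ P (ι n) P≤) (trans (cong (λ z → eval (take ℓ P) (ι n) + z * ι n ^ ℓ) top) (lem (eval (take ℓ P) (ι n)) (ι n ^ ℓ))))
    where
    lem : ∀ a y → a + 0ℚ * y ≡ a
    lem = solve-∀ ℚring

eval-constant : ∀ p x → (∀ k → coeff p (suc k) ≡ 0ℚ) → eval p x ≡ coeff p 0
eval-constant [] x z = refl
eval-constant (c ∷ cs) x z = trans (cong (λ y → c + x * y) (eval-Zero cs x z)) (lem c x)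
  where
  lem : ∀ c x → c + x * 0ℚ ≡ c
  lem = solve-∀ ℚring

-- Divisibility alone leaves room here: `C` may have degree k, so x^k G = C only makes `G` constant.
-- The preceding leading term argument then gives P = 0, and with it C = 0.
x^k·[xPx-[4x-2]P[x-1]]-Zero : ∀ k C P → length C ≡ suc k →
  Ev (λ n → ι (suc n) ^ k * (ι (suc n) * eval P (ι (suc n)) - (4ℚ * ι (suc n) - 2ℚ) * eval P (ι n)) ≡ eval C (ι (suc n))) → Zero C
x^k·[xPx-[4x-2]P[x-1]]-Zero k C P C≡ (n₀ , e) = vanishing⇒Zero C (suc n₀) C-vanishes
  where
  G : Poly
  G = (0ℚ ∷ P) ⊕ -1ℚ ⊙ ((- 2ℚ ∷ 4ℚ ∷ []) ⊗ shift -1ℚ P)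
  g : ℕ → ℚ
  g n = ι (suc n) * eval P (ι (suc n)) - (4ℚ * ι (suc n) - 2ℚ) * eval P (ι n)
  eval-G : ∀ n → eval G (ι (suc n)) ≡ g n
  eval-G n = trans (eval-⊕ (0ℚ ∷ P) (-1ℚ ⊙ ((- 2ℚ ∷ 4ℚ ∷ []) ⊗ shift -1ℚ P)) (ι (suc n)))
    (trans (cong (eval (0ℚ ∷ P) (ι (suc n)) +_) (trans (eval-⊙ -1ℚ ((- 2ℚ ∷ 4ℚ ∷ []) ⊗ shift -1ℚ P) (ι (suc n)))
      (cong (-1ℚ *_) (trans (eval-⊗ (- 2ℚ ∷ 4ℚ ∷ []) (shift -1ℚ P) (ι (suc n))) (cong (eval (- 2ℚ ∷ 4ℚ ∷ []) (ι (suc n)) *_) (eval-shift-1 P n))))))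
      (lem (ι (suc n)) (eval P (ι (suc n))) (eval P (ι n))))
    where
    lem : ∀ x p q → (0ℚ + x * p) + -1ℚ * ((- 2ℚ + x * (4ℚ + x * 0ℚ)) * q) ≡ x * p - (4ℚ * x - 2ℚ) * q
    lem = solve-∀ ℚring
  agree : ∀ n → suc n₀ ℕ.≤ n → eval (X^ k · G) (ι n) ≡ eval C (ι n)
  agree (suc n) (s≤s n≥) = trans (eval-X^ k G (ι (suc n))) (trans (cong (ι (suc n) ^ k *_) (eval-G n)) (e n n≥))
  G-const : ∀ j → coeff G (suc j) ≡ 0ℚ
  G-const j = trans (sym (coeff-X^-+ k G (suc j))) (trans (agree⇒coeff≡ (X^ k · G) C (suc n₀) agree (k ℕ.+ suc j))
    (coeff-≥length C (k ℕ.+ suc j) (subst (ℕ._≤ k ℕ.+ suc j) (sym C≡) (subst (suc k ℕ.≤_) (sym (ℕₚ.+-suc k j)) (s≤s (ℕₚ.m≤m+n k j))))))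
  P≡0 : ∀ n → eval P (ι n) ≡ 0ℚ
  P≡0 = xPx-[4x-2]P[x-1]-constant (coeff G 0) (length P) P ℕₚ.≤-refl
    (0 , λ n _ → trans (sym (eval-G n)) (eval-constant G (ι (suc n)) G-const))
  C-vanishes : ∀ n → suc n₀ ℕ.≤ n → eval C (ι n) ≡ 0ℚ
  C-vanishes (suc n) (s≤s n≥) = trans (sym (e n n≥)) (trans (cong₂ (λ y z → ι (suc n) ^ k * (ι (suc n) * y - (4ℚ * ι (suc n) - 2ℚ) * z)) (P≡0 (suc n)) (P≡0 n))
    (lem (ι (suc n) ^ k) (ι (suc n))))
    where
    lem : ∀ y x → y * (x * 0ℚ - (4ℚ * x - 2ℚ) * 0ℚ) ≡ 0ℚ
    lem = solve-∀ ℚring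

ρ : List ℕ → ℕ → ℚ
ρ []      n = ρ₀ n
ρ (_ ∷ _) n = 1ℚ

-- The zero 1/2 of 4 - 2/n is not an integer; this is why 0 is the only singular point of the
-- recurrence for σ(∅).
4x-2≢0 : ∀ n → 4ℚ * ι (suc n) - 2ℚ ≢ 0ℚ
4x-2≢0 n e = ι-suc≢0 (4 ℕ.* n ℕ.+ 1) (trans (trans (cong ι (sym (ℕₚ.+-suc (4 ℕ.* n) 1))) (ι-4n+2 n)) e)

-- Once `EvPoly-solution` has made `h` a polynomial, the recurrence multiplied by a power of x
-- compares polynomials, and the numbers `c t` reappear as the coefficients of `cleared`.
polar≡0⇒≡0 : ∀ b (h : ℕ → ℚ) K c q → EvNZ q → EvPoly (λ n → eval q (ι n) * h n) →
  Ev (λ n → h (suc n) ≡ ρ b (suc n) * h n + polar c K (suc n)) → ∀ t → t ℕ.< K → c t ≡ 0ℚ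
polar≡0⇒≡0 [] h (suc k) c q q≢0 I rec = cleared-Zero c (suc k) (uncurry fin (EvPoly-solution h (suc k) A C A≢0 (Ev-map rec′ rec) q q≢0 I))
  where
  A C : Poly
  -- One of the k + 1 factors x is spent on the pole of `ρ₀`, since x (4 - 2/x) = 4x - 2.
  A = X^ k · (- 2ℚ ∷ 4ℚ ∷ [])
  C = cleared c (suc k)
  lem₁ : ∀ y x → y * (- 2ℚ + x * (4ℚ + x * 0ℚ)) ≡ y * (4ℚ * x - 2ℚ)
  lem₁ = solve-∀ ℚring
  eval-A : ∀ x → eval A x ≡ x ^ k * (4ℚ * x - 2ℚ)
  eval-A x = trans (eval-X^ k (- 2ℚ ∷ 4ℚ ∷ []) x) (lem₁ (x ^ k) x)
  A≢0 : ∀ j → eval A (ι (suc j)) ≢ 0ℚ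
  A≢0 j = *-≢0 (^-≢0 k (ι-suc≢0 j)) (4x-2≢0 j) ∘ trans (sym (eval-A (ι (suc j))))
  lem₂ : ∀ x y i h s → x * y * ((4ℚ - 2ℚ * i) * h + s) ≡ y * (4ℚ * x - 2ℚ * (x * i)) * h + x * y * s
  lem₂ = solve-∀ ℚring
  lem₃ : ∀ x y h s → y * (4ℚ * x - 2ℚ * 1ℚ) * h + s ≡ y * (4ℚ * x - 2ℚ) * h + s
  lem₃ = solve-∀ ℚring
  rec′ : ∀ n → h (suc n) ≡ ρ₀ (suc n) * h n + polar c (suc k) (suc n) →
    ι (suc n) ^ suc k * h (suc n) ≡ eval A (ι (suc n)) * h n + eval C (ι (suc n))
  rec′ n e = begin
    x * y * h (suc n)                                 ≡⟨ cong (x * y *_) e ⟩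
    x * y * ((4ℚ - 2ℚ * i) * h n + s)                 ≡⟨ lem₂ x y i (h n) s ⟩
    y * (4ℚ * x - 2ℚ * (x * i)) * h n + x * y * s     ≡⟨ cong (λ z → y * (4ℚ * x - 2ℚ * z) * h n + x * y * s) (ι-inv n) ⟩
    y * (4ℚ * x - 2ℚ * 1ℚ) * h n + x * y * s          ≡⟨ lem₃ x y (h n) (x * y * s) ⟩
    y * (4ℚ * x - 2ℚ) * h n + x * y * s               ≡⟨ cong₂ (λ u v → u * h n + v) (sym (eval-A x)) (sym (eval-cleared c (suc k) n)) ⟩
    eval A x * h n + eval C x                         ∎
    where
    open ≡-Reasoning
    x = ι (suc n)
    y = ι (suc n) ^ k
    i = invℕ (suc n)
    s = polar c (suc k) (suc n)
  lem₄ : ∀ x y p q a c → x * y * p ≡ a * q + c → a ≡ y * (4ℚ * x - 2ℚ) → y * (x * p - (4ℚ * x - 2ℚ) * q) ≡ c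
  lem₄ x y p q a c e a≡ = trans (lem₅ x y p q) (trans (cong₂ (λ u v → u - v * q) e (sym a≡)) (lem₆ (a * q) c))
    where
    lem₅ : ∀ x y p q → y * (x * p - (4ℚ * x - 2ℚ) * q) ≡ x * y * p - y * (4ℚ * x - 2ℚ) * q
    lem₅ = solve-∀ ℚring
    lem₆ : ∀ a c → a + c - a ≡ c
    lem₆ = solve-∀ ℚring
  fin : ∀ P → Ev (λ n → h n ≡ eval P (ι n)) → Zero C
  fin P hP = x^k·[xPx-[4x-2]P[x-1]]-Zero k C P (length-cleared c (suc k))
    (Ev-zip (λ n e (hn , hsn) → lem₄ (ι (suc n)) (ι (suc n) ^ k) (eval P (ι (suc n))) (eval P (ι n)) (eval A (ι (suc n))) (eval C (ι (suc n)))
        (subst₂ (λ u v → ι (suc n) ^ suc k * u ≡ eval A (ι (suc n)) * v + eval C (ι (suc n))) hsn hn e) (eval-A (ι (suc n))))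
      (Ev-map rec′ rec) (Ev-zip (λ n → _,_) hP (Ev-suc hP)))
polar≡0⇒≡0 (_ ∷ _) h K c q q≢0 I rec = cleared-Zero c K (uncurry fin (EvPoly-solution h K A C A≢0 (Ev-map rec′ rec) q q≢0 I))
  where
  A C : Poly
  A = X^ K · (1ℚ ∷ [])
  C = cleared c K
  lem₁ : ∀ y x → y * (1ℚ + x * 0ℚ) ≡ y
  lem₁ = solve-∀ ℚring
  eval-A : ∀ x → eval A x ≡ x ^ K
  eval-A x = trans (eval-X^ K (1ℚ ∷ []) x) (lem₁ (x ^ K) x)
  A≢0 : ∀ j → eval A (ι (suc j)) ≢ 0ℚ
  A≢0 j = ^-≢0 K (ι-suc≢0 j) ∘ trans (sym (eval-A (ι (suc j))))
  lem₂ : ∀ y h s → y * (1ℚ * h + s) ≡ y * h + y * s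
  lem₂ = solve-∀ ℚring
  rec′ : ∀ n → h (suc n) ≡ 1ℚ * h n + polar c K (suc n) →
    ι (suc n) ^ K * h (suc n) ≡ eval A (ι (suc n)) * h n + eval C (ι (suc n))
  rec′ n e = trans (cong (ι (suc n) ^ K *_) e) (trans (lem₂ (ι (suc n) ^ K) (h n) (polar c K (suc n)))
    (cong₂ (λ u v → u * h n + v) (sym (eval-A (ι (suc n)))) (sym (eval-cleared c K n))))
  lem₄ : ∀ y p q a c → y * p ≡ a * q + c → a ≡ y → y * (p - q) ≡ c
  lem₄ y p q a c e a≡ = trans (lem₅ y p q) (trans (cong₂ (λ u v → u - v * q) e (sym a≡)) (lem₆ (a * q) c))
    where
    lem₅ : ∀ y p q → y * (p - q) ≡ y * p - y * q
    lem₅ = solve-∀ ℚring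
    lem₆ : ∀ a c → a + c - a ≡ c
    lem₆ = solve-∀ ℚring
  fin : ∀ P → Ev (λ n → h n ≡ eval P (ι n)) → Zero C
  fin P hP = x^K·[Px-P[x-1]]-Zero K C P (length-cleared c K)
    (Ev-zip (λ n e (hn , hsn) → lem₄ (ι (suc n) ^ K) (eval P (ι (suc n))) (eval P (ι n)) (eval A (ι (suc n))) (eval C (ι (suc n)))
        (subst₂ (λ u v → ι (suc n) ^ K * u ≡ eval A (ι (suc n)) * v + eval C (ι (suc n))) hsn hn e) (eval-A (ι (suc n))))
      (Ev-map rec′ rec) (Ev-zip (λ n → _,_) hP (Ev-suc hP)))

-- Linear independence

Tends0-≗ : ∀ {f g} → Tends0 f → Ev (λ N → g N ≡ f N) → Tends0 g
Tends0-≗ f→0 e ε ε>0 = Ev-zip (λ N lt eq → subst (λ z → ∣ z ∣ < ε) (sym eq) lt) (f→0 ε ε>0) e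

Tends0-+ : ∀ {f g} → Tends0 f → Tends0 g → Tends0 (λ N → f N + g N)
Tends0-+ {f} {g} f→0 g→0 ε ε>0 = Ev-zip
  (λ N lt lt′ → ≤-<-trans (∣p+q∣≤∣p∣+∣q∣ (f N) (g N)) (subst (∣ f N ∣ + ∣ g N ∣ <_) (lem ε) (+-mono-< lt lt′)))
  (f→0 (ℚ.½ * ε) δ>0) (g→0 (ℚ.½ * ε) δ>0)
  where
  lem : ∀ ε → ℚ.½ * ε + ℚ.½ * ε ≡ ε
  lem = solve-∀ ℚring
  δ>0 : 0ℚ < ℚ.½ * ε
  δ>0 = subst (_< ℚ.½ * ε) (*-zeroʳ ℚ.½) (*-monoʳ-<-pos ℚ.½ ε>0)

Tends0-* : ∀ c {f} → Tends0 f → Tends0 (λ N → c * f N)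
Tends0-* c {f} f→0 ε ε>0 = uncurry scale (archimedean ∣ c ∣)
  where
  open ≤-Reasoning
  scale : ∀ M → ∣ c ∣ ≤ ι M → Ev (λ N → ∣ c * f N ∣ < ε)
  scale M c≤M = Ev-map bound (f→0 (i * ε) δ>0)
    where
    m i : ℚ
    m = ι (suc M)
    i = invℕ (suc M)
    m>0 : ℚ.Positive m
    m>0 = ℚ.positive (<-≤-trans (positive⁻¹ 1ℚ) (subst (_≤ m) ι-1 (ι-mono-≤ (s≤s z≤n))))
    i>0 : ℚ.Positive i
    i>0 = normalize-pos 1 (suc M)
    δ>0 : 0ℚ < i * ε
    δ>0 = subst (_< i * ε) (*-zeroʳ i) (*-monoʳ-<-pos i {{i>0}} ε>0)
    bound : ∀ N → ∣ f N ∣ < i * ε → ∣ c * f N ∣ < ε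
    bound N lt = begin-strict
      ∣ c * f N ∣        ≡⟨ ∣p*q∣≡∣p∣*∣q∣ c (f N) ⟩
      ∣ c ∣ * ∣ f N ∣    ≤⟨ *-monoʳ-≤-nonNeg ∣ f N ∣ {{∣-∣-nonNeg (f N)}} (≤-trans c≤M (ι-mono-≤ (ℕₚ.n≤1+n M))) ⟩
      m * ∣ f N ∣        <⟨ *-monoʳ-<-pos m {{m>0}} lt ⟩
      m * (i * ε)        ≡⟨ sym (*-assoc m i ε) ⟩
      m * i * ε          ≡⟨ cong (_* ε) (ι-inv M) ⟩
      1ℚ * ε             ≡⟨ *-identityˡ ε ⟩
      ε                  ∎

Tends0-const : ∀ {c} → Tends0 (λ N → c) → c ≡ 0ℚ
Tends0-const {c} c→0 with c ≟ 0ℚ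
... | yes c≡0 = c≡0
... | no c≢0 = contradiction (proj₂ (c→0 ∣ c ∣ (≢0⇒0<∣∣ c≢0)) _ ℕₚ.≤-refl) (<-irrefl refl)

Ev-∀< : ∀ K {P : ℕ → ℕ → Set} → (∀ t → t ℕ.< K → Ev (P t)) → Ev (λ n → ∀ t → t ℕ.< K → P t n)
Ev-∀< zero e = 0 , λ n _ t ()
Ev-∀< (suc K) {P} e = Ev-zip (λ n ps p t t<1+K → extend n ps p t (ℕₚ.m≤n⇒m<n∨m≡n (ℕₚ.≤-pred t<1+K)))
  (Ev-∀< K (λ t t<K → e t (ℕₚ.m<n⇒m<1+n t<K))) (e K ℕₚ.≤-refl)
  where
  extend : ∀ n → (∀ t → t ℕ.< K → P t n) → P K n → ∀ t → t ℕ.< K ⊎ t ≡ K → P t n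
  extend n ps p t (inj₁ t<K) = ps t t<K
  extend n ps p t (inj₂ refl) = p

EvPoly-Σ< : ∀ K {f : ℕ → ℕ → ℚ} → (∀ t → t ℕ.< K → EvPoly (f t)) → EvPoly (λ n → Σ< K (λ t → f t n))
EvPoly-Σ< zero e = EvPoly-const 0ℚ
EvPoly-Σ< (suc K) e = EvPoly-+ (EvPoly-Σ< K (λ t t<K → e t (ℕₚ.m<n⇒m<1+n t<K))) (e K ℕₚ.≤-refl)

^*powNeg : ∀ n {t M} → t ℕ.≤ M → ι (suc n) ^ M * powNeg (suc n) (ℤ.+ t) ≡ ι (suc n) ^ (M ∸ t)
^*powNeg n {t} {M} t≤M = begin
  x ^ M * p                    ≡⟨ cong (λ k → x ^ k * p) (sym (ℕₚ.m∸n+n≡m t≤M)) ⟩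
  x ^ (M ∸ t ℕ.+ t) * p        ≡⟨ cong (_* p) (^-+ (M ∸ t)) ⟩
  x ^ (M ∸ t) * x ^ t * p      ≡⟨ *-assoc (x ^ (M ∸ t)) (x ^ t) p ⟩
  x ^ (M ∸ t) * (x ^ t * p)    ≡⟨ cong (x ^ (M ∸ t) *_) (powNeg-inverse n t) ⟩
  x ^ (M ∸ t) * 1ℚ             ≡⟨ *-identityʳ (x ^ (M ∸ t)) ⟩
  x ^ (M ∸ t)                  ∎
  where
  open ≡-Reasoning
  x p : ℚ
  x = ι (suc n)
  p = powNeg (suc n) (ℤ.+ t)
  ^-+ : ∀ a → x ^ (a ℕ.+ t) ≡ x ^ a * x ^ t
  ^-+ zero = sym (*-identityˡ (x ^ t))
  ^-+ (suc a) = trans (cong (x *_) (^-+ a)) (sym (*-assoc x (x ^ a) (x ^ t)))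

EvPoly-ρ : ∀ b M → EvPoly (λ n → ι (suc n) ^ suc M * ρ b (suc n))
EvPoly-ρ [] M = EvPoly-≗
  (EvPoly-* (EvPoly-suc (EvPoly-^ M)) (EvPoly-+ (EvPoly-* (EvPoly-const 4ℚ) (EvPoly-suc EvPoly-ι)) (EvPoly-const (- 2ℚ))))
  (0 , λ n _ → trans (lem₁ (ι (suc n)) (ι (suc n) ^ M) (invℕ (suc n)))
    (trans (cong (λ z → ι (suc n) ^ M * (4ℚ * ι (suc n) - 2ℚ * z)) (ι-inv n)) (lem₂ (ι (suc n)) (ι (suc n) ^ M))))
  where
  lem₁ : ∀ x y i → x * y * (4ℚ - 2ℚ * i) ≡ y * (4ℚ * x - 2ℚ * (x * i))
  lem₁ = solve-∀ ℚring
  lem₂ : ∀ x y → y * (4ℚ * x - 2ℚ * 1ℚ) ≡ y * (4ℚ * x + (- 2ℚ))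
  lem₂ = solve-∀ ℚring
EvPoly-ρ (_ ∷ _) M = EvPoly-* (EvPoly-suc (EvPoly-^ (suc M))) (EvPoly-const 1ℚ)

-- An entry t of b stands for the exponent t + 1, and the last exponent comes first.
σ′ : List ℕ → ℕ → ℕ → ℚ
σ′ b = S (map (λ t → ℤ.+ suc t) b)

-- Finite sums over the indices of bounded depth and exponents

module Levels (K : ℕ) where

  -- Bounding the entries makes each depth a finite set. The shift τ only deletes entries, so the
  -- bound is stable.
  data Level : ℕ → List ℕ → Set where
    []  : Level 0 []
    _∷_ : ∀ {r t b} → t ℕ.< K → Level r b → Level (suc r) (t ∷ b)

  Level-length : ∀ {r b} → Level r b → length b ≡ r
  Level-length [] = refl
  Level-length (_ ∷ l) = cong suc (Level-length l)

  -- The last exponent is summed innermost: this groups the indices `t ∷ b` that contribute to the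
  -- coefficient of a given `b` under τ.
  ΣLevel : ℕ → (List ℕ → ℚ) → ℚ
  ΣLevel zero    f = f []
  ΣLevel (suc r) f = ΣLevel r (λ b → Σ< K (λ t → f (t ∷ b)))

  Σ≤Level : ℕ → (List ℕ → ℚ) → ℚ
  Σ≤Level zero    f = f []
  Σ≤Level (suc r) f = Σ≤Level r f + ΣLevel (suc r) f

  ΣLevel-cong : ∀ r {f g} → (∀ b → Level r b → f b ≡ g b) → ΣLevel r f ≡ ΣLevel r g
  ΣLevel-cong zero e = e [] []
  ΣLevel-cong (suc r) e = ΣLevel-cong r λ b l → Σ<-cong K λ t t<K → e (t ∷ b) (t<K ∷ l)

  ΣLevel-+ : ∀ r f g → ΣLevel r (λ b → f b + g b) ≡ ΣLevel r f + ΣLevel r g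
  ΣLevel-+ zero f g = refl
  ΣLevel-+ (suc r) f g = trans (ΣLevel-cong r λ b _ → Σ<-+ K (λ t → f (t ∷ b)) (λ t → g (t ∷ b)))
    (ΣLevel-+ r (λ b → Σ< K (λ t → f (t ∷ b))) (λ b → Σ< K (λ t → g (t ∷ b))))

  ΣLevel-* : ∀ r c f → ΣLevel r (λ b → c * f b) ≡ c * ΣLevel r f
  ΣLevel-* zero c f = refl
  ΣLevel-* (suc r) c f = trans (ΣLevel-cong r λ b _ → Σ<-* K c (λ t → f (t ∷ b))) (ΣLevel-* r c (λ b → Σ< K (λ t → f (t ∷ b))))

  ΣLevel-zero : ∀ r {f} → (∀ b → Level r b → f b ≡ 0ℚ) → ΣLevel r f ≡ 0ℚ
  ΣLevel-zero zero e = e [] []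
  ΣLevel-zero (suc r) e = ΣLevel-zero r λ b l → Σ<-zero K λ t t<K → e (t ∷ b) (t<K ∷ l)

  Σ≤Level-cong : ∀ r {f g} → (∀ j b → j ℕ.≤ r → Level j b → f b ≡ g b) → Σ≤Level r f ≡ Σ≤Level r g
  Σ≤Level-cong zero e = e 0 [] z≤n []
  Σ≤Level-cong (suc r) e = cong₂ _+_ (Σ≤Level-cong r (λ j b j≤r → e j b (ℕₚ.m≤n⇒m≤1+n j≤r)))
    (ΣLevel-cong (suc r) (λ b → e (suc r) b ℕₚ.≤-refl))

  Σ≤Level-+ : ∀ r f g → Σ≤Level r (λ b → f b + g b) ≡ Σ≤Level r f + Σ≤Level r g
  Σ≤Level-+ zero f g = refl
  Σ≤Level-+ (suc r) f g = trans (cong₂ _+_ (Σ≤Level-+ r f g) (ΣLevel-+ (suc r) f g))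
    (lem (Σ≤Level r f) (Σ≤Level r g) (ΣLevel (suc r) f) (ΣLevel (suc r) g))
    where
    lem : ∀ a b c d → a + b + (c + d) ≡ a + c + (b + d)
    lem = solve-∀ ℚring

  Σ≤Level-* : ∀ r c f → Σ≤Level r (λ b → c * f b) ≡ c * Σ≤Level r f
  Σ≤Level-* zero c f = refl
  Σ≤Level-* (suc r) c f = trans (cong₂ _+_ (Σ≤Level-* r c f) (ΣLevel-* (suc r) c f)) (sym (*-distribˡ-+ c (Σ≤Level r f) (ΣLevel (suc r) f)))

  Ev-∀Level : ∀ r {P : List ℕ → ℕ → Set} → (∀ b → Level r b → Ev (P b)) → Ev (λ n → ∀ b → Level r b → P b n)
  Ev-∀Level zero e = Ev-map (λ { n p _ [] → p }) (e [] [])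
  Ev-∀Level (suc r) e = Ev-map (λ { n p (t ∷ b) (t<K ∷ l) → p b l t t<K })
    (Ev-∀Level r (λ b l → Ev-∀< K (λ t t<K → e (t ∷ b) (t<K ∷ l))))

  -- The coefficient of σ′ b (suc n) in Σ F(b) σ′ b n.
  push : (List ℕ → ℚ) → ℕ → List ℕ → ℚ
  push F n b = ρ b (suc n) * F b + polar (λ t → F (t ∷ b)) K (suc n)

  ΣLevel-push : ∀ r (F : List ℕ → ℚ) n N → n ℕ.< N → ΣLevel (suc r) (λ b → F b * σ′ b n N) ≡
    ΣLevel (suc r) (λ b → F b * σ′ b (suc n) N) + ΣLevel r (λ b → polar (λ t → F (t ∷ b)) K (suc n) * σ′ b (suc n) N)
  ΣLevel-push r F n N n<N = trans (ΣLevel-cong r inner)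
    (ΣLevel-+ r (λ b → Σ< K (λ t → F (t ∷ b) * σ′ (t ∷ b) (suc n) N)) (λ b → polar (λ t → F (t ∷ b)) K (suc n) * σ′ b (suc n) N))
    where
    lem : ∀ f s p s′ → f * (s + p * s′) ≡ f * s + s′ * (f * p)
    lem = solve-∀ ℚring
    inner : ∀ b → Level r b → Σ< K (λ t → F (t ∷ b) * σ′ (t ∷ b) n N) ≡
      Σ< K (λ t → F (t ∷ b) * σ′ (t ∷ b) (suc n) N) + polar (λ t → F (t ∷ b)) K (suc n) * σ′ b (suc n) N
    inner b _ = trans (Σ<-cong K λ t _ → trans (cong (F (t ∷ b) *_) (S-suc (ℤ.+ suc t) (map (λ t → ℤ.+ suc t) b) n N n<N))
        (lem (F (t ∷ b)) (σ′ (t ∷ b) (suc n) N) (powNeg (suc n) (ℤ.+ suc t)) (σ′ b (suc n) N)))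
      (trans (Σ<-+ K (λ t → F (t ∷ b) * σ′ (t ∷ b) (suc n) N) (λ t → σ′ b (suc n) N * (F (t ∷ b) * powNeg (suc n) (ℤ.+ suc t))))
        (cong (Σ< K (λ t → F (t ∷ b) * σ′ (t ∷ b) (suc n) N) +_)
          (trans (Σ<-* K (σ′ b (suc n) N) (λ t → F (t ∷ b) * powNeg (suc n) (ℤ.+ suc t))) (*-comm (σ′ b (suc n) N) (polar (λ t → F (t ∷ b)) K (suc n))))))

  -- The top depth stands apart because its coefficients do not change: no longer index contributes
  -- to them, and its indices are nonempty, so that ρ = 1.
  Σ≤Level-push : ∀ r (F : List ℕ → ℚ) n N → n ℕ.< N → Σ≤Level (suc r) (λ b → F b * σ′ b n N) ≡
    Σ≤Level r (λ b → push F n b * σ′ b (suc n) N) + ΣLevel (suc r) (λ b → F b * σ′ b (suc n) N)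
  Σ≤Level-push zero F n N n<N = trans (cong₂ _+_ (cong (F [] *_) (S-[] n N)) (ΣLevel-push 0 F n N n<N))
    (lem (F []) (ρ₀ (suc n)) (σ′ [] (suc n) N) (ΣLevel 1 (λ b → F b * σ′ b (suc n) N)) (polar (λ t → F (t ∷ [])) K (suc n)))
    where
    lem : ∀ f r s l p → f * (r * s) + (l + p * s) ≡ (r * f + p) * s + l
    lem = solve-∀ ℚring
  Σ≤Level-push (suc r) F n N n<N = begin
    Σ≤Level (suc r) (λ b → F b * σ′ b n N) + ΣLevel (suc (suc r)) (λ b → F b * σ′ b n N)
      ≡⟨ cong₂ _+_ (Σ≤Level-push r F n N n<N) (ΣLevel-push (suc r) F n N n<N) ⟩
    V + A + (B + C)
      ≡⟨ lem V A B C ⟩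
    V + (A + C) + B
      ≡⟨ cong (λ z → V + z + B) (sym (trans (ΣLevel-cong (suc r) split) (ΣLevel-+ (suc r) (λ b → F b * σ′ b (suc n) N) (λ b → polar (λ t → F (t ∷ b)) K (suc n) * σ′ b (suc n) N)))) ⟩
    V + ΣLevel (suc r) (λ b → push F n b * σ′ b (suc n) N) + B ∎
    where
    open ≡-Reasoning
    V A B C : ℚ
    V = Σ≤Level r (λ b → push F n b * σ′ b (suc n) N)
    A = ΣLevel (suc r) (λ b → F b * σ′ b (suc n) N)
    B = ΣLevel (suc (suc r)) (λ b → F b * σ′ b (suc n) N)
    C = ΣLevel (suc r) (λ b → polar (λ t → F (t ∷ b)) K (suc n) * σ′ b (suc n) N)
    lem : ∀ v a b c → v + a + (b + c) ≡ v + (a + c) + b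
    lem = solve-∀ ℚring
    lem₂ : ∀ f p s → (1ℚ * f + p) * s ≡ f * s + p * s
    lem₂ = solve-∀ ℚring
    split : ∀ b → Level (suc r) b → push F n b * σ′ b (suc n) N ≡ F b * σ′ b (suc n) N + polar (λ t → F (t ∷ b)) K (suc n) * σ′ b (suc n) N
    split (t ∷ b) _ = lem₂ (F (t ∷ b)) (polar (λ t′ → F (t′ ∷ t ∷ b)) K (suc n)) (σ′ (t ∷ b) (suc n) N)

module Independence (K : ℕ) where
  open Levels K

  -- The form in which a family of rational functions is given. A single `q` for all indices lets a
  -- whole relation be cleared at once.
  CommonDenominator : (List ℕ → ℕ → ℚ) → Set
  CommonDenominator F = ∃[ q ] EvNZ q × (∀ b → EvPoly (λ n → eval q (ι n) * F b n))

  Relation : ℕ → (List ℕ → ℕ → ℚ) → Set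
  Relation r F = Ev (λ n → Tends0 (λ N → Σ≤Level r (λ b → F b n * σ′ b n N)))

  -- The decision is an argument so that the denominator proof can match on it directly.
  differenced : ∀ r b → Dec (length b ℕ.≤ r) → (List ℕ → ℕ → ℚ) → ℕ → ℚ
  differenced r b (yes _) F n = push (λ b → F b n) n b - F b (suc n)
  differenced r b (no _)  F n = F b n - F b (suc n)

  -- The coefficients of Σ F(b, n) σ′ b n - Σ F(b, n + 1) σ′ b (n + 1), placed at index n + 1.
  Δ : ℕ → (List ℕ → ℕ → ℚ) → List ℕ → ℕ → ℚ
  Δ r F b zero    = 0ℚ
  Δ r F b (suc n) = differenced r b (length b ℕ.≤? r) F n

  Δ-lower : ∀ r F b n → length b ℕ.≤ r → Δ r F b (suc n) ≡ push (λ b → F b n) n b - F b (suc n)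
  Δ-lower r F b n b≤r with length b ℕ.≤? r
  ... | yes _ = refl
  ... | no b≰r = contradiction b≤r b≰r

  Δ-top : ∀ r F b n → length b ≡ suc r → Δ r F b (suc n) ≡ F b n - F b (suc n)
  Δ-top r F b n b≡ with length b ℕ.≤? r
  ... | yes b≤r = contradiction (subst (ℕ._≤ r) b≡ b≤r) (ℕₚ.<-irrefl refl)
  ... | no _ = refl

  Δ-CommonDenominator : ∀ r F → CommonDenominator F → CommonDenominator (Δ r F)
  Δ-CommonDenominator r F (q , (n₀ , q≢0) , I) = q′ , (suc n₀ , q′≢0) , λ b → EvPoly-pred (I′ b (length b ℕ.≤? r))
    where
    q′ : Poly
    -- The factor q(x - 1) clears the coefficients at n, q(x) those at n + 1, and the power of x
    -- clears the polar terms, of order at most K. The exponent K + 1 also covers the pole of `ρ₀`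
    -- when K = 0.
    q′ = X^ suc K · (q ⊗ shift -1ℚ q)
    Q : ℕ → ℚ
    Q n = eval q (ι n)
    eval-q′ : ∀ n → eval q′ (ι (suc n)) ≡ ι (suc n) ^ suc K * (Q (suc n) * Q n)
    eval-q′ n = trans (eval-X^ (suc K) (q ⊗ shift -1ℚ q) (ι (suc n)))
      (cong (ι (suc n) ^ suc K *_) (trans (eval-⊗ q (shift -1ℚ q) (ι (suc n))) (cong (Q (suc n) *_) (eval-shift-1 q n))))
    q′≢0 : ∀ n → suc n₀ ℕ.≤ n → eval q′ (ι n) ≢ 0ℚ
    q′≢0 (suc n) (s≤s n≥) = *-≢0 (^-≢0 (suc K) (ι-suc≢0 n)) (*-≢0 (q≢0 (suc n) (ℕₚ.m≤n⇒m≤1+n n≥)) (q≢0 n n≥)) ∘ trans (sym (eval-q′ n))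
    I₁ : EvPoly (λ n → Q (suc n))
    I₁ = EvPoly-suc (EvPoly-poly q)
    Iₓ : EvPoly (λ n → ι (suc n) ^ suc K)
    Iₓ = EvPoly-suc (EvPoly-^ (suc K))
    here : ∀ b → EvPoly (λ n → -1ℚ * (ι (suc n) ^ suc K * (Q n * (Q (suc n) * F b (suc n)))))
    here b = EvPoly-* (EvPoly-const -1ℚ) (EvPoly-* Iₓ (EvPoly-* (EvPoly-poly q) (EvPoly-suc (I b))))
    children : ∀ b → EvPoly (λ n → Σ< K (λ t → (ι (suc n) ^ suc K * powNeg (suc n) (ℤ.+ suc t)) * (Q (suc n) * (Q n * F (t ∷ b) n))))
    children b = EvPoly-Σ< K λ t t<K → EvPoly-*
      (EvPoly-≗ (EvPoly-suc (EvPoly-^ (suc K ∸ suc t))) (0 , λ n _ → ^*powNeg n (ℕₚ.m≤n⇒m≤1+n t<K)))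
      (EvPoly-* I₁ (I (t ∷ b)))
    children-eq : ∀ b n → ι (suc n) ^ suc K * (Q (suc n) * Q n) * polar (λ t → F (t ∷ b) n) K (suc n) ≡
      Σ< K (λ t → (ι (suc n) ^ suc K * powNeg (suc n) (ℤ.+ suc t)) * (Q (suc n) * (Q n * F (t ∷ b) n)))
    children-eq b n = trans (sym (Σ<-* K (ι (suc n) ^ suc K * (Q (suc n) * Q n)) (λ t → F (t ∷ b) n * powNeg (suc n) (ℤ.+ suc t))))
      (Σ<-cong K λ t _ → lem (ι (suc n) ^ suc K) (Q (suc n)) (Q n) (F (t ∷ b) n) (powNeg (suc n) (ℤ.+ suc t)))
      where
      lem : ∀ x q₁ q₀ f p → x * (q₁ * q₀) * (f * p) ≡ (x * p) * (q₁ * (q₀ * f))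
      lem = solve-∀ ℚring
    I′ : ∀ b d → EvPoly (λ n → eval q′ (ι (suc n)) * differenced r b d F n)
    I′ b (yes _) = EvPoly-≗
      (EvPoly-+ (EvPoly-+ (EvPoly-* (EvPoly-ρ b K) (EvPoly-* I₁ (I b))) (children b)) (here b))
      (0 , λ n _ → trans (cong (_* (push (λ b → F b n) n b - F b (suc n))) (eval-q′ n))
        (trans (lem₁ (ι (suc n) ^ suc K) (Q (suc n)) (Q n) (ρ b (suc n)) (F b n) (polar (λ t → F (t ∷ b) n) K (suc n)) (F b (suc n)))
          (cong (λ z → (ι (suc n) ^ suc K * ρ b (suc n)) * (Q (suc n) * (Q n * F b n)) + z + -1ℚ * (ι (suc n) ^ suc K * (Q n * (Q (suc n) * F b (suc n)))))
            (children-eq b n))))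
      where
      lem₁ : ∀ x q₁ q₀ ρ f p f₁ → x * (q₁ * q₀) * (ρ * f + p - f₁) ≡
        (x * ρ) * (q₁ * (q₀ * f)) + x * (q₁ * q₀) * p + -1ℚ * (x * (q₀ * (q₁ * f₁)))
      lem₁ = solve-∀ ℚring
    I′ b (no _) = EvPoly-≗
      (EvPoly-+ (EvPoly-* Iₓ (EvPoly-* I₁ (I b))) (here b))
      (0 , λ n _ → trans (cong (_* (F b n - F b (suc n))) (eval-q′ n))
        (lem₁ (ι (suc n) ^ suc K) (Q (suc n)) (Q n) (F b n) (F b (suc n))))
      where
      lem₁ : ∀ x q₁ q₀ f f₁ → x * (q₁ * q₀) * (f - f₁) ≡ x * (q₁ * (q₀ * f)) + -1ℚ * (x * (q₀ * (q₁ * f₁)))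
      lem₁ = solve-∀ ℚring

  Δ-sum : ∀ r F n N → n ℕ.< N → Σ≤Level (suc r) (λ b → Δ r F b (suc n) * σ′ b (suc n) N) ≡
    Σ≤Level (suc r) (λ b → F b n * σ′ b n N) + -1ℚ * Σ≤Level (suc r) (λ b → F b (suc n) * σ′ b (suc n) N)
  Δ-sum r F n N n<N = begin
    Σ≤Level r (λ b → Δ r F b (suc n) * s b) + ΣLevel (suc r) (λ b → Δ r F b (suc n) * s b)
      ≡⟨ cong₂ _+_
           (Σ≤Level-cong r λ j b j≤r l → trans (cong (_* s b) (Δ-lower r F b n (subst (ℕ._≤ r) (sym (Level-length l)) j≤r)))
             (lem₁ (push (λ b → F b n) n b) (F b (suc n)) (s b)))
           (ΣLevel-cong (suc r) λ b l → trans (cong (_* s b) (Δ-top r F b n (Level-length l))) (lem₁ (F b n) (F b (suc n)) (s b))) ⟩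
    Σ≤Level r (λ b → push (λ b → F b n) n b * s b + -1ℚ * (F b (suc n) * s b)) + ΣLevel (suc r) (λ b → F b n * s b + -1ℚ * (F b (suc n) * s b))
      ≡⟨ cong₂ _+_
           (trans (Σ≤Level-+ r (λ b → push (λ b → F b n) n b * s b) (λ b → -1ℚ * (F b (suc n) * s b)))
             (cong (A +_) (Σ≤Level-* r -1ℚ (λ b → F b (suc n) * s b))))
           (trans (ΣLevel-+ (suc r) (λ b → F b n * s b) (λ b → -1ℚ * (F b (suc n) * s b)))
             (cong (C +_) (ΣLevel-* (suc r) -1ℚ (λ b → F b (suc n) * s b)))) ⟩
    (A + -1ℚ * B) + (C + -1ℚ * D)
      ≡⟨ lem₂ A B C D ⟩
    (A + C) + -1ℚ * (B + D)
      ≡⟨ cong (_+ -1ℚ * (B + D)) (sym (Σ≤Level-push r (λ b → F b n) n N n<N)) ⟩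
    Σ≤Level (suc r) (λ b → F b n * σ′ b n N) + -1ℚ * (B + D) ∎
    where
    open ≡-Reasoning
    s : List ℕ → ℚ
    s b = σ′ b (suc n) N
    A B C D : ℚ
    A = Σ≤Level r (λ b → push (λ b → F b n) n b * s b)
    B = Σ≤Level r (λ b → F b (suc n) * s b)
    C = ΣLevel (suc r) (λ b → F b n * s b)
    D = ΣLevel (suc r) (λ b → F b (suc n) * s b)
    lem₁ : ∀ p f s → (p - f) * s ≡ p * s + -1ℚ * (f * s)
    lem₁ = solve-∀ ℚring
    lem₂ : ∀ a b c d → (a + -1ℚ * b) + (c + -1ℚ * d) ≡ (a + c) + -1ℚ * (b + d)
    lem₂ = solve-∀ ℚring

  Δ-Relation : ∀ r F → Relation (suc r) F → Relation (suc r) (Δ r F)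
  Δ-Relation r F rel = Ev-pred (Ev-zip
    (λ n R R′ → Tends0-≗ (Tends0-+ R (Tends0-* -1ℚ R′)) (suc n , λ N n<N → Δ-sum r F n N n<N))
    rel (Ev-suc rel))

  Relation-lower : ∀ r F → (∀ b → Level (suc r) b → Ev (λ n → F b n ≡ 0ℚ)) → Relation (suc r) F → Relation r F
  Relation-lower r F top≡0 = Ev-zip
    (λ n top≡0 R → Tends0-≗ R (0 , λ N _ → sym (trans
      (cong (Σ≤Level r (λ b → F b n * σ′ b n N) +_) (ΣLevel-zero (suc r) λ b l → trans (cong (_* σ′ b n N) (top≡0 b l)) (*-zeroˡ (σ′ b n N))))
      (+-identityʳ (Σ≤Level r (λ b → F b n * σ′ b n N))))))
    (Ev-∀Level (suc r) top≡0)

  Independent : ℕ → Set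
  Independent r = ∀ F → CommonDenominator F → Relation r F → ∀ j b → j ℕ.≤ r → Level j b → Ev (λ n → F b n ≡ 0ℚ)

  constant : ∀ {f : ℕ → ℚ} n₀ → (∀ n → n₀ ℕ.≤ n → f n ≡ f (suc n)) → ∀ n → n₀ ℕ.≤ n → f n ≡ f n₀
  constant {f} n₀ e n n≥ = subst (λ k → f k ≡ f n₀) (ℕₚ.m∸n+n≡m n≥) (go (n ∸ n₀))
    where
    go : ∀ d → f (d ℕ.+ n₀) ≡ f n₀
    go zero = refl
    go (suc d) = trans (sym (e (d ℕ.+ n₀) (ℕₚ.m≤n+m n₀ d))) (go d)

  -- Differencing lowers the degree of the top coefficients; once they are constant, the relation one level
  -- below is a first-order recurrence for a rational function.
  top-vanishes : ∀ r → Independent r → ∀ d F → CommonDenominator F →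
    (∀ b → Level (suc r) b → ∃[ p ] length p ℕ.≤ d × Ev (λ n → F b n ≡ eval p (ι n))) →
    Relation (suc r) F → ∀ b → Level (suc r) b → Ev (λ n → F b n ≡ 0ℚ)
  top-vanishes r ind zero F cd top rel b l with top b l
  ... | [] , _ , e = e
  top-vanishes r ind (suc d) F cd top rel (t ∷ b) (t<K ∷ l) = n₀ , λ n n≥ →
    trans (const t t<K n n≥) (polar≡0⇒≡0 b (F b) K (λ t → F (t ∷ b) n₀) (proj₁ cd) (proj₁ (proj₂ cd)) (proj₂ (proj₂ cd) b) rec t t<K)
    where
    cd′ : CommonDenominator (Δ r F)
    cd′ = Δ-CommonDenominator r F cd
    rel′ : Relation (suc r) (Δ r F)
    rel′ = Δ-Relation r F rel
    top′ : ∀ b → Level (suc r) b → ∃[ p ] length p ℕ.≤ d × Ev (λ n → Δ r F b n ≡ eval p (ι n))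
    top′ b l = let p , p≤ , e = top b l in diff -1ℚ p , length-diff -1ℚ p p≤ ,
      Ev-pred (Ev-zip (λ n e₀ e₁ → trans (Δ-top r F b n (Level-length l)) (trans (cong₂ _-_ e₀ e₁) (sym (eval-diff-1 p n)))) e (Ev-suc e))
    Δ-top≡0 : ∀ b → Level (suc r) b → Ev (λ n → Δ r F b n ≡ 0ℚ)
    Δ-top≡0 = top-vanishes r ind d (Δ r F) cd′ top′ rel′
    steady : Ev (λ n → ∀ t → t ℕ.< K → F (t ∷ b) n ≡ F (t ∷ b) (suc n))
    steady = Ev-∀< K λ t t<K → Ev-map (λ n e → -≡0⇒≡ (trans (sym (Δ-top r F (t ∷ b) n (Level-length (t<K ∷ l)))) e)) (Ev-suc (Δ-top≡0 (t ∷ b) (t<K ∷ l)))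
    n₀ : ℕ
    n₀ = proj₁ steady
    const : ∀ t → t ℕ.< K → ∀ n → n₀ ℕ.≤ n → F (t ∷ b) n ≡ F (t ∷ b) n₀
    const t t<K = constant n₀ (λ n n≥ → proj₂ steady n n≥ t t<K)
    -- The top coefficients of `Δ r F` vanish, so it is a relation of depth r with rational
    -- coefficients, to which the induction hypothesis applies. The vanishing of its coefficient at
    -- `b` is the recurrence `rec`; all the constants belonging to `t ∷ b` enter it together as one
    -- polar part.
    below≡0 : Ev (λ n → Δ r F b n ≡ 0ℚ)
    below≡0 = ind (Δ r F) cd′ (Relation-lower r (Δ r F) Δ-top≡0 rel′) r b ℕₚ.≤-refl l
    rec : Ev (λ n → F b (suc n) ≡ ρ b (suc n) * F b n + polar (λ t → F (t ∷ b) n₀) K (suc n))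
    rec = Ev-zip (λ n e const → sym (trans (cong (ρ b (suc n) * F b n +_)
        (Σ<-cong K λ t t<K → cong (_* powNeg (suc n) (ℤ.+ suc t)) (sym (const t t<K))))
        (-≡0⇒≡ (trans (sym (Δ-lower r F b n (ℕₚ.≤-reflexive (Level-length l)))) e))))
      (Ev-suc below≡0) (n₀ , λ n n≥ t t<K → const t t<K n n≥)

  -- Multiplication by the common denominator makes the top coefficients polynomial, as
  -- `top-vanishes` demands, and `q` can be cancelled again because it is eventually nonzero. What
  -- is left of the original relation has smaller depth.
  independent : ∀ r → Independent r
  independent zero F cd rel zero [] z≤n [] = Ev-map (λ n R → *-cancel-0 (binInv≢0 n) (trans (*-comm (binInv n) (F [] n)) (Tends0-const R))) rel
  independent (suc r) F cd@(q , q≢0 , I) rel j b j≤ l =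
    [ (λ { (s≤s j≤r) → independent r F cd (Relation-lower r F top≡0 rel) j b j≤r l })
    , (λ { refl → top≡0 b l }) ]′ (ℕₚ.m≤n⇒m<n∨m≡n j≤)
    where
    qF : List ℕ → ℕ → ℚ
    qF b n = eval q (ι n) * F b n
    cd′ : CommonDenominator qF
    cd′ = 1ℚ ∷ [] , (0 , λ n _ e → 1≢0 (trans (sym (lem (ι n))) e)) , λ b → EvPoly-* (EvPoly-poly (1ℚ ∷ [])) (I b)
      where
      lem : ∀ x → 1ℚ + x * 0ℚ ≡ 1ℚ
      lem = solve-∀ ℚring
    -- Here the eventual quantifier runs over degree bounds d: its closure under finite conjunctions
    -- supplies a maximum over the level.
    bound : Ev (λ d → ∀ b → Level (suc r) b → length (proj₁ (I b)) ℕ.≤ d)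
    bound = Ev-∀Level (suc r) λ b _ → length (proj₁ (I b)) , λ n n≥ → n≥
    rel′ : Relation (suc r) qF
    rel′ = Ev-map (λ n R → Tends0-≗ (Tends0-* (eval q (ι n)) R) (0 , λ N _ →
      trans (Σ≤Level-cong (suc r) λ j b _ _ → *-assoc (eval q (ι n)) (F b n) (σ′ b n N))
        (Σ≤Level-* (suc r) (eval q (ι n)) (λ b → F b n * σ′ b n N)))) rel
    top≡0 : ∀ b → Level (suc r) b → Ev (λ n → F b n ≡ 0ℚ)
    top≡0 b l = Ev-zip (λ n → *-cancel-0) q≢0 (top-vanishes r (independent r) (proj₁ bound) qF cd′
      (λ b l → proj₁ (I b) , proj₂ bound _ ℕₚ.≤-refl b l , proj₂ (I b)) rel′ b l)

-- Negligible truncation errors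

n<2^n : ∀ n → n ℕ.< 2 ℕ.^ n
n<2^n zero = s≤s z≤n
n<2^n (suc n) = begin-strict
  suc n                      <⟨ ℕₚ.+-monoʳ-< 1 (n<2^n n) ⟩
  1 ℕ.+ 2 ℕ.^ n              ≤⟨ ℕₚ.+-mono-≤ (ℕₚ.m^n>0 2 n) (ℕₚ.m≤m+n (2 ℕ.^ n) 0) ⟩
  2 ℕ.^ n ℕ.+ (2 ℕ.^ n ℕ.+ 0) ∎
  where open ℕₚ.≤-Reasoning

*-^ : ∀ m n k → (m ℕ.* n) ℕ.^ k ≡ m ℕ.^ k ℕ.* n ℕ.^ k
*-^ m n zero = refl
*-^ m n (suc k) = trans (cong (m ℕ.* n ℕ.*_) (*-^ m n k)) (lem m n (m ℕ.^ k) (n ℕ.^ k))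
  where
  lem : ∀ m n a b → m ℕ.* n ℕ.* (a ℕ.* b) ≡ m ℕ.* a ℕ.* (n ℕ.* b)
  lem = solveℕ-∀

-- With M = N / j one has N + 1 ≤ j (M + 1) ≤ j 2^M.
[1+N]^j≤j^j*2^N : ∀ k N → suc N ℕ.^ suc k ℕ.≤ suc k ℕ.^ suc k ℕ.* 2 ℕ.^ N
[1+N]^j≤j^j*2^N k N = begin
  suc N ℕ.^ j                        ≤⟨ ℕₚ.^-monoˡ-≤ j 1+N≤ ⟩
  (j ℕ.* 2 ℕ.^ M) ℕ.^ j              ≡⟨ *-^ j (2 ℕ.^ M) j ⟩
  j ℕ.^ j ℕ.* (2 ℕ.^ M) ℕ.^ j        ≡⟨ cong (j ℕ.^ j ℕ.*_) (ℕₚ.^-*-assoc 2 M j) ⟩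
  j ℕ.^ j ℕ.* 2 ℕ.^ (M ℕ.* j)        ≤⟨ ℕₚ.*-monoʳ-≤ (j ℕ.^ j) (ℕₚ.^-monoʳ-≤ 2 (m/n*n≤m N j)) ⟩
  j ℕ.^ j ℕ.* 2 ℕ.^ N                ∎
  where
  open ℕₚ.≤-Reasoning
  j = suc k
  M = N ℕ./ j
  1+N≤ : suc N ℕ.≤ j ℕ.* 2 ℕ.^ M
  1+N≤ = begin
    suc N                          ≡⟨ cong suc (m≡m%n+[m/n]*n N j) ⟩
    suc (N ℕ.% j) ℕ.+ M ℕ.* j      ≤⟨ ℕₚ.+-monoˡ-≤ (M ℕ.* j) (m%n<n N j) ⟩
    suc M ℕ.* j                    ≤⟨ ℕₚ.*-monoˡ-≤ j (n<2^n M) ⟩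
    2 ℕ.^ M ℕ.* j                  ≡⟨ ℕₚ.*-comm (2 ℕ.^ M) j ⟩
    j ℕ.* 2 ℕ.^ M                  ∎

2^-_ : ℕ → ℚ
2^- N = invℕ (2 ℕ.^ N)

0≤2^- : ∀ N → ℚ.NonNegative (2^- N)
0≤2^- N = ℚ.nonNegative (0≤invℕ (2 ℕ.^ N))

-- The bound does not depend on n, so a tail sum of at most N errors costs one more power of N + 1;
-- the polynomial factor also absorbs weights n^(-a) with a < 0.
record Negligible (E : ℕ → ℕ → ℚ) : Set where
  constructor negligible
  field
    factor degree : ℕ
    bound : ∀ n N → n ℕ.≤ N → ∣ E n N ∣ ≤ ι (factor ℕ.* suc N ℕ.^ degree) * 2^- N

-- The estimate of (N + 1)^j by 2^N is used with j one above the degree: a factor 1/(N + 1) is left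
-- over, so the error is at most B/(N + 1).
Negligible⇒Tends0 : ∀ {E} → Negligible E → ∀ n → Tends0 (E n)
Negligible⇒Tends0 {E} (negligible c k bound) n ε ε>0 = uncurry go (inverse (≢-sym (<⇒≢ ε>0)))
  where
  B : ℕ
  B = c ℕ.* suc k ℕ.^ suc k
  go : ∀ r → ε * r ≡ 1ℚ → Ev (λ N → ∣ E n N ∣ < ε)
  go r εr≡1 = uncurry conclude (archimedean (ι B * r))
    where
    open ≤-Reasoning
    conclude : ∀ M → ι B * r ≤ ι M → Ev (λ N → ∣ E n N ∣ < ε)
    conclude M M≥ = n ℕ.⊔ M , λ N N≥ → small N (ℕₚ.m⊔n≤o⇒m≤o n M N≥) (ℕₚ.m⊔n≤o⇒n≤o n M N≥)
      where
      small : ∀ N → n ℕ.≤ N → M ℕ.≤ N → ∣ E n N ∣ < ε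
      small N n≤N M≤N = *-cancelʳ-<-nonNeg (ι (suc N)) {{ℚ.nonNegative (0≤ι (suc N))}} (begin-strict
        ∣ E n N ∣ * ι (suc N)                          ≤⟨ *-monoʳ-≤-nonNeg (ι (suc N)) {{ℚ.nonNegative (0≤ι (suc N))}} (bound n N n≤N) ⟩
        ι (c ℕ.* suc N ℕ.^ k) * 2^- N * ι (suc N)      ≡⟨ lem₁ (ι (c ℕ.* suc N ℕ.^ k)) (2^- N) (ι (suc N)) ⟩
        ι (c ℕ.* suc N ℕ.^ k) * ι (suc N) * 2^- N      ≡⟨ cong (_* 2^- N) (sym (ι-* (c ℕ.* suc N ℕ.^ k) (suc N))) ⟩
        ι (c ℕ.* suc N ℕ.^ k ℕ.* suc N) * 2^- N        ≤⟨ *-monoʳ-≤-nonNeg (2^- N) {{0≤2^- N}} (ι-mono-≤ (ℕₚ.≤-trans (ℕₚ.≤-reflexive (lem₂ c (suc N) (suc N ℕ.^ k))) (ℕₚ.*-monoʳ-≤ c ([1+N]^j≤j^j*2^N k N)))) ⟩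
        ι (c ℕ.* (suc k ℕ.^ suc k ℕ.* 2 ℕ.^ N)) * 2^- N ≡⟨ cong (λ z → ι z * 2^- N) (sym (ℕₚ.*-assoc c (suc k ℕ.^ suc k) (2 ℕ.^ N))) ⟩
        ι (B ℕ.* 2 ℕ.^ N) * 2^- N                      ≡⟨ cong (_* 2^- N) (ι-* B (2 ℕ.^ N)) ⟩
        ι B * ι (2 ℕ.^ N) * 2^- N                      ≡⟨ *-assoc (ι B) (ι (2 ℕ.^ N)) (2^- N) ⟩
        ι B * (ι (2 ℕ.^ N) * 2^- N)                    ≡⟨ cong (ι B *_) (trans (invℕ-inverse (2 ℕ.^ N) (ℕₚ.m^n>0 2 N)) (sym εr≡1)) ⟩
        ι B * (ε * r)                                  ≡⟨ lem₃ (ι B) ε r ⟩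
        ι B * r * ε                                    ≤⟨ *-monoʳ-≤-nonNeg ε {{ℚ.nonNegative (<⇒≤ ε>0)}} (≤-trans M≥ (ι-mono-≤ M≤N)) ⟩
        ι N * ε                                        <⟨ *-monoˡ-<-pos ε {{ℚ.positive ε>0}} ι<ι ⟩
        ι (suc N) * ε                                  ≡⟨ *-comm (ι (suc N)) ε ⟩
        ε * ι (suc N)                                  ∎)
        where
        lem₁ : ∀ a b c → a * b * c ≡ a * c * b
        lem₁ = solve-∀ ℚring
        lem₂ : ∀ c m y → c ℕ.* y ℕ.* m ≡ c ℕ.* (m ℕ.* y)
        lem₂ = solveℕ-∀
        lem₃ : ∀ b e r → b * (e * r) ≡ b * r * e
        lem₃ = solve-∀ ℚring
        ι<ι : ι N < ι (suc N)
        ι<ι = subst₂ _<_ (+-identityʳ (ι N)) (sym (ι-suc N)) (+-monoʳ-< (ι N) (positive⁻¹ 1ℚ))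

Negligible-≗ : ∀ {E E′} → Negligible E → (∀ n N → n ℕ.≤ N → E′ n N ≡ E n N) → Negligible E′
Negligible-≗ (negligible c k bound) e = negligible c k λ n N n≤N → subst (λ z → ∣ z ∣ ≤ ι (c ℕ.* suc N ℕ.^ k) * 2^- N) (sym (e n N n≤N)) (bound n N n≤N)

Negligible-0 : Negligible (λ n N → 0ℚ)
Negligible-0 = negligible 0 0 λ n N _ → ≤-reflexive (sym (trans (cong (_* 2^- N) ι-0) (*-zeroˡ (2^- N))))

Negligible-+ : ∀ {E E′} → Negligible E → Negligible E′ → Negligible (λ n N → E n N + E′ n N)
Negligible-+ {E} {E′} (negligible c k bound) (negligible c′ k′ bound′) = negligible (c ℕ.+ c′) (k ℕ.+ k′) λ n N n≤N → begin
  ∣ E n N + E′ n N ∣                 ≤⟨ ∣p+q∣≤∣p∣+∣q∣ (E n N) (E′ n N) ⟩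
  ∣ E n N ∣ + ∣ E′ n N ∣             ≤⟨ +-mono-≤ (bound n N n≤N) (bound′ n N n≤N) ⟩
  ι (c ℕ.* suc N ℕ.^ k) * 2^- N + ι (c′ ℕ.* suc N ℕ.^ k′) * 2^- N  ≡⟨ sym (*-distribʳ-+ (2^- N) (ι (c ℕ.* suc N ℕ.^ k)) (ι (c′ ℕ.* suc N ℕ.^ k′))) ⟩
  (ι (c ℕ.* suc N ℕ.^ k) + ι (c′ ℕ.* suc N ℕ.^ k′)) * 2^- N        ≡⟨ cong (_* 2^- N) (sym (ι-+ (c ℕ.* suc N ℕ.^ k) (c′ ℕ.* suc N ℕ.^ k′))) ⟩
  ι (c ℕ.* suc N ℕ.^ k ℕ.+ c′ ℕ.* suc N ℕ.^ k′) * 2^- N            ≤⟨ *-monoʳ-≤-nonNeg (2^- N) {{0≤2^- N}} (ι-mono-≤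
      (ℕₚ.≤-trans (ℕₚ.+-mono-≤ (ℕₚ.*-monoʳ-≤ c (ℕₚ.^-monoʳ-≤ (suc N) (ℕₚ.m≤m+n k k′))) (ℕₚ.*-monoʳ-≤ c′ (ℕₚ.^-monoʳ-≤ (suc N) (ℕₚ.m≤n+m k′ k))))
        (ℕₚ.≤-reflexive (sym (ℕₚ.*-distribʳ-+ (suc N ℕ.^ (k ℕ.+ k′)) c c′))))) ⟩
  ι ((c ℕ.+ c′) ℕ.* suc N ℕ.^ (k ℕ.+ k′)) * 2^- N                  ∎
  where open ≤-Reasoning

Negligible-weight : ∀ {E : ℕ → ℕ → ℚ} (w : ℕ → ℕ → ℚ) c k → (∀ n N → n ℕ.≤ N → ∣ w n N ∣ ≤ ι (c ℕ.* suc N ℕ.^ k)) → Negligible E → Negligible (λ n N → w n N * E n N)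
Negligible-weight {E} w c k wb (negligible c′ k′ bound) = negligible (c ℕ.* c′) (k ℕ.+ k′) λ n N n≤N → begin
  ∣ w n N * E n N ∣                                      ≡⟨ ∣p*q∣≡∣p∣*∣q∣ (w n N) (E n N) ⟩
  ∣ w n N ∣ * ∣ E n N ∣                                  ≤⟨ *-monoˡ-≤-nonNeg ∣ w n N ∣ {{∣-∣-nonNeg (w n N)}} (bound n N n≤N) ⟩
  ∣ w n N ∣ * (ι (c′ ℕ.* suc N ℕ.^ k′) * 2^- N)          ≡⟨ sym (*-assoc ∣ w n N ∣ (ι (c′ ℕ.* suc N ℕ.^ k′)) (2^- N)) ⟩
  ∣ w n N ∣ * ι (c′ ℕ.* suc N ℕ.^ k′) * 2^- N            ≤⟨ *-monoʳ-≤-nonNeg (2^- N) {{0≤2^- N}} (*-monoʳ-≤-nonNeg (ι (c′ ℕ.* suc N ℕ.^ k′)) {{ℚ.nonNegative (0≤ι (c′ ℕ.* suc N ℕ.^ k′))}} (wb n N n≤N)) ⟩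
  ι (c ℕ.* suc N ℕ.^ k) * ι (c′ ℕ.* suc N ℕ.^ k′) * 2^- N ≡⟨ cong (_* 2^- N) (sym (ι-* (c ℕ.* suc N ℕ.^ k) (c′ ℕ.* suc N ℕ.^ k′))) ⟩
  ι (c ℕ.* suc N ℕ.^ k ℕ.* (c′ ℕ.* suc N ℕ.^ k′)) * 2^- N ≡⟨ cong (λ z → ι z * 2^- N) (trans (lem c c′ (suc N ℕ.^ k) (suc N ℕ.^ k′)) (cong (c ℕ.* c′ ℕ.*_) (sym (ℕₚ.^-distribˡ-+-* (suc N) k k′)))) ⟩
  ι (c ℕ.* c′ ℕ.* suc N ℕ.^ (k ℕ.+ k′)) * 2^- N          ∎
  where
  open ≤-Reasoning
  lem : ∀ c c′ x y → c ℕ.* x ℕ.* (c′ ℕ.* y) ≡ c ℕ.* c′ ℕ.* (x ℕ.* y)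
  lem = solveℕ-∀

Negligible-const* : ∀ a {E} → Negligible E → Negligible (λ n N → a * E n N)
Negligible-const* a {E} nE = uncurry (λ M a≤M → Negligible-weight (λ _ _ → a) M 0
  (λ n N _ → subst (∣ a ∣ ≤_) (cong ι (sym (ℕₚ.*-identityʳ M))) a≤M) nE) (archimedean ∣ a ∣)

Negligible-powNeg* : ∀ a {E} → Negligible E → Negligible (λ n N → powNeg n a * E n N)
Negligible-powNeg* a = Negligible-weight (λ n _ → powNeg n a) 1 ℤ.∣ a ∣ λ n N n≤N → ≤-trans (∣powNeg∣≤ n a)
  (ι-mono-≤ (ℕₚ.≤-trans (ℕₚ.^-monoˡ-≤ ℤ.∣ a ∣ (s≤s n≤N)) (ℕₚ.m≤m+n (suc N ℕ.^ ℤ.∣ a ∣) 0)))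

Negligible-T : ∀ {E} → Negligible E → Negligible (T E)
Negligible-T {E} (negligible c k bound) = negligible c (suc k) λ n N n≤N → begin
  ∣ T E n N ∣                                        ≤⟨ ∣Σ<∣≤ (N ∸ n) (λ j j< → bound (suc (n ℕ.+ j)) N (<∸⇒+< n N j<)) ⟩
  ι (N ∸ n) * (ι (c ℕ.* suc N ℕ.^ k) * 2^- N)        ≡⟨ sym (*-assoc (ι (N ∸ n)) (ι (c ℕ.* suc N ℕ.^ k)) (2^- N)) ⟩
  ι (N ∸ n) * ι (c ℕ.* suc N ℕ.^ k) * 2^- N          ≡⟨ cong (_* 2^- N) (sym (ι-* (N ∸ n) (c ℕ.* suc N ℕ.^ k))) ⟩
  ι ((N ∸ n) ℕ.* (c ℕ.* suc N ℕ.^ k)) * 2^- N        ≤⟨ *-monoʳ-≤-nonNeg (2^- N) {{0≤2^- N}} (ι-mono-≤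
      (ℕₚ.≤-trans (ℕₚ.*-monoˡ-≤ (c ℕ.* suc N ℕ.^ k) (ℕₚ.m≤n⇒m≤1+n (ℕₚ.m∸n≤m N n))) (ℕₚ.≤-reflexive (lem (suc N) c (suc N ℕ.^ k))))) ⟩
  ι (c ℕ.* suc N ℕ.^ suc k) * 2^- N                  ∎
  where
  open ≤-Reasoning
  lem : ∀ m c y → m ℕ.* (c ℕ.* y) ≡ c ℕ.* (m ℕ.* y)
  lem = solveℕ-∀

-- The boundary term from telescoping n^ℓ σ(∅). All other truncation errors are propagated from
-- terms of this kind.
Negligible-^*binInv : ∀ ℓ → Negligible (λ n N → ι N ^ ℓ * binInv N)
Negligible-^*binInv ℓ = negligible 1 ℓ λ n N _ → begin
  ∣ ι N ^ ℓ * binInv N ∣          ≡⟨ cong (λ z → ∣ z * binInv N ∣) (sym (ι-^ N ℓ)) ⟩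
  ∣ ι (N ℕ.^ ℓ) * binInv N ∣      ≡⟨ 0≤p⇒∣p∣≡p (subst (_≤ ι (N ℕ.^ ℓ) * binInv N) (*-zeroʳ (ι (N ℕ.^ ℓ)))
                                        (*-monoˡ-≤-nonNeg (ι (N ℕ.^ ℓ)) {{ℚ.nonNegative (0≤ι (N ℕ.^ ℓ))}} (0≤invℕ ((2 ℕ.* N) choose N)))) ⟩
  ι (N ℕ.^ ℓ) * binInv N          ≤⟨ *-monoˡ-≤-nonNeg (ι (N ℕ.^ ℓ)) {{ℚ.nonNegative (0≤ι (N ℕ.^ ℓ))}} (binInv≤ N) ⟩
  ι (N ℕ.^ ℓ) * 2^- N             ≤⟨ *-monoʳ-≤-nonNeg (2^- N) {{0≤2^- N}} (ι-mono-≤ (ℕₚ.≤-trans (ℕₚ.^-monoˡ-≤ ℓ (ℕₚ.n≤1+n N)) (ℕₚ.m≤m+n (suc N ℕ.^ ℓ) 0))) ⟩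
  ι (1 ℕ.* suc N ℕ.^ ℓ) * 2^- N   ∎
  where open ≤-Reasoning

-- Tail sums

Combination : Set
Combination = List (List ℕ × Poly)

val : Combination → ℕ → ℕ → ℚ
val []            n N = 0ℚ
val ((b , p) ∷ F) n N = eval p (ι n) * σ′ b n N + val F n N

val-++ : ∀ F G n N → val (F ++ G) n N ≡ val F n N + val G n N
val-++ [] G n N = sym (+-identityˡ (val G n N))
val-++ ((b , p) ∷ F) G n N = trans (cong (eval p (ι n) * σ′ b n N +_) (val-++ F G n N)) (sym (+-assoc (eval p (ι n) * σ′ b n N) (val F n N) (val G n N)))

scale : ℚ → Combination → Combination
scale a = map λ (b , p) → b , a ⊙ p

val-scale : ∀ a F n N → val (scale a F) n N ≡ a * val F n N
val-scale a [] n N = sym (*-zeroʳ a)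
val-scale a ((b , p) ∷ F) n N = trans (cong₂ (λ y z → y * σ′ b n N + z) (eval-⊙ a p (ι n)) (val-scale a F n N)) (lem a (eval p (ι n)) (σ′ b n N) (val F n N))
  where
  lem : ∀ a p s v → a * p * s + a * v ≡ a * (p * s + v)
  lem = solve-∀ ℚring

record Representable (X : ℕ → ℕ → ℚ) : Set where
  constructor represent
  field
    combination : Combination
    remainder   : Negligible (λ n N → X n N - val combination n N)

Representable-≗ : ∀ {X Y} → Representable X → (∀ n N → n ℕ.≤ N → Y n N ≡ X n N) → Representable Y
Representable-≗ (represent F negl) e = represent F (Negligible-≗ negl λ n N n≤N → cong (_- val F n N) (e n N n≤N))

Representable-+ : ∀ {X Y} → Representable X → Representable Y → Representable (λ n N → X n N + Y n N)
Representable-+ {X} {Y} (represent F negl) (represent G negl′) = represent (F ++ G) (Negligible-≗ (Negligible-+ negl negl′) λ n N _ →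
  trans (cong (λ z → X n N + Y n N - z) (val-++ F G n N)) (lem (X n N) (Y n N) (val F n N) (val G n N)))
  where
  lem : ∀ x y f g → x + y - (f + g) ≡ (x - f) + (y - g)
  lem = solve-∀ ℚring

Representable-* : ∀ a {X} → Representable X → Representable (λ n N → a * X n N)
Representable-* a {X} (represent F negl) = represent (scale a F) (Negligible-≗ (Negligible-const* a negl) λ n N _ →
  trans (cong (λ z → a * X n N - z) (val-scale a F n N)) (lem a (X n N) (val F n N)))
  where
  lem : ∀ a x f → a * x - a * f ≡ a * (x - f)
  lem = solve-∀ ℚring

Representable-negligible : ∀ {X} → Negligible X → Representable X
Representable-negligible {X} negl = represent [] (Negligible-≗ negl λ n N _ → +-identityʳ (X n N))

Representable-σ′ : ∀ b p → Representable (λ n N → eval p (ι n) * σ′ b n N)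
Representable-σ′ b p = represent ((b , p) ∷ []) (Negligible-≗ Negligible-0 λ n N _ → lem (eval p (ι n) * σ′ b n N))
  where
  lem : ∀ x → x - (x + 0ℚ) ≡ 0ℚ
  lem = solve-∀ ℚring

T-cong : ∀ X Y → (∀ m N → suc m ℕ.≤ N → X (suc m) N ≡ Y (suc m) N) → ∀ n N → T X n N ≡ T Y n N
T-cong X Y e n N = Σ<-cong (N ∸ n) λ j j< → e (n ℕ.+ j) N (<∸⇒+< n N j<)

T-+ : ∀ X Y n N → T (λ m N → X m N + Y m N) n N ≡ T X n N + T Y n N
T-+ X Y n N = Σ<-+ (N ∸ n) (λ j → X (suc (n ℕ.+ j)) N) (λ j → Y (suc (n ℕ.+ j)) N)

T-* : ∀ a X n N → T (λ m N → a * X m N) n N ≡ a * T X n N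
T-* a X n N = Σ<-* (N ∸ n) a (λ j → X (suc (n ℕ.+ j)) N)

-- A record rather than a synonym, so that `b` and `g` can be inferred from the type. Only positive
-- arguments of `g` matter, as a tail sum starts at n + 1; `TailRep-≗` exploits this.
record TailRep (b : List ℕ) (g : ℕ → ℚ) : Set where
  constructor tail
  field
    representable : Representable (T (λ m N → g m * σ′ b m N))
open TailRep

TailRep-≗ : ∀ {b f g} → TailRep b f → (∀ m → g (suc m) ≡ f (suc m)) → TailRep b g
TailRep-≗ {b} {f} {g} (tail R) e = tail $ Representable-≗ R λ n N _ →
  T-cong (λ m N → g m * σ′ b m N) (λ m N → f m * σ′ b m N) (λ m N _ → cong (_* σ′ b (suc m) N) (e m)) n N

TailRep-+ : ∀ {b f g} → TailRep b f → TailRep b g → TailRep b (λ m → f m + g m)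
TailRep-+ {b} {f} {g} (tail R) (tail R′) = tail $ Representable-≗ (Representable-+ R R′) λ n N _ → trans
  (T-cong (λ m N → (f m + g m) * σ′ b m N) (λ m N → f m * σ′ b m N + g m * σ′ b m N)
    (λ m N _ → *-distribʳ-+ (σ′ b (suc m) N) (f (suc m)) (g (suc m))) n N)
  (T-+ (λ m N → f m * σ′ b m N) (λ m N → g m * σ′ b m N) n N)

TailRep-* : ∀ a {b f} → TailRep b f → TailRep b (λ m → a * f m)
TailRep-* a {b} {f} (tail R) = tail $ Representable-≗ (Representable-* a R) λ n N _ → trans
  (T-cong (λ m N → a * f m * σ′ b m N) (λ m N → a * (f m * σ′ b m N))
    (λ m N _ → *-assoc a (f (suc m)) (σ′ b (suc m) N)) n N)
  (T-* a (λ m N → f m * σ′ b m N) n N)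

TailRep-0 : ∀ {b} → TailRep b (λ m → 0ℚ)
TailRep-0 {b} = tail $ Representable-negligible (Negligible-≗ Negligible-0 λ n N _ →
  Σ<-zero (N ∸ n) λ j _ → *-zeroˡ (σ′ b (suc (n ℕ.+ j)) N))

-- The polynomials u x^ℓ + r, one in each degree, form a triangular basis of Q[T]. Subtracting c/u
-- times the one that matches the leading term of `p` leaves a shorter polynomial.
TailRep-triangular : ∀ b →
  (∀ ℓ → ∃[ u ] ∃[ r ] u ≢ 0ℚ × length r ℕ.≤ ℓ × TailRep b (λ m → u * ι m ^ ℓ + eval r (ι m))) →
  ∀ p → TailRep b (λ m → eval p (ι m))
TailRep-triangular b tri p = go (length p) p ℕₚ.≤-refl
  where
  go : ∀ ℓ p → length p ℕ.≤ ℓ → TailRep b (λ m → eval p (ι m))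
  go zero [] _ = TailRep-0
  go (suc ℓ) p p≤ = let u , r , u≢0 , r≤ , R = tri ℓ in uncurry (solve u r r≤ R) (inverse u≢0)
    where
    c : ℚ
    c = coeff p ℓ
    -- The summand containing 1 - u v makes this an identity in any commutative ring; it disappears
    -- once u v = 1 is substituted.
    lem : ∀ c v u y r q → q + c * y ≡ c * v * (u * y + r) + (q + (- (c * v)) * r) + c * (1ℚ - u * v) * y
    lem = solve-∀ ℚring
    lem₂ : ∀ a y c → a + c * (1ℚ - 1ℚ) * y ≡ a
    lem₂ = solve-∀ ℚring
    solve : ∀ u r → length r ℕ.≤ ℓ → TailRep b (λ m → u * ι m ^ ℓ + eval r (ι m)) →
      ∀ v → u * v ≡ 1ℚ → TailRep b (λ m → eval p (ι m))
    solve u r r≤ R v uv≡1 = TailRep-≗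
      (TailRep-+ (TailRep-* (c * v) R)
        (go ℓ (take ℓ p ⊕ (- (c * v)) ⊙ r) (length-⊕ (take ℓ p) ((- (c * v)) ⊙ r) (length-take≤ ℓ p) (length-⊙ (- (c * v)) r r≤))))
      λ m → eq (ι (suc m))
      where
      open ≡-Reasoning
      eq : ∀ x → eval p x ≡ c * v * (u * x ^ ℓ + eval r x) + eval (take ℓ p ⊕ (- (c * v)) ⊙ r) x
      eq x = begin
        eval p x                                ≡⟨ eval-take ℓ p x p≤ ⟩
        eval (take ℓ p) x + c * x ^ ℓ           ≡⟨ lem c v u (x ^ ℓ) (eval r x) (eval (take ℓ p) x) ⟩
        A + (eval (take ℓ p) x + (- (c * v)) * eval r x) + c * (1ℚ - u * v) * x ^ ℓ
          ≡⟨ cong₂ (λ y z → A + y + c * (1ℚ - z) * x ^ ℓ)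
               (sym (trans (eval-⊕ (take ℓ p) ((- (c * v)) ⊙ r) x) (cong (eval (take ℓ p) x +_) (eval-⊙ (- (c * v)) r x)))) uv≡1 ⟩
        A + B + c * (1ℚ - 1ℚ) * x ^ ℓ           ≡⟨ lem₂ (A + B) (x ^ ℓ) c ⟩
        A + B                                   ∎
        where
        A B : ℚ
        A = c * v * (u * x ^ ℓ + eval r x)
        B = eval (take ℓ p ⊕ (- (c * v)) ⊙ r) x

monomial : ℕ → Poly
monomial ℓ = X^ ℓ · (1ℚ ∷ [])

eval-monomial : ∀ ℓ x → eval (monomial ℓ) x ≡ x ^ ℓ
eval-monomial ℓ x = trans (eval-X^ ℓ (1ℚ ∷ []) x) (lem (x ^ ℓ) x)
  where
  lem : ∀ y x → y * (1ℚ + x * 0ℚ) ≡ y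
  lem = solve-∀ ℚring

length-monomial : ∀ ℓ → length (monomial ℓ) ≡ suc ℓ
length-monomial zero = refl
length-monomial (suc ℓ) = cong suc (length-monomial ℓ)

-- Only the leading coefficient ℓ + 1 is tracked, since its nonvanishing is all that
-- `TailRep-triangular` asks for.
x^1+ℓ-[x-1]^1+ℓ : ∀ ℓ → ∃[ r ] length r ℕ.≤ ℓ × (∀ x → x ^ suc ℓ - (x + -1ℚ) ^ suc ℓ ≡ ι (suc ℓ) * x ^ ℓ + eval r x)
x^1+ℓ-[x-1]^1+ℓ zero = [] , z≤n , λ x → trans (lem x) (cong (λ z → z * 1ℚ + 0ℚ) (sym ι-1))
  where
  lem : ∀ x → x * 1ℚ - (x + -1ℚ) * 1ℚ ≡ 1ℚ * 1ℚ + 0ℚ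
  lem = solve-∀ ℚring
x^1+ℓ-[x-1]^1+ℓ (suc ℓ) = let r , r≤ , e = x^1+ℓ-[x-1]^1+ℓ ℓ in
  (0ℚ ∷ r) ⊕ ((- L) ⊙ monomial ℓ ⊕ -1ℚ ⊙ r) ,
  length-⊕ (0ℚ ∷ r) ((- L) ⊙ monomial ℓ ⊕ -1ℚ ⊙ r) (s≤s r≤)
    (length-⊕ ((- L) ⊙ monomial ℓ) (-1ℚ ⊙ r) (length-⊙ (- L) (monomial ℓ) (ℕₚ.≤-reflexive (length-monomial ℓ))) (length-⊙ -1ℚ r (ℕₚ.m≤n⇒m≤1+n r≤))) ,
  λ x → begin
    x * x ^ suc ℓ - (x + -1ℚ) * (x + -1ℚ) ^ suc ℓ
      ≡⟨ lem₁ x (x ^ suc ℓ) ((x + -1ℚ) ^ suc ℓ) ⟩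
    x * x ^ ℓ + x * (x ^ suc ℓ - (x + -1ℚ) ^ suc ℓ) - (x ^ suc ℓ - (x + -1ℚ) ^ suc ℓ)
      ≡⟨ cong (λ z → x * x ^ ℓ + x * z - z) (e x) ⟩
    x * x ^ ℓ + x * (L * x ^ ℓ + eval r x) - (L * x ^ ℓ + eval r x)
      ≡⟨ lem₂ x (x ^ ℓ) L (eval r x) ⟩
    (L + 1ℚ) * (x * x ^ ℓ) + (0ℚ + x * eval r x + ((- L) * x ^ ℓ + -1ℚ * eval r x))
      ≡⟨ cong₂ (λ y z → y * (x * x ^ ℓ) + z) (sym (ι-suc (suc ℓ))) (sym (eval-r r x)) ⟩
    ι (suc (suc ℓ)) * (x * x ^ ℓ) + eval ((0ℚ ∷ r) ⊕ ((- L) ⊙ monomial ℓ ⊕ -1ℚ ⊙ r)) x ∎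
  where
  open ≡-Reasoning
  L : ℚ
  L = ι (suc ℓ)
  lem₁ : ∀ x y z → x * y - (x + -1ℚ) * z ≡ y + x * (y - z) - (y - z)
  lem₁ = solve-∀ ℚring
  lem₂ : ∀ x y l r → x * y + x * (l * y + r) - (l * y + r) ≡ (l + 1ℚ) * (x * y) + (0ℚ + x * r + ((- l) * y + -1ℚ * r))
  lem₂ = solve-∀ ℚring
  eval-r : ∀ r x → eval ((0ℚ ∷ r) ⊕ ((- L) ⊙ monomial ℓ ⊕ -1ℚ ⊙ r)) x ≡ 0ℚ + x * eval r x + ((- L) * x ^ ℓ + -1ℚ * eval r x)
  eval-r r x = trans (eval-⊕ (0ℚ ∷ r) ((- L) ⊙ monomial ℓ ⊕ -1ℚ ⊙ r) x) (cong (0ℚ + x * eval r x +_)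
    (trans (eval-⊕ ((- L) ⊙ monomial ℓ) (-1ℚ ⊙ r) x) (cong₂ _+_
      (trans (eval-⊙ (- L) (monomial ℓ) x) (cong ((- L) *_) (eval-monomial ℓ x))) (eval-⊙ -1ℚ r x))))

TailRep-powNeg-suc : ∀ b t → TailRep b (λ m → powNeg m (ℤ.+ suc t))
TailRep-powNeg-suc b t = tail $ Representable-≗ (Representable-σ′ (t ∷ b) (1ℚ ∷ [])) λ n N n≤N →
  trans (sym (S-∷ (ℤ.+ suc t) (map (λ t → ℤ.+ suc t) b) n N n≤N)) (lem (ι n) (σ′ (t ∷ b) n N))
  where
  lem : ∀ x s → s ≡ (1ℚ + x * 0ℚ) * s
  lem = solve-∀ ℚring

TailRep-powNeg : ∀ b → (∀ p → TailRep b (λ m → eval p (ι m))) → ∀ a → TailRep b (λ m → powNeg m a)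
TailRep-powNeg b R (ℤ.+ suc t) = TailRep-powNeg-suc b t
TailRep-powNeg b R (ℤ.+ zero) = TailRep-≗ (R (monomial 0)) λ m → sym (eval-monomial 0 (ι (suc m)))
TailRep-powNeg b R ℤ.-[1+ k ] = TailRep-≗ (R (monomial (suc k))) λ m → trans (sym (ι-def (suc m ℕ.^ suc k)))
  (trans (ι-^ (suc m) (suc k)) (sym (eval-monomial (suc k) (ι (suc m)))))

-- Horner's scheme: n^(-a) (c + n q) = c n^(-a) + n^(-(a-1)) q, so walking down the coefficient list
-- leaves only integer powers of n.
TailRep-powNeg*eval : ∀ b → (∀ p → TailRep b (λ m → eval p (ι m))) → ∀ p a → TailRep b (λ m → powNeg m a * eval p (ι m))
TailRep-powNeg*eval b R [] a = TailRep-≗ TailRep-0 λ m → *-zeroʳ (powNeg (suc m) a)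
TailRep-powNeg*eval b R (c ∷ cs) a = TailRep-≗
  (TailRep-+ (TailRep-* c (TailRep-powNeg b R a)) (TailRep-powNeg*eval b R cs (ℤ.pred a)))
  λ m → trans (lem (powNeg (suc m) a) c (ι (suc m)) (eval cs (ι (suc m))))
    (cong (λ z → c * powNeg (suc m) a + z * eval cs (ι (suc m))) (sym (powNeg-pred m a)))
  where
  lem : ∀ p c x e → p * (c + x * e) ≡ c * p + x * p * e
  lem = solve-∀ ℚring

-- The factor ρ dictates the two cases. For σ(∅) the difference m^ℓ - ρ(m) (m - 1)^ℓ keeps degree ℓ,
-- with leading coefficient 1 - 4 = -3, but acquires a multiple of 1/m, whose tail sum is σ(1). For
-- a nonempty index ρ = 1 and the degree drops, so the power ℓ + 1 is telescoped; the shift of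
-- σ(b,t) then leaves a tail sum over σ(b), available by recursion on the index.
TailRep-eval : ∀ b p → TailRep b (λ m → eval p (ι m))
TailRep-eval [] = TailRep-triangular [] λ ℓ → - 3ℚ , r ℓ , (λ ()) , r≤ ℓ ,
  TailRep-≗ (TailRep-+ (telescope ℓ) (TailRep-* (- (2ℚ * y₀ ℓ)) (TailRep-powNeg-suc [] 0))) (eq ℓ)
  where
  D y r : ℕ → Poly
  D ℓ = diff -1ℚ (monomial ℓ)
  y ℓ = shift -1ℚ (monomial ℓ)
  -- With (x - 1)^ℓ = y₀ + x y₁, the term 2 (x - 1)^ℓ / x of the telescoped weight splits into the
  -- polynomial 2 y₁ and the polar term 2 y₀ / x. The polar term is cancelled by -2 y₀ times the
  -- weight 1/x; the rest is -3 x^ℓ + r.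
  r ℓ = (- 4ℚ) ⊙ D ℓ ⊕ 2ℚ ⊙ drop 1 (y ℓ)
  y₀ : ℕ → ℚ
  y₀ ℓ = coeff (y ℓ) 0
  length-drop : ∀ {k} (q : Poly) → length q ℕ.≤ suc k → length (drop 1 q) ℕ.≤ k
  length-drop [] _ = z≤n
  length-drop (_ ∷ _) (s≤s q≤) = q≤
  eval-drop : ∀ q x → eval q x ≡ coeff q 0 + x * eval (drop 1 q) x
  eval-drop [] x = sym (trans (+-identityˡ (x * 0ℚ)) (*-zeroʳ x))
  eval-drop (_ ∷ _) x = refl
  monomial≤ : ∀ ℓ → length (monomial ℓ) ℕ.≤ suc ℓ
  monomial≤ ℓ = ℕₚ.≤-reflexive (length-monomial ℓ)
  r≤ : ∀ ℓ → length (r ℓ) ℕ.≤ ℓ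
  r≤ ℓ = length-⊕ ((- 4ℚ) ⊙ D ℓ) (2ℚ ⊙ drop 1 (y ℓ)) (length-⊙ (- 4ℚ) (D ℓ) (length-diff -1ℚ (monomial ℓ) (monomial≤ ℓ)))
    (length-⊙ 2ℚ (drop 1 (y ℓ)) (length-drop (y ℓ) (length-shift -1ℚ (monomial ℓ) (monomial≤ ℓ))))
  g : ℕ → ℕ → ℚ
  g ℓ m = ι m ^ ℓ - ρ₀ m * eval (y ℓ) (ι m)
  telescope : ∀ ℓ → TailRep [] (g ℓ)
  telescope ℓ = tail $ Representable-≗
    (Representable-+ (Representable-σ′ [] (-1ℚ ⊙ monomial ℓ)) (Representable-negligible (Negligible-^*binInv ℓ)))
    λ n N n≤N → begin
      T X n N                                       ≡⟨ lem₁ (T X n N) (f N N) ⟩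
      T X n N + f N N - f N N                       ≡⟨ cong (_- f N N) (sym (tail-unique X (λ n → f n N) N (λ n _ → step n N) n n≤N)) ⟩
      f n N - f N N                                 ≡⟨ lem₂ (ι n ^ ℓ) (ι N ^ ℓ) (binInv n) (binInv N) ⟩
      -1ℚ * ι n ^ ℓ * binInv n + ι N ^ ℓ * binInv N ≡⟨ cong (λ z → z * binInv n + ι N ^ ℓ * binInv N) (sym (trans (eval-⊙ -1ℚ (monomial ℓ) (ι n)) (cong (-1ℚ *_) (eval-monomial ℓ (ι n))))) ⟩
      eval (-1ℚ ⊙ monomial ℓ) (ι n) * binInv n + ι N ^ ℓ * binInv N ∎
    where
    open ≡-Reasoning
    X f : ℕ → ℕ → ℚ
    X m N = g ℓ m * σ′ [] m N
    f n N = - (ι n ^ ℓ * binInv n)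
    lem₁ : ∀ t f → t ≡ t + f - f
    lem₁ = solve-∀ ℚring
    lem₂ : ∀ a b s t → - (a * s) - (- (b * t)) ≡ -1ℚ * a * s + b * t
    lem₂ = solve-∀ ℚring
    lem₃ : ∀ a b ρ s → - (b * (ρ * s)) ≡ (a - ρ * b) * s + (- (a * s))
    lem₃ = solve-∀ ℚring
    step : ∀ n N → f n N ≡ X (suc n) N + f (suc n) N
    step n N = begin
      - (ι n ^ ℓ * binInv n)                             ≡⟨ cong (λ z → - (ι n ^ ℓ * z)) (binInv-suc n) ⟩
      - (ι n ^ ℓ * (ρ₀ (suc n) * binInv (suc n)))        ≡⟨ lem₃ (ι (suc n) ^ ℓ) (ι n ^ ℓ) (ρ₀ (suc n)) (binInv (suc n)) ⟩
      (ι (suc n) ^ ℓ - ρ₀ (suc n) * ι n ^ ℓ) * binInv (suc n) + f (suc n) N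
        ≡⟨ cong (λ z → (ι (suc n) ^ ℓ - ρ₀ (suc n) * z) * binInv (suc n) + f (suc n) N) (sym (trans (eval-shift-1 (monomial ℓ) n) (eval-monomial ℓ (ι n)))) ⟩
      X (suc n) N + f (suc n) N ∎
  eq : ∀ ℓ m → - 3ℚ * ι (suc m) ^ ℓ + eval (r ℓ) (ι (suc m)) ≡ g ℓ (suc m) + (- (2ℚ * y₀ ℓ)) * powNeg (suc m) (ℤ.+ 1)
  eq ℓ m = begin
    - 3ℚ * x ^ ℓ + eval (r ℓ) x
      ≡⟨ cong (- 3ℚ * x ^ ℓ +_) (trans (eval-⊕ ((- 4ℚ) ⊙ D ℓ) (2ℚ ⊙ drop 1 (y ℓ)) x) (cong₂ _+_ (eval-⊙ (- 4ℚ) (D ℓ) x) (eval-⊙ 2ℚ (drop 1 (y ℓ)) x))) ⟩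
    - 3ℚ * x ^ ℓ + (- 4ℚ * eval (D ℓ) x + 2ℚ * y₁)
      ≡⟨ cong (λ z → - 3ℚ * x ^ ℓ + (- 4ℚ * z + 2ℚ * y₁)) (trans (eval-diff -1ℚ (monomial ℓ) x) (cong₂ _-_ (sym (eval-shift -1ℚ (monomial ℓ) x)) (eval-monomial ℓ x))) ⟩
    - 3ℚ * x ^ ℓ + (- 4ℚ * (eval (y ℓ) x - x ^ ℓ) + 2ℚ * y₁)
      ≡⟨ lem₁ (x ^ ℓ) (eval (y ℓ) x) y₁ (y₀ ℓ) i ⟩
    x ^ ℓ - 4ℚ * eval (y ℓ) x + 2ℚ * (y₀ ℓ * i + 1ℚ * y₁) + (- (2ℚ * y₀ ℓ)) * i
      ≡⟨ cong (λ z → x ^ ℓ - 4ℚ * eval (y ℓ) x + 2ℚ * (y₀ ℓ * i + z * y₁) + (- (2ℚ * y₀ ℓ)) * i) (sym (ι-inv m)) ⟩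
    x ^ ℓ - 4ℚ * eval (y ℓ) x + 2ℚ * (y₀ ℓ * i + x * i * y₁) + (- (2ℚ * y₀ ℓ)) * i
      ≡⟨ lem₂ (x ^ ℓ) (eval (y ℓ) x) y₁ (y₀ ℓ) i x ⟩
    x ^ ℓ - 4ℚ * eval (y ℓ) x + 2ℚ * i * (y₀ ℓ + x * y₁) + (- (2ℚ * y₀ ℓ)) * i
      ≡⟨ cong (λ z → x ^ ℓ - 4ℚ * eval (y ℓ) x + 2ℚ * i * z + (- (2ℚ * y₀ ℓ)) * i) (sym (eval-drop (y ℓ) x)) ⟩
    x ^ ℓ - 4ℚ * eval (y ℓ) x + 2ℚ * i * eval (y ℓ) x + (- (2ℚ * y₀ ℓ)) * i
      ≡⟨ lem₃ (x ^ ℓ) (eval (y ℓ) x) i ((- (2ℚ * y₀ ℓ)) * i) ⟩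
    x ^ ℓ - (4ℚ - 2ℚ * i) * eval (y ℓ) x + (- (2ℚ * y₀ ℓ)) * i
      ≡⟨ cong (λ k → g ℓ (suc m) + (- (2ℚ * y₀ ℓ)) * invℕ k) (sym (ℕₚ.*-identityʳ (suc m))) ⟩
    g ℓ (suc m) + (- (2ℚ * y₀ ℓ)) * powNeg (suc m) (ℤ.+ 1) ∎
    where
    open ≡-Reasoning
    x y₁ i : ℚ
    x = ι (suc m)
    y₁ = eval (drop 1 (y ℓ)) x
    i = invℕ (suc m)
    lem₁ : ∀ a y y₁ y₀ i → - 3ℚ * a + (- 4ℚ * (y - a) + 2ℚ * y₁) ≡ a - 4ℚ * y + 2ℚ * (y₀ * i + 1ℚ * y₁) + (- (2ℚ * y₀)) * i
    lem₁ = solve-∀ ℚring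
    lem₂ : ∀ a y y₁ y₀ i x → a - 4ℚ * y + 2ℚ * (y₀ * i + x * i * y₁) + (- (2ℚ * y₀)) * i ≡ a - 4ℚ * y + 2ℚ * i * (y₀ + x * y₁) + (- (2ℚ * y₀)) * i
    lem₂ = solve-∀ ℚring
    lem₃ : ∀ a y i c → a - 4ℚ * y + 2ℚ * i * y + c ≡ a - (4ℚ - 2ℚ * i) * y + c
    lem₃ = solve-∀ ℚring
TailRep-eval (t ∷ b) = TailRep-triangular (t ∷ b) λ ℓ → let r , r≤ , e = x^1+ℓ-[x-1]^1+ℓ ℓ in
  ι (suc ℓ) , r , ι-suc≢0 ℓ , r≤ , TailRep-≗ (telescope (suc ℓ)) λ m → sym (e (ι (suc m)))
  where
  g : ℕ → ℕ → ℚ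
  g ℓ m = ι m ^ ℓ - (ι m + -1ℚ) ^ ℓ
  telescope : ∀ ℓ → TailRep (t ∷ b) (g ℓ)
  telescope ℓ = tail $ Representable-≗
    (Representable-+ (Representable-σ′ (t ∷ b) (-1ℚ ⊙ monomial ℓ)) (representable (TailRep-powNeg*eval b (TailRep-eval b) (shift -1ℚ (monomial ℓ)) (ℤ.+ suc t))))
    λ n N n≤N → begin
      T X n N                        ≡⟨ sym (+-identityʳ (T X n N)) ⟩
      T X n N + 0ℚ                   ≡⟨ cong (T X n N +_) (sym (end N)) ⟩
      T X n N + f N N                ≡⟨ sym (tail-unique X (λ n → f n N) N (λ n → step n N) n n≤N) ⟩
      f n N                          ≡⟨ cong (λ z → z * σ′ (t ∷ b) n N + T Y n N) (sym (trans (eval-⊙ -1ℚ (monomial ℓ) (ι n)) (cong (-1ℚ *_) (eval-monomial ℓ (ι n))))) ⟩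
      eval (-1ℚ ⊙ monomial ℓ) (ι n) * σ′ (t ∷ b) n N + T Y n N ∎
    where
    open ≡-Reasoning
    X Y f : ℕ → ℕ → ℚ
    X m N = g ℓ m * σ′ (t ∷ b) m N
    Y m N = powNeg m (ℤ.+ suc t) * eval (shift -1ℚ (monomial ℓ)) (ι m) * σ′ b m N
    -- The product rule: one step of the first summand also produces a multiple of σ(b), which `T Y`
    -- compensates. Both summands are empty sums at n = N, so this telescoping has no boundary term.
    f n N = -1ℚ * ι n ^ ℓ * σ′ (t ∷ b) n N + T Y n N
    end : ∀ N → f N N ≡ 0ℚ
    end N = trans (cong₂ (λ y z → -1ℚ * ι N ^ ℓ * y + z) (S-diag (ℤ.+ suc t) (map (λ t → ℤ.+ suc t) b) N) (T-diag Y N)) (lem (ι N ^ ℓ))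
      where
      lem : ∀ a → -1ℚ * a * 0ℚ + 0ℚ ≡ 0ℚ
      lem = solve-∀ ℚring
    step : ∀ n N → n ℕ.< N → f n N ≡ X (suc n) N + f (suc n) N
    step n N n<N = begin
      -1ℚ * a * σ′ (t ∷ b) n N + T Y n N
        ≡⟨ cong₂ (λ y z → -1ℚ * a * y + z) (S-suc (ℤ.+ suc t) (map (λ t → ℤ.+ suc t) b) n N n<N) (T-suc Y n N n<N) ⟩
      -1ℚ * a * (s + p * s′) + (p * eval (shift -1ℚ (monomial ℓ)) (ι (suc n)) * s′ + T Y (suc n) N)
        ≡⟨ cong (λ z → -1ℚ * a * (s + p * s′) + (p * z * s′ + T Y (suc n) N)) (trans (eval-shift-1 (monomial ℓ) n) (eval-monomial ℓ (ι n))) ⟩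
      -1ℚ * a * (s + p * s′) + (p * a * s′ + T Y (suc n) N)
        ≡⟨ lem a (ι (suc n) ^ ℓ) s p s′ (T Y (suc n) N) ⟩
      (ι (suc n) ^ ℓ - a) * s + (-1ℚ * ι (suc n) ^ ℓ * s + T Y (suc n) N)
        ≡⟨ cong (λ z → (ι (suc n) ^ ℓ - z ^ ℓ) * s + f (suc n) N) (sym (ι-suc-1 n)) ⟩
      X (suc n) N + f (suc n) N ∎
      where
      a s p s′ : ℚ
      a = ι n ^ ℓ
      s = σ′ (t ∷ b) (suc n) N
      p = powNeg (suc n) (ℤ.+ suc t)
      s′ = σ′ b (suc n) N
      lem : ∀ a a′ s p s′ y → -1ℚ * a * (s + p * s′) + (p * a * s′ + y) ≡ (a′ - a) * s + (-1ℚ * a′ * s + y)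
      lem = solve-∀ ℚring

Representable-T-powNeg : ∀ a {X} → Representable X → Representable (T (λ m N → powNeg m a * X m N))
Representable-T-powNeg a {X} (represent F negl) = Representable-≗
  (Representable-+ (go F) (Representable-negligible (Negligible-T (Negligible-powNeg* a negl))))
  λ n N _ → trans (T-cong (λ m N → powNeg m a * X m N) (λ m N → powNeg m a * val F m N + powNeg m a * (X m N - val F m N))
      (λ m N _ → lem (powNeg (suc m) a) (X (suc m) N) (val F (suc m) N)) n N)
    (T-+ (λ m N → powNeg m a * val F m N) (λ m N → powNeg m a * (X m N - val F m N)) n N)
  where
  lem : ∀ p x v → p * x ≡ p * v + p * (x - v)
  lem = solve-∀ ℚring
  go : ∀ F → Representable (T (λ m N → powNeg m a * val F m N))
  go [] = Representable-negligible (Negligible-≗ Negligible-0 λ n N _ → Σ<-zero (N ∸ n) λ j _ → *-zeroʳ (powNeg (suc (n ℕ.+ j)) a))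
  go ((b , p) ∷ F) = Representable-≗ (Representable-+ (representable (TailRep-powNeg*eval b (TailRep-eval b) p a)) (go F))
    λ n N _ → trans (T-cong (λ m N → powNeg m a * (eval p (ι m) * σ′ b m N + val F m N))
        (λ m N → powNeg m a * eval p (ι m) * σ′ b m N + powNeg m a * val F m N)
        (λ m N _ → lem₂ (powNeg (suc m) a) (eval p (ι (suc m))) (σ′ b (suc m) N) (val F (suc m) N)) n N)
      (T-+ (λ m N → powNeg m a * eval p (ι m) * σ′ b m N) (λ m N → powNeg m a * val F m N) n N)
    where
    lem₂ : ∀ w p s v → w * (p * s + v) ≡ w * p * s + w * v
    lem₂ = solve-∀ ℚring

Representable-S : ∀ a → Representable (S a)
Representable-S [] = Representable-≗ (Representable-σ′ [] (1ℚ ∷ [])) λ n N _ → lem (ι n) (σ′ [] n N)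
  where
  lem : ∀ x s → s ≡ (1ℚ + x * 0ℚ) * s
  lem = solve-∀ ℚring
Representable-S (a ∷ as) = Representable-≗ (Representable-T-powNeg a (Representable-S as)) λ n N n≤N → S-∷ a as n N n≤N

-- Families

-- Reversed lists of exponents minus one correspond bijectively to compositions; unlike
-- compositions, they carry no positivity proofs.
encode : List ℕ → List ℕ
encode b = reverse (map suc b)

decode : List ℕ → List ℕ
decode c = map ℕ.pred (reverse c)

All-reverse : ∀ {P : ℕ → Set} (c : List ℕ) → All P c → All P (reverse c)
All-reverse [] [] = []
All-reverse (x ∷ c) (px ∷ pc) rewrite unfold-reverse x c = Allₚ.++⁺ (All-reverse c pc) (px ∷ [])

encode-IsComposition : ∀ b → IsComposition (encode b)
encode-IsComposition b = All-reverse (map suc b) (Allₚ.map⁺ (All.universal (λ _ → s≤s z≤n) b))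

decode-encode : ∀ b → decode (encode b) ≡ b
decode-encode b = trans (cong (map ℕ.pred) (reverse-involutive (map suc b))) (trans (sym (map-∘ b)) (map-id b))

encode-decode : ∀ c → IsComposition c → encode (decode c) ≡ c
encode-decode c pos = trans (cong reverse (suc-pred (reverse c) (All-reverse c pos))) (reverse-involutive c)
  where
  suc-pred : ∀ c → IsComposition c → map suc (map ℕ.pred c) ≡ c
  suc-pred [] [] = refl
  suc-pred (suc x ∷ c) (_ ∷ pos) = cong (suc x ∷_) (suc-pred c pos)

σTrunc-encode : ∀ b n N → σTrunc (map ℤ.+_ (encode b)) n N ≡ σ′ b n N
σTrunc-encode b n N = cong (λ l → σTrunc l n N) (trans (reverse-map ℤ.+_ (map suc b)) (cong reverse (sym (map-∘ b))))

toFamily : Combination → Family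
toFamily = map λ (b , p) → (encode b , encode-IsComposition b) , p

famTrunc-toFamily : ∀ F n N → famTrunc (toFamily F) n N ≡ val F n N
famTrunc-toFamily [] n N = refl
famTrunc-toFamily ((b , p) ∷ F) n N =
  cong₂ _+_ (cong₂ _*_ (cong (eval p) (sym (ι-def n))) (σTrunc-encode b n N)) (famTrunc-toFamily F n N)

fromFamily : Family → Combination
fromFamily = map λ ((c , _) , p) → decode c , p

val-fromFamily : ∀ G n N → val (fromFamily G) n N ≡ famTrunc G n N
val-fromFamily [] n N = refl
val-fromFamily (((c , pos) , p) ∷ G) n N = cong₂ _+_
  (cong₂ _*_ (cong (eval p) (ι-def n)) (trans (sym (σTrunc-encode (decode c) n N)) (cong (λ l → σTrunc (map ℤ.+_ l) n N) (encode-decode c pos))))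
  (val-fromFamily G n N)

-- Collecting the entries of a family, and uniqueness

only : ∀ {c b : List ℕ} → Dec (c ≡ b) → Poly → Poly
only (yes _) p = p
only (no _)  p = []

polyAt : Combination → List ℕ → Poly
polyAt []            b = []
polyAt ((c , p) ∷ F) b = only (≡-dec ℕ._≟_ c b) p ⊕ polyAt F b

coeff-polyAt : ∀ G b k → famCoeff G (encode b) k ≡ coeff (polyAt (fromFamily G) b) k
coeff-polyAt [] b k = refl
coeff-polyAt (((c , pos) , p) ∷ G) b k with ≡-dec ℕ._≟_ c (encode b) | ≡-dec ℕ._≟_ (decode c) b
... | yes _     | yes _     = trans (cong (coeff p k +_) (coeff-polyAt G b k)) (sym (coeff-⊕ p (polyAt (fromFamily G) b) k))
... | no _      | no _      = coeff-polyAt G b k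
... | yes refl  | no decode≢ = contradiction (decode-encode b) decode≢
... | no ≢encode | yes refl  = contradiction (sym (encode-decode c pos)) ≢encode

-- Coefficients are compared at every list of naturals, including lists with a zero entry, which no
-- entry of a family carries.
famCoeff-¬IsComposition : ∀ G b k → (IsComposition b → ⊥) → famCoeff G b k ≡ 0ℚ
famCoeff-¬IsComposition [] b k ¬pos = refl
famCoeff-¬IsComposition (((c , pos) , p) ∷ G) b k ¬pos with ≡-dec ℕ._≟_ c b
... | yes refl = contradiction pos ¬pos
... | no _ = famCoeff-¬IsComposition G b k ¬pos

-- A single number that dominates both the length and every exponent, so that one K can bound the
-- depth and the exponents at once.
weight : List ℕ → ℕ
weight []      = 0
weight (t ∷ b) = suc t ℕ.+ weight b

size : Combination → ℕ
size []            = 0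
size ((b , _) ∷ F) = weight b ℕ.+ size F

length≤weight : ∀ b → length b ℕ.≤ weight b
length≤weight [] = z≤n
length≤weight (t ∷ b) = s≤s (ℕₚ.≤-trans (length≤weight b) (ℕₚ.m≤n+m (weight b) t))

Σ<-single : ∀ K {f : ℕ → ℚ} t → t ℕ.< K → (∀ u → u ≢ t → f u ≡ 0ℚ) → Σ< K f ≡ f t
Σ<-single (suc K) {f} t t<1+K else≡0 with t ℕ.≟ K
... | yes refl = trans (cong (_+ f t) (Σ<-zero t λ u u<t → else≡0 u (ℕₚ.<⇒≢ u<t))) (+-identityˡ (f t))
... | no t≢K = trans (cong₂ _+_ (Σ<-single K t (ℕₚ.≤∧≢⇒< (ℕₚ.≤-pred t<1+K) t≢K) else≡0) (else≡0 K (≢-sym t≢K))) (+-identityʳ (f t))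

module _ (K : ℕ) where
  open Levels K
  open Independence K

  weight≤⇒Level : ∀ b → weight b ℕ.≤ K → Level (length b) b
  weight≤⇒Level [] _ = []
  weight≤⇒Level (t ∷ b) w≤ = ℕₚ.m+n≤o⇒m≤o (suc t) w≤ ∷ weight≤⇒Level b (ℕₚ.m+n≤o⇒n≤o (suc t) w≤)

  ΣLevel-single : ∀ {r} g c → Level r c → (∀ b → b ≢ c → g b ≡ 0ℚ) → ΣLevel r g ≡ g c
  ΣLevel-single g [] [] _ = refl
  ΣLevel-single g (t ∷ c) (t<K ∷ l) else≡0 = trans
    (ΣLevel-single (λ b → Σ< K (λ u → g (u ∷ b))) c l λ b b≢c → Σ<-zero K λ u _ → else≡0 (u ∷ b) λ { refl → b≢c refl })
    (Σ<-single K t t<K λ u u≢t → else≡0 (u ∷ c) λ { refl → u≢t refl })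

  Σ≤Level-zero : ∀ r {g} → (∀ j b → j ℕ.≤ r → Level j b → g b ≡ 0ℚ) → Σ≤Level r g ≡ 0ℚ
  Σ≤Level-zero zero e = e 0 [] z≤n []
  Σ≤Level-zero (suc r) e = cong₂ _+_ (Σ≤Level-zero r (λ j b j≤r → e j b (ℕₚ.m≤n⇒m≤1+n j≤r))) (ΣLevel-zero (suc r) (λ b → e (suc r) b ℕₚ.≤-refl))

  Σ≤Level-single : ∀ r {j} g c → j ℕ.≤ r → Level j c → (∀ b → b ≢ c → g b ≡ 0ℚ) → Σ≤Level r g ≡ g c
  Σ≤Level-single zero g [] z≤n [] _ = refl
  Σ≤Level-single (suc r) {j} g c j≤ l else≡0 with j ℕ.≟ suc r
  ... | yes refl = trans (cong₂ _+_
          (Σ≤Level-zero r λ i b i≤r l′ → else≡0 b λ { refl → ℕₚ.<⇒≢ (s≤s i≤r) (trans (sym (Level-length l′)) (Level-length l)) })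
          (ΣLevel-single g c l else≡0)) (+-identityˡ (g c))
  ... | no j≢ = trans (cong₂ _+_ (Σ≤Level-single r g c (ℕₚ.≤-pred (ℕₚ.≤∧≢⇒< j≤ j≢)) l else≡0)
          (ΣLevel-zero (suc r) λ b l′ → else≡0 b λ { refl → j≢ (trans (sym (Level-length l)) (Level-length l′)) })) (+-identityʳ (g c))

  -- Each entry is a sum over all indices with a single nonzero term; adding these sums collects
  -- repeated occurrences of an index.
  val≡Σ≤Level : ∀ F → size F ℕ.≤ K → ∀ n N → val F n N ≡ Σ≤Level K (λ b → eval (polyAt F b) (ι n) * σ′ b n N)
  val≡Σ≤Level [] _ n N = sym (Σ≤Level-zero K λ j b _ _ → *-zeroˡ (σ′ b n N))
  val≡Σ≤Level ((c , p) ∷ F) s≤ n N = sym (begin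
    Σ≤Level K (λ b → eval (only (≡-dec ℕ._≟_ c b) p ⊕ polyAt F b) x * σ′ b n N)
      ≡⟨ Σ≤Level-cong K (λ j b _ _ → trans (cong (_* σ′ b n N) (eval-⊕ (only (≡-dec ℕ._≟_ c b) p) (polyAt F b) x))
           (*-distribʳ-+ (σ′ b n N) (eval (only (≡-dec ℕ._≟_ c b) p) x) (eval (polyAt F b) x))) ⟩
    Σ≤Level K (λ b → g b + eval (polyAt F b) x * σ′ b n N)
      ≡⟨ Σ≤Level-+ K g (λ b → eval (polyAt F b) x * σ′ b n N) ⟩
    Σ≤Level K g + Σ≤Level K (λ b → eval (polyAt F b) x * σ′ b n N)
      ≡⟨ cong₂ _+_ (trans (Σ≤Level-single K g c (ℕₚ.≤-trans (length≤weight c) w≤) (weight≤⇒Level c w≤) (λ b b≢c → elsewhere b b≢c (≡-dec ℕ._≟_ c b))) (here (≡-dec ℕ._≟_ c c)))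
           (sym (val≡Σ≤Level F (ℕₚ.m+n≤o⇒n≤o (weight c) s≤) n N)) ⟩
    eval p x * σ′ c n N + val F n N ∎)
    where
    open ≡-Reasoning
    x : ℚ
    x = ι n
    g : List ℕ → ℚ
    g b = eval (only (≡-dec ℕ._≟_ c b) p) x * σ′ b n N
    w≤ : weight c ℕ.≤ K
    w≤ = ℕₚ.m+n≤o⇒m≤o (weight c) s≤
    elsewhere : ∀ b → b ≢ c → (d : Dec (c ≡ b)) → eval (only d p) x * σ′ b n N ≡ 0ℚ
    elsewhere b b≢c (yes c≡b) = contradiction (sym c≡b) b≢c
    elsewhere b b≢c (no _) = *-zeroˡ (σ′ b n N)
    here : (d : Dec (c ≡ c)) → eval (only d p) x * σ′ c n N ≡ eval p x * σ′ c n N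
    here (yes _) = refl
    here (no c≢c) = contradiction refl c≢c

  coeff-unique : ∀ F G → size F ℕ.≤ K → size G ℕ.≤ K → (∀ n → Tends0 (λ N → val F n N - val G n N)) →
    ∀ b → weight b ℕ.≤ K → ∀ k → coeff (polyAt F b) k ≡ coeff (polyAt G b) k
  coeff-unique F G F≤ G≤ F-G→0 b w≤ = uncurry (agree⇒coeff≡ (polyAt F b) (polyAt G b)) (Ev-map (λ n → -≡0⇒≡)
    (independent K H (1ℚ ∷ [] , (0 , λ n _ e → 1≢0 (trans (sym (lem₀ (ι n))) e)) , cd) rel (length b) b (ℕₚ.≤-trans (length≤weight b) w≤) (weight≤⇒Level b w≤)))
    where
    H : List ℕ → ℕ → ℚ
    H b n = eval (polyAt F b) (ι n) - eval (polyAt G b) (ι n)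
    lem₀ : ∀ x → 1ℚ + x * 0ℚ ≡ 1ℚ
    lem₀ = solve-∀ ℚring
    lem₁ : ∀ f g → f - g ≡ f + -1ℚ * g
    lem₁ = solve-∀ ℚring
    lem₂ : ∀ f g s → (f - g) * s ≡ f * s + -1ℚ * (g * s)
    lem₂ = solve-∀ ℚring
    cd : ∀ b → EvPoly (λ n → eval (1ℚ ∷ []) (ι n) * H b n)
    cd b = EvPoly-* (EvPoly-poly (1ℚ ∷ [])) (EvPoly-≗ (EvPoly-+ (EvPoly-poly (polyAt F b)) (EvPoly-* (EvPoly-const -1ℚ) (EvPoly-poly (polyAt G b))))
      (0 , λ n _ → lem₁ (eval (polyAt F b) (ι n)) (eval (polyAt G b) (ι n))))
    rel : Relation K H
    rel = 0 , λ n _ → Tends0-≗ (F-G→0 n) (0 , λ N _ → begin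
      Σ≤Level K (λ b → H b n * σ′ b n N)
        ≡⟨ Σ≤Level-cong K (λ j b _ _ → lem₂ (eval (polyAt F b) (ι n)) (eval (polyAt G b) (ι n)) (σ′ b n N)) ⟩
      Σ≤Level K (λ b → eval (polyAt F b) (ι n) * σ′ b n N + -1ℚ * (eval (polyAt G b) (ι n) * σ′ b n N))
        ≡⟨ Σ≤Level-+ K (λ b → eval (polyAt F b) (ι n) * σ′ b n N) (λ b → -1ℚ * (eval (polyAt G b) (ι n) * σ′ b n N)) ⟩
      Σ≤Level K (λ b → eval (polyAt F b) (ι n) * σ′ b n N) + Σ≤Level K (λ b → -1ℚ * (eval (polyAt G b) (ι n) * σ′ b n N))
        ≡⟨ cong₂ _+_ (sym (val≡Σ≤Level F F≤ n N)) (trans (Σ≤Level-* K -1ℚ (λ b → eval (polyAt G b) (ι n) * σ′ b n N)) (cong (-1ℚ *_) (sym (val≡Σ≤Level G G≤ n N)))) ⟩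
      val F n N + -1ℚ * val G n N
        ≡⟨ sym (lem₁ (val F n N) (val G n N)) ⟩
      val F n N - val G n N ∎)
      where open ≡-Reasoning

famCoeff-unique : ∀ G H → (∀ n → Tends0 (λ N → famTrunc G n N - famTrunc H n N)) → ∀ b k → famCoeff G b k ≡ famCoeff H b k
famCoeff-unique G H G-H→0 c k with All.all? (λ x → 0 ℕ.<? x) c
... | no ¬pos = trans (famCoeff-¬IsComposition G c k ¬pos) (sym (famCoeff-¬IsComposition H c k ¬pos))
... | yes pos = begin
  famCoeff G c k                            ≡⟨ cong (λ c → famCoeff G c k) (sym (encode-decode c pos)) ⟩
  famCoeff G (encode b) k                   ≡⟨ coeff-polyAt G b k ⟩
  -- The bound includes the weight of `b` itself, as `b` need not occur in either family.
  coeff (polyAt (fromFamily G) b) k         ≡⟨ coeff-unique (g ℕ.+ (h ℕ.+ w)) (fromFamily G) (fromFamily H)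
                                                 (ℕₚ.m≤m+n g (h ℕ.+ w)) (ℕₚ.≤-trans (ℕₚ.m≤m+n h w) (ℕₚ.m≤n+m (h ℕ.+ w) g))
                                                 (λ n → Tends0-≗ (G-H→0 n) (0 , λ N _ → cong₂ _-_ (val-fromFamily G n N) (val-fromFamily H n N)))
                                                 b (ℕₚ.≤-trans (ℕₚ.m≤n+m w h) (ℕₚ.m≤n+m (h ℕ.+ w) g)) k ⟩
  coeff (polyAt (fromFamily H) b) k         ≡⟨ sym (coeff-polyAt H b k) ⟩
  famCoeff H (encode b) k                   ≡⟨ cong (λ c → famCoeff H c k) (encode-decode c pos) ⟩
  famCoeff H c k                            ∎
  where
  open ≡-Reasoning
  b : List ℕ
  b = decode c
  g h w : ℕ
  g = size (fromFamily G)
  h = size (fromFamily H)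
  w = weight b

theorem3 : (a : List ℤ) →
    Σ Family (λ F →
    ((n : ℕ) → Represents a F n) ×
    ((G : Family) → ((n : ℕ) → Represents a G n) →
    (b : List ℕ) (k : ℕ) → famCoeff G b k ≡ famCoeff F b k))
theorem3 a = toFamily F , represents , λ G G-represents → famCoeff-unique G (toFamily F) λ n →
    Tends0-≗ (Tends0-+ (represents n) (Tends0-* -1ℚ (G-represents n)))
      (0 , λ N _ → lem (σTrunc a n N) (famTrunc G n N) (famTrunc (toFamily F) n N))
  where
  open Representable (Representable-S (reverse a)) renaming (combination to F)
  represents : ∀ n → Represents a (toFamily F) n
  represents n = Tends0-≗ (Negligible⇒Tends0 remainder n) (0 , λ N _ →
    cong₂ _-_ (cong (λ l → σTrunc l n N) (sym (reverse-involutive a))) (famTrunc-toFamily F n N))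
  lem : ∀ s g f → g - f ≡ (s - f) + -1ℚ * (s - g)
  lem = solve-∀ ℚring
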